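{- Let $q\equiv 3\pmod 4$ be a prime power, let $a\in\mathbb{F}_q^*$ be a square in $\mathbb{F}_q^*$, let $b\in\mathbb{F}_q$ satisfy $b^2=a$, and let $n$ be an odd positive integer such that $\operatorname{rad}(n+1)$ divides $q-1$. Then for every irreducible factor $f(x)$ of $E_n(x,a)$ in $\mathbb{F}_q[x]$ there exist $\alpha\in\mathbb{F}_{q^2}^*$ and a positive divisor $t$ of $\frac{2(n+1)}{\gcd(2(n+1),q-1)}$ satisfying (i) $\alpha^{2(n+1)/t}=1$, (ii) $\operatorname{rad}(t)$ divides $\operatorname{ord}_{q^2}(\alpha)$, (iii) $\gcd\left(t,\frac{q^2-1}{\operatorname{ord}_{q^2}(\alpha)}\right)=1$, (iv) $(\alpha,t)\notin\{(1,1),(-1,1)\}$, such that $f(x)$ has the following form: (a) $f(x)=D_t(x,a)-b^t(\alpha+\alpha^{ -1})$ in the case that $\alpha\in\mathbb{F}_q^*$ or $\alpha^{q+1}=1$; (b) $f(x)=\left(D_t(x,a)-b^t(\alpha+\alpha^{ -1})\right)\left(D_t(x,a)-b^t(\alpha^q+\alpha^{ -q})\right)$ in the case that $\alpha$ satisfies neither of the conditions in (a).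
   Context: For $n\ge 1$ and $a\in\mathbb{F}_q$, the $n$-th Dickson polynomials of the first and second kind with parameter $a$ are $D_n(x,a)=\sum_{i=0}^{\lfloor n/2\rfloor}\frac{n}{n-i}\binom{n-i}{i}(-a)^i x^{n-2i}$ and $E_n(x,a)=\sum_{i=0}^{\lfloor n/2\rfloor}\binom{n-i}{i}(-a)^i x^{n-2i}$ in $\mathbb{F}_q[x]$ (the numbers $\frac{n}{n-i}\binom{n-i}{i}$ are integers, viewed in $\mathbb{F}_q$). $\operatorname{rad}(n)$ is the product of the distinct primes dividing $n$, with $\operatorname{rad}(1)=1$. $\operatorname{ord}_{q^2}(\alpha)$ is the multiplicative order of $\alpha$ in the cyclic group $\mathbb{F}_{q^2}^*$. Irreducible factors are normalized to be monic. -}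

module Defs where

open import Algebra.Bundles using (CommutativeRing; RawSemiring)
open import Algebra.Morphism.Structures using (module RingMorphisms)
import Algebra.Definitions.RawSemiring as RawSemiringDefinitions
import Algebra.Properties.Semiring.Exp as SemiringExp
import Algebra.Properties.Semiring.Mult as SemiringMult
open import Data.Fin.Base using (Fin)
open import Data.List.Base using (List; []; _∷_; _++_; map; filter; foldr; replicate; applyUpTo; upTo)
open import Data.Nat.Base as ℕ using (ℕ; zero; suc; _∸_; _<_; _≤_; ⌊_/2⌋)
open import Data.Nat.Combinatorics using (_C_)
open import Data.Nat.Divisibility using (_∣_; _∣?_)
open import Data.Nat.ListAction using (product)
open import Data.Nat.Primality using (Prime; prime?)
open import Data.Product.Base using (∃-syntax; _×_; _,_; proj₁)
open import Function.Bundles using (Inverse)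
open import Level using (Level; _⊔_) renaming (suc to lsuc)
open import Relation.Binary.PropositionalEquality.Core using (_≡_)
open import Relation.Binary.PropositionalEquality.Properties using (setoid)
open import Relation.Nullary.Decidable.Core using (_×-dec_)
open import Relation.Nullary.Negation.Core using (¬_)

private
  variable
    c ℓ : Level

-- Division made total by the junk value m div 0 = 0.  It is only applied to
-- positive divisors that divide the dividend, where it is the exact quotient.
infixl 7 _div_
_div_ : ℕ → ℕ → ℕ
m div zero  = 0
m div suc n = m ℕ./ suc n

IsPrimePower : ℕ → Set
IsPrimePower q = ∃[ p ] ∃[ k ] Prime p × 0 < k × q ≡ p ℕ.^ k

-- Only meaningful for n ≥ 1: every divisor of such an n is at most n.
rad : ℕ → ℕ
rad n = product (filter (λ p → prime? p ×-dec (p ∣? n)) (upTo (suc n)))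

-- The finite fields considered here have decidable equality, so the classical
-- definition of a field is adequate and no apartness relation is carried.
record Field c ℓ : Set (lsuc (c ⊔ ℓ)) where
  field
    commutativeRing : CommutativeRing c ℓ

  open CommutativeRing commutativeRing public
  open SemiringExp semiring public using (_^_)

  field
    1≉0        : ¬ (1# ≈ 0#)
    invertible : ∀ x → ¬ (x ≈ 0#) → ∃[ y ] x * y ≈ 1#

  inv : ∀ x → ¬ (x ≈ 0#) → Carrier
  inv x x≉0 = proj₁ (invertible x x≉0)

  record IsMultiplicativeOrder (x : Carrier) (d : ℕ) : Set ℓ where
    field
      positive : 0 < d
      power≈1  : x ^ d ≈ 1#
      minimal  : ∀ m → 0 < m → x ^ m ≈ 1# → d ≤ m

HasCardinality : Field c ℓ → ℕ → Set (c ⊔ ℓ)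
HasCardinality F q = Inverse (Field.setoid F) (setoid (Fin q))

-- A polynomial is its list of coefficients, constant term first.  Trailing
-- zeros are allowed; they are invisible to _≈ₚ_.
module Polynomial (F : Field c ℓ) where
  open Field F
  open SemiringMult semiring using () renaming (_×_ to _·_)

  Poly : Set c
  Poly = List Carrier

  coeff : Poly → ℕ → Carrier
  coeff []      _       = 0#
  coeff (x ∷ f) zero    = x
  coeff (x ∷ f) (suc i) = coeff f i

  infix 4 _≈ₚ_
  record _≈ₚ_ (f g : Poly) : Set ℓ where
    constructor coefficientwise
    field
      coeff-≈ : ∀ i → coeff f i ≈ coeff g i

  infixl 6 _+ₚ_ _-ₚ_
  infixl 7 _*ₚ_

  _+ₚ_ : Poly → Poly → Poly
  []      +ₚ g       = g
  (x ∷ f) +ₚ []      = x ∷ f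
  (x ∷ f) +ₚ (y ∷ g) = (x + y) ∷ (f +ₚ g)

  _-ₚ_ : Poly → Poly → Poly
  f -ₚ g = f +ₚ map -_ g

  _*ₚ_ : Poly → Poly → Poly
  []      *ₚ g = []
  (x ∷ f) *ₚ g = map (x *_) g +ₚ (0# ∷ (f *ₚ g))

  constant : Carrier → Poly
  constant x = x ∷ []

  rawSemiringₚ : RawSemiring c ℓ
  rawSemiringₚ = record
    { Carrier = Poly
    ; _≈_     = _≈ₚ_
    ; _+_     = _+ₚ_
    ; _*_     = _*ₚ_
    ; 0#      = []
    ; 1#      = constant 1#
    }

  open RawSemiringDefinitions rawSemiringₚ public
    using (Irreducible) renaming (_∣_ to _∣ₚ_)

  Monic : Poly → Set ℓ
  Monic f = ∃[ d ] coeff f d ≈ 1# × (∀ i → d < i → coeff f i ≈ 0#)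

  monomial : Carrier → ℕ → Poly
  monomial x k = replicate k 0# ++ (x ∷ [])

  sumUpTo : ℕ → (ℕ → Poly) → Poly
  sumUpTo m f = foldr _+ₚ_ [] (applyUpTo f (suc m))

  -- dicksonD n is the Dickson polynomial of the first kind for n ≥ 1 only:
  -- then n ∸ i is positive for i ≤ ⌊ n /2⌋ and divides n * ((n ∸ i) C i).
  dicksonD : ℕ → Carrier → Poly
  dicksonD n a = sumUpTo ⌊ n /2⌋ λ i →
    monomial (((n ℕ.* ((n ∸ i) C i)) div (n ∸ i)) · ((- a) ^ i)) (n ∸ 2 ℕ.* i)

  dicksonE : ℕ → Carrier → Poly
  dicksonE n a = sumUpTo ⌊ n /2⌋ λ i →
    monomial (((n ∸ i) C i) · ((- a) ^ i)) (n ∸ 2 ℕ.* i)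

-- Injectivity is automatic for a ring homomorphism between fields.
IsFieldEmbedding : ∀ {c₁ ℓ₁ c₂ ℓ₂} (F : Field c₁ ℓ₁) (K : Field c₂ ℓ₂) →
                   (Field.Carrier F → Field.Carrier K) → Set (c₁ ⊔ ℓ₁ ⊔ ℓ₂)
IsFieldEmbedding F K = RingMorphisms.IsRingHomomorphism (Field.rawRing F) (Field.rawRing K)

-- Over an extension, E_n (b (ζ + ζ⁻¹), b²) (ζ - ζ⁻¹) = b ^ n (ζ ^ (n + 1) - ζ ^ -(n + 1)),
-- so a root of f is x₀ = b (ζ + ζ⁻¹) with ζ ^ 2(n + 1) = 1 and ζ ≠ ±1.  Such a
-- ζ is the class of X modulo a prime factor, over 𝔽_q², of
-- X ^ deg f * f (b (X + X⁻¹)).  Let m be the order of ζ, Q = q ^ 2,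
-- d = gcd m (Q - 1), t = m / d and α = ζ ^ t.  Then α ^ d = 1, hence α ∈ 𝔽_q²,
-- and D_t (x₀, a) = b ^ t (α + α⁻¹).  Every prime factor of m divides Q - 1 and
-- 4 ∣ Q - 1, so by lifting the exponent m ∣ Q ^ i - 1 implies t ∣ i, and
-- therefore x₀ ^ (Q ^ i) = x₀ implies t ∣ i; if b ^ t (α + α⁻¹) is not in 𝔽_q,
-- moreover x₀ ^ (q ^ i) = x₀ implies 2t ∣ i.  Thus the asserted polynomial,
-- which has coefficients in 𝔽_q and the root x₀, has as many distinct roots
-- among the conjugates of x₀ as its degree.  They are also roots of f, so it
-- divides f and, f being irreducible, equals f.

module Submission where

open import Defs
open import Algebra.Bundles using (CommutativeRing; RawRing)
open import Algebra.Definitions.RawMagma using (_,_)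
open import Algebra.Morphism.Structures using (module RingMorphisms)
import Algebra.Morphism.Construct.Composition as Composition
import Algebra.Properties.AbelianGroup as AbelianGroupProperties
import Algebra.Properties.CommutativeMonoid.Sum as CommutativeMonoidSum
import Algebra.Properties.CommutativeSemiring.Binomial as Binomial
import Algebra.Properties.CommutativeSemiring.Exp as CommutativeExp
import Algebra.Properties.Group as GroupProperties
import Algebra.Properties.Ring as RingProperties
import Algebra.Properties.Semiring.Exp as SemiringExp
import Algebra.Properties.Semiring.Mult as SemiringMult
import Algebra.Properties.Semiring.Mult.TCOptimised as SemiringMultTC
import Algebra.Properties.Semiring.Sum as SemiringSum
import Algebra.Solver.Ring
import Algebra.Solver.Ring.AlmostCommutativeRing as ACR
import Algebra.Solver.Ring.NaturalCoefficients.Default as NaturalSolver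
open import Data.Fin.Base as Fin using (Fin; toℕ; fromℕ; inject₁; punchIn)
open import Data.Fin.Permutation using (Permutation; permutation; _⟨$⟩ʳ_)
import Data.Fin.Properties as Fin
open import Data.List.Base using (List; []; _∷_; length; tabulate; map; take; drop; applyUpTo; foldr)
open import Data.List.Properties using (length-tabulate; length-map; length-take; length-applyUpTo; map-∘)
open import Data.List.Relation.Unary.All as All using (All; []; _∷_)
import Data.List.Relation.Unary.All.Properties as Allₚ
open import Data.List.Relation.Unary.AllPairs using (AllPairs; []; _∷_)
import Data.List.Relation.Unary.AllPairs.Properties as AllPairsₚ
open import Data.Maybe.Base using (Maybe; just; nothing)
open import Data.Nat.Base as ℕ using (ℕ; zero; suc; _∸_; _<_; _≤_; z≤n; s≤s; NonZero; >-nonZero; ⌊_/2⌋; _%_)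
open import Data.Nat.Combinatorics using (_C_; nCn≡1; k>n⇒nCk≡0; nCk+nC[k+1]≡[n+1]C[k+1])
open import Data.Nat.Coprimality using (Coprime; coprime-Bézout)
open import Data.Nat.DivMod using (_/_; m≡m%n+[m/n]*n; m%n<n; m*n/n≡m; 0/n≡0)
open import Data.Nat.Divisibility using (_∣_; divides; m%n≡0⇒n∣m; ∣⇒≤; ∣-trans; m∣m*n; n∣m*n; *-cancelˡ-∣; 1∣_; ∣m+n∣m⇒∣n)
open import Data.Nat.GCD using (gcd; module Bézout)
open import Data.Nat.Induction using (<-rec)
open import Data.Nat.Primality using (Prime; ¬prime[0])
import Data.Nat.Properties as ℕ
import Data.Nat.Tactic.RingSolver as ℕ-Solver
open import Data.Product.Base using (Σ-syntax; ∃-syntax; _×_; _,_; proj₁; proj₂)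
open import Data.Product.Properties using (≡-dec)
open import Data.Sum.Base as Sum using (_⊎_; inj₁; inj₂; [_,_]′)
open import Function.Base using (_∘_; id)
open import Function.Bundles using (Inverse)
open import Level using (_⊔_) renaming (suc to lsuc)
open import Relation.Binary.PropositionalEquality.Core as ≡ using (_≡_; _≢_)
import Relation.Binary.Reasoning.Setoid as SetoidReasoning
open import Relation.Nullary using (¬_; Dec; yes; no; contradiction)
import Relation.Nullary.Decidable as Dec

-- Why the base is q ^ 2: the order m may be even, and q ≡ 3 modulo 4 leaves a single factor 2 in q
-- - 1, where lifting the exponent fails at the prime 2. In q ^ 2 - 1 the factor q + 1 supplies the
-- missing 4. The point x₀ determines ζ only up to inversion. Hence x₀ ^ (Q ^ i) = x₀ also permits ζ
-- ^ (Q ^ i) = ζ⁻¹, that is m ∣ Q ^ i + 1. As d divides Q ^ i - 1, it then divides 2, and this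
-- forces t = 1: a prime factor of t would divide d, hence be 2, but 2 also divides (Q - 1) / d,
-- which is coprime to t. That ζ ≠ ±1 rests on the radical condition: a prime factor of n + 1
-- divides q - 1 and so is not the characteristic. All comparisons of degrees are root counts. Lower
-- bounds for the period of x₀ under a Frobenius power therefore suffice, and the overring of 𝔽_q²
-- only has to be a domain. Elements are recognised as lying in 𝔽_q or 𝔽_q² by x ^ q = x or x ^ Q =
-- x, because these fields already supply all the solutions.

-- The solver of the standard library cancels x - x only if it can decide
-- equality of coefficients.  In an arbitrary commutative ring the coefficients
-- are therefore taken to be differences a - b of natural numbers, in lowest
-- terms.
module IntegerSolver {c ℓ} (R : CommutativeRing c ℓ) where
  open CommutativeRing R hiding (zero)
  open RingProperties ring using (-‿distribˡ-*; -‿distribʳ-*)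
  open AbelianGroupProperties +-abelianGroup
    using (⁻¹-∙-comm; ⁻¹-anti-homo‿-; ε⁻¹≈ε; ⁻¹-involutive)
  open SemiringMult semiring using () renaming (_×_ to _·_; ×-homo-+ to ·-homo-+; ×1-homo-* to ·1-homo-*)
  open SemiringMultTC semiring using (×ᵤ≈×) renaming (_×_ to _·′_)
  open SetoidReasoning setoid

  private
    reduce : ℕ → ℕ → ℕ × ℕ
    reduce (suc a) (suc b) = reduce a b
    reduce a       b       = a , b

    differences : RawRing _ _
    differences = record
      { Carrier = ℕ × ℕ
      ; _≈_     = _≡_
      ; _+_     = λ (a , b) (c , d) → reduce (a ℕ.+ c) (b ℕ.+ d)
      ; _*_     = λ (a , b) (c , d) → reduce (a ℕ.* c ℕ.+ b ℕ.* d) (a ℕ.* d ℕ.+ b ℕ.* c)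
      ; -_      = λ (a , b) → b , a
      ; 0#      = 0 , 0
      ; 1#      = 1 , 0
      }

    almostCommutativeRing : ACR.AlmostCommutativeRing c ℓ
    almostCommutativeRing = ACR.fromCommutativeRing R

    -- The case distinction makes the coefficients 0 and 1 denote 0# and 1#
    -- definitionally.
    ⟦_⟧ : ℕ × ℕ → Carrier
    ⟦ a , zero ⟧  = a ·′ 1#
    ⟦ a , suc b ⟧ = a ·′ 1# - suc b ·′ 1#

    difference : ∀ a b → ⟦ a , b ⟧ ≈ a · 1# - b · 1#
    difference a zero = begin
      a ·′ 1#      ≈⟨ ×ᵤ≈× a 1# ⟨
      a · 1#       ≈⟨ +-identityʳ _ ⟨
      a · 1# + 0#  ≈⟨ +-congˡ ε⁻¹≈ε ⟨
      a · 1# - 0#  ∎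
    difference a (suc b) = sym (+-cong (×ᵤ≈× a 1#) (-‿cong (×ᵤ≈× (suc b) 1#)))

    +-interchange : ∀ a b c d → (a + c) - (b + d) ≈ (a - b) + (c - d)
    +-interchange a b c d = begin
      (a + c) - (b + d)        ≈⟨ +-congˡ (⁻¹-∙-comm b d) ⟨
      (a + c) + (- b + - d)    ≈⟨ solve 4 (λ a b c d → (a :+ c) :+ (b :+ d) := (a :+ b) :+ (c :+ d)) refl a (- b) c (- d) ⟩
      (a - b) + (c - d)        ∎
      where open NaturalSolver commutativeSemiring

    reduced : ∀ a b → ⟦ reduce a b ⟧ ≈ a · 1# - b · 1#
    reduced zero    b       = difference zero b
    reduced (suc a) zero    = difference (suc a) zero
    reduced (suc a) (suc b) = begin
      ⟦ reduce a b ⟧                       ≈⟨ reduced a b ⟩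
      a · 1# - b · 1#                      ≈⟨ +-identityˡ _ ⟨
      0# + (a · 1# - b · 1#)               ≈⟨ +-congʳ (-‿inverseʳ 1#) ⟨
      (1# - 1#) + (a · 1# - b · 1#)        ≈⟨ +-interchange _ _ _ _ ⟨
      (1# + a · 1#) - (1# + b · 1#)        ∎

    *-expand : ∀ a b c d → (a * c + b * d) - (a * d + b * c) ≈ (a - b) * (c - d)
    *-expand a b c d = begin
      (a * c + b * d) - (a * d + b * c)            ≈⟨ +-congˡ (⁻¹-∙-comm _ _) ⟨
      (a * c + b * d) + (- (a * d) + - (b * c))    ≈⟨ +-cong (+-congˡ (trans (sym (⁻¹-involutive _)) (trans (-‿cong (-‿distribʳ-* b d)) (-‿distribˡ-* b (- d)))))
                                                        (+-cong (-‿distribʳ-* a d) (-‿distribˡ-* b c)) ⟩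
      (a * c + - b * - d) + (a * - d + - b * c)    ≈⟨ solve 4 (λ a b c d → (a :* c :+ b :* d) :+ (a :* d :+ b :* c) := (a :+ b) :* (c :+ d)) refl a (- b) c (- d) ⟩
      (a - b) * (c - d)                            ∎
      where open NaturalSolver commutativeSemiring

    homomorphism : differences ACR.-Raw-AlmostCommutative⟶ almostCommutativeRing
    homomorphism = record
      { ⟦_⟧    = ⟦_⟧
      ; +-homo = λ (a , b) (c , d) → begin
          ⟦ reduce (a ℕ.+ c) (b ℕ.+ d) ⟧              ≈⟨ reduced (a ℕ.+ c) (b ℕ.+ d) ⟩
          (a ℕ.+ c) · 1# - (b ℕ.+ d) · 1#             ≈⟨ +-cong (·-homo-+ 1# a c) (-‿cong (·-homo-+ 1# b d)) ⟩
          (a · 1# + c · 1#) - (b · 1# + d · 1#)       ≈⟨ +-interchange _ _ _ _ ⟩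
          (a · 1# - b · 1#) + (c · 1# - d · 1#)       ≈⟨ +-cong (difference a b) (difference c d) ⟨
          ⟦ a , b ⟧ + ⟦ c , d ⟧                       ∎
      ; *-homo = λ (a , b) (c , d) → begin
          ⟦ reduce (a ℕ.* c ℕ.+ b ℕ.* d) (a ℕ.* d ℕ.+ b ℕ.* c) ⟧          ≈⟨ reduced (a ℕ.* c ℕ.+ b ℕ.* d) (a ℕ.* d ℕ.+ b ℕ.* c) ⟩
          (a ℕ.* c ℕ.+ b ℕ.* d) · 1# - (a ℕ.* d ℕ.+ b ℕ.* c) · 1#         ≈⟨ +-cong (sum-of-products a c b d) (-‿cong (sum-of-products a d b c)) ⟩
          (a · 1# * c · 1# + b · 1# * d · 1#) - (a · 1# * d · 1# + b · 1# * c · 1#) ≈⟨ *-expand _ _ _ _ ⟩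
          (a · 1# - b · 1#) * (c · 1# - d · 1#)                           ≈⟨ *-cong (difference a b) (difference c d) ⟨
          ⟦ a , b ⟧ * ⟦ c , d ⟧                                           ∎
      ; -‿homo = λ (a , b) → begin
          ⟦ b , a ⟧              ≈⟨ difference b a ⟩
          b · 1# - a · 1#        ≈⟨ ⁻¹-anti-homo‿- (a · 1#) (b · 1#) ⟨
          - (a · 1# - b · 1#)    ≈⟨ -‿cong (difference a b) ⟨
          - ⟦ a , b ⟧            ∎
      ; 0-homo = refl
      ; 1-homo = refl
      }
      where
      sum-of-products : ∀ a c b d → (a ℕ.* c ℕ.+ b ℕ.* d) · 1# ≈ a · 1# * c · 1# + b · 1# * d · 1#
      sum-of-products a c b d =
        trans (·-homo-+ 1# (a ℕ.* c) (b ℕ.* d)) (+-cong (·1-homo-* a c) (·1-homo-* b d))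

    coefficient≟ : ∀ x y → Maybe (⟦ x ⟧ ≈ ⟦ y ⟧)
    coefficient≟ x y with ≡-dec ℕ._≟_ ℕ._≟_ x y
    ... | yes ≡.refl = just refl
    ... | no  _      = nothing

  open Algebra.Solver.Ring differences almostCommutativeRing homomorphism coefficient≟ public

  :1 : ∀ {n} → Polynomial n
  :1 = con (1 , 0)

  :0 : ∀ {n} → Polynomial n
  :0 = con (0 , 0)

-- Number theory: radicals, binomial coefficients, lifting the exponent.

module Arithmetic where
  open import Data.Nat.Base using (_+_; _*_; _^_)
  open import Data.Nat.Properties
  open import Data.Nat.Divisibility
  open import Data.Nat.Primality using (Prime; prime?; prime[2]; ¬prime[1]; prime⇒nonZero; prime⇒nonTrivial; prime⇒irreducible; euclidsLemma)
  open import Data.Nat.Primality.Factorisation using (factorise; factorisationHasAllPrimeFactors)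
  open import Data.Nat.Coprimality using (Coprime; coprime-divisor)
  open import Data.Nat.GCD using (gcd; gcd[m,n]∣m; gcd[m,n]∣n; gcd-greatest)
  open import Data.Nat.ListAction using (product)
  open import Data.Nat.ListAction.Properties using (∈⇒∣product)
  open import Data.Nat.Combinatorics using (_C_; nC1≡n; nCk+nC[k+1]≡[n+1]C[k+1]; k>n⇒nCk≡0)
  open import Data.Nat.Tactic.RingSolver using (solve-∀)
  open import Data.Nat.DivMod using (m*n/n≡m)
  open import Data.List.Base using (upTo; filter)
  open import Data.List.Relation.Unary.All.Properties using (all-filter)
  open import Data.List.Relation.Unary.Unique.Propositional using (Unique)
  import Data.List.Relation.Unary.Unique.Propositional.Properties as Uniqueₚ
  open import Data.List.Membership.Propositional.Properties using (∈-filter⁺; ∈-upTo⁺)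
  open import Relation.Binary.PropositionalEquality
  open import Relation.Nullary.Decidable.Core using (_×-dec_)

  primeDivisor : ∀ n → n ≢ 1 → ∃[ p ] Prime p × p ∣ n
  primeDivisor zero      _   = 2 , prime[2] , 2 ∣0
  primeDivisor n@(suc _) n≢1 with factorise n
  ... | record { factors = [] ; isFactorisation = n≡1 } = contradiction n≡1 n≢1
  ... | record { factors = p ∷ ps ; isFactorisation = n≡ ; factorsPrime = pp ∷ _ } =
    p , pp , subst (p ∣_) (sym n≡) (m∣m*n (product ps))

  prime∤1 : ∀ {p} → Prime p → ¬ (p ∣ 1)
  prime∤1 pp p∣1 = ¬prime[1] (subst Prime (∣1⇒≡1 p∣1) pp)

  prime∣prime⇒≡ : ∀ {p r} → Prime p → Prime r → p ∣ r → p ≡ r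
  prime∣prime⇒≡ pp pr p∣r with prime⇒irreducible pr p∣r
  ... | inj₁ p≡1 = contradiction (subst Prime p≡1 pp) ¬prime[1]
  ... | inj₂ p≡r = p≡r

  noCommonPrime⇒coprime : ∀ {m n} → (∀ p → Prime p → p ∣ m → ¬ (p ∣ n)) → Coprime m n
  noCommonPrime⇒coprime none {d} (d∣m , d∣n) with d ≟ 1
  ... | yes d≡1 = d≡1
  ... | no  d≢1 with primeDivisor d d≢1
  ... | p , pp , p∣d = contradiction (∣-trans p∣d d∣n) (none p pp (∣-trans p∣d d∣m))

  primeDivisor∣rad : ∀ {p} n → .{{NonZero n}} → Prime p → p ∣ n → p ∣ rad n
  primeDivisor∣rad n pp p∣n = ∈⇒∣product
    (∈-filter⁺ (λ p → prime? p ×-dec (p ∣? n)) (∈-upTo⁺ (s≤s (∣⇒≤ p∣n))) (pp , p∣n))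

  -- By Euclid's lemma `p` divides the cofactor `k` of `product ps`, since it differs from all the
  -- primes in `ps`.
  productOfDistinctPrimes∣ : ∀ {d} ps → Unique ps → All Prime ps → All (_∣ d) ps → product ps ∣ d
  productOfDistinctPrimes∣ []       _             _          _            = 1∣ _
  productOfDistinctPrimes∣ (p ∷ ps) (p∉ps ∷ uniq) (pp ∷ pps) (p∣d ∷ ps∣d)
    with productOfDistinctPrimes∣ ps uniq pps ps∣d
  ... | divides k refl = *-monoˡ-∣ (product ps) p∣k
    where
    p∣k : p ∣ k
    p∣k with euclidsLemma k (product ps) pp p∣d
    ... | inj₁ p∣k  = p∣k
    ... | inj₂ p∣ps = contradiction refl
                        (All.lookup p∉ps (factorisationHasAllPrimeFactors pp p∣ps pps))

  rad∣ : ∀ {d} n → (∀ p → Prime p → p ∣ n → p ∣ d) → rad n ∣ d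
  rad∣ n p∣n⇒p∣d = productOfDistinctPrimes∣ (filter prime∣n? (upTo (suc n)))
    (Uniqueₚ.filter⁺ prime∣n? (Uniqueₚ.upTo⁺ (suc n)))
    (All.map proj₁ primes) (All.map (λ (pp , p∣n) → p∣n⇒p∣d _ pp p∣n) primes)
    where
    prime∣n? : ∀ p → Dec (Prime p × p ∣ n)
    prime∣n? p = prime? p ×-dec (p ∣? n)
    primes : All (λ p → Prime p × p ∣ n) (filter prime∣n? (upTo (suc n)))
    primes = all-filter prime∣n? (upTo (suc n))

  -- Absorption identity, by induction through Pascal's rule. It yields the divisibility of binomial
  -- coefficients by a prime and the integrality of the Dickson coefficients.
  [k+1]*[n+1]C[k+1] : ∀ n k → suc k * (suc n C suc k) ≡ suc n * (n C k)
  [k+1]*[n+1]C[k+1] zero zero = refl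
  [k+1]*[n+1]C[k+1] zero (suc k)
    rewrite k>n⇒nCk≡0 {1} {suc (suc k)} (s≤s (s≤s z≤n)) | k>n⇒nCk≡0 {0} {suc k} (s≤s z≤n) = *-zeroʳ k
  [k+1]*[n+1]C[k+1] (suc n) zero
    rewrite sym (nCk+nC[k+1]≡[n+1]C[k+1] (suc n) 0) | +-identityʳ (suc n C 1)
    | sym (*-identityˡ (suc n C 1)) | [k+1]*[n+1]C[k+1] n 0 = refl
  [k+1]*[n+1]C[k+1] (suc n) (suc k) = begin
    suc (suc k) * (suc (suc n) C suc (suc k))  ≡⟨ cong (suc (suc k) *_) (nCk+nC[k+1]≡[n+1]C[k+1] (suc n) (suc k)) ⟨
    suc (suc k) * (x + y)                      ≡⟨ regroup (suc k) x y ⟩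
    x + (suc k * x + suc (suc k) * y)          ≡⟨ cong (x +_) (cong₂ _+_ ([k+1]*[n+1]C[k+1] n k) ([k+1]*[n+1]C[k+1] n (suc k))) ⟩
    x + (suc n * (n C k) + suc n * (n C suc k)) ≡⟨ cong (x +_) (*-distribˡ-+ (suc n) (n C k) (n C suc k)) ⟨
    x + suc n * (n C k + n C suc k)            ≡⟨ cong (λ z → x + suc n * z) (nCk+nC[k+1]≡[n+1]C[k+1] n k) ⟩
    suc (suc n) * x                            ∎
    where
    open ≡-Reasoning
    x = suc n C suc k
    y = suc n C suc (suc k)
    regroup : ∀ k x y → suc k * (x + y) ≡ x + (k * x + suc k * y)
    regroup = solve-∀

  -- By absorption `suc p` divides `suc k` times the coefficient, and it is too large to divide
  -- `suc k`.
  prime∣pCk : ∀ {p} k → Prime (suc p) → suc k < suc p → suc p ∣ suc p C suc k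
  prime∣pCk {p} k pp k<p with euclidsLemma (suc k) (suc p C suc k) pp
      (subst (suc p ∣_) (sym ([k+1]*[n+1]C[k+1] p k)) (m∣m*n (p C k)))
  ... | inj₁ p∣k = contradiction (∣⇒≤ p∣k) (<⇒≱ k<p)
  ... | inj₂ p∣C = p∣C

  nC0≡1 : ∀ n → n C 0 ≡ 1
  nC0≡1 n = begin
    n C 0  ≡⟨ *-cancelˡ-≡ _ _ (suc n) (begin
      suc n * (n C 0)      ≡⟨ [k+1]*[n+1]C[k+1] n 0 ⟨
      1 * (suc n C 1)      ≡⟨ *-identityˡ _ ⟩
      suc n C 1            ≡⟨ nC1≡n (suc n) ⟩
      suc n                ≡⟨ *-identityʳ _ ⟨
      suc n * 1            ∎) ⟩
    1      ∎
    where open ≡-Reasoning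

  -- n / (n - i) * C(n - i, i) = C(n - i, i) + C(n - i - 1, i - 1), with
  -- n replaced by n + 2 and i by i + 1, and m = n - i.
  dicksonCoefficient : ∀ m i →
    ((suc m + suc i) * (suc m C suc i)) div suc m ≡ suc m C suc i + m C i
  dicksonCoefficient m i = trans (cong (_div suc m) numerator) (m*n/n≡m (x + m C i) (suc m))
    where
    open ≡-Reasoning
    x = suc m C suc i
    numerator : (suc m + suc i) * x ≡ (x + m C i) * suc m
    numerator = begin
      (suc m + suc i) * x            ≡⟨ *-distribʳ-+ x (suc m) (suc i) ⟩
      suc m * x + suc i * x          ≡⟨ cong (suc m * x +_) ([k+1]*[n+1]C[k+1] m i) ⟩
      suc m * x + suc m * (m C i)    ≡⟨ *-distribˡ-+ (suc m) x (m C i) ⟨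
      suc m * (x + m C i)            ≡⟨ *-comm (suc m) _ ⟩
      (x + m C i) * suc m            ∎

  -- (Q ^ n - 1) / (Q - 1)
  geometric : ℕ → ℕ → ℕ
  geometric Q zero    = 0
  geometric Q (suc n) = 1 + Q * geometric Q n

  geometric-+ : ∀ Q m n → geometric Q (m + n) ≡ geometric Q m + Q ^ m * geometric Q n
  geometric-+ Q zero    n = sym (+-identityʳ _)
  geometric-+ Q (suc m) n rewrite geometric-+ Q m n = cong suc (lemma Q (geometric Q m) (Q ^ m) (geometric Q n))
    where
    lemma : ∀ q x y z → q * (x + y * z) ≡ q * x + q * y * z
    lemma = solve-∀

  -- The factorisation of (Q ^ nm - 1) / (Q - 1) through Q ^ m - 1; it allows the base to be changed
  -- from `Q` to `Q ^ m`.
  geometric-* : ∀ Q m n → geometric Q (n * m) ≡ geometric Q m * geometric (Q ^ m) n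
  geometric-* Q m zero    = sym (*-zeroʳ (geometric Q m))
  geometric-* Q m (suc n) rewrite geometric-+ Q m (n * m) | geometric-* Q m n =
    lemma (geometric Q m) (Q ^ m) (geometric (Q ^ m) n)
    where
    lemma : ∀ x y z → x + y * (x * z) ≡ x * suc (y * z)
    lemma = solve-∀

  1+z^n : ∀ z n → suc z ^ n ≡ 1 + z * geometric (suc z) n
  1+z^n z zero    = cong suc (sym (*-zeroʳ z))
  1+z^n z (suc n) rewrite 1+z^n z n = lemma z (geometric (suc z) n)
    where
    lemma : ∀ z x → suc z * (1 + z * x) ≡ 1 + z * (1 + suc z * x)
    lemma = solve-∀

  -- The binomial coefficient C(n, 2), as the sum of the numbers below n.
  triangular : ℕ → ℕ
  triangular zero    = 0
  triangular (suc n) = n + triangular n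

  2*triangular : ∀ n → 2 * triangular (suc n) ≡ suc n * n
  2*triangular zero    = refl
  2*triangular (suc n) = trans (lemma n (triangular (suc n))) (trans (cong (_+ 2 * suc n) (2*triangular n)) (lemma′ n))
    where
    lemma : ∀ n x → 2 * (suc n + x) ≡ 2 * x + 2 * suc n
    lemma = solve-∀
    lemma′ : ∀ n → suc n * n + 2 * suc n ≡ suc (suc n) * suc n
    lemma′ = solve-∀

  -- Binomial expansion of ((1 + z) ^ n - 1) / z, with all terms from z ^ 2 on collected in `w`.
  geometric-expand : ∀ z n → ∃[ w ] geometric (suc z) n ≡ n + z * triangular n + z * z * w
  geometric-expand z zero = 0 , lemma z
    where
    lemma : ∀ z → 0 ≡ 0 + z * 0 + z * z * 0
    lemma = solve-∀
  geometric-expand z (suc n) with geometric-expand z n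
  ... | w , eq = triangular n + w + z * w ,
    trans (cong (λ x → suc (suc z * x)) eq) (lemma z n (triangular n) w)
    where
    lemma : ∀ z n t w → suc (suc z * (n + z * t + z * z * w)) ≡
                        suc n + z * (n + t) + z * z * (t + w + z * w)
    lemma = solve-∀

  -- The prime `r` divides 2 C(r, 2) = r (r - 1) but not 2.
  odd-prime∣triangular : ∀ {r} → Prime r → r ≢ 2 → r ∣ triangular r
  odd-prime∣triangular {suc r} pr r≢2
    with euclidsLemma 2 (triangular (suc r)) pr (subst (suc r ∣_) (sym (2*triangular r)) (m∣m*n r))
  ... | inj₁ r∣2 = contradiction (prime∣prime⇒≡ pr prime[2] r∣2) r≢2
  ... | inj₂ r∣t = r∣t

  -- One step of lifting the exponent. With z = y r the expansion is r times u = 1 + y C(r, 2) +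
  -- ..., and `u` is 1 modulo `r`: for odd `r` because r ∣ C(r, 2), for r = 2 because 4 ∣ z makes
  -- `y` even. A prime dividing `z` and `u` divides the remaining term `r` of the expansion, so it
  -- is `r`, which does not divide `u`.
  geometric-prime : ∀ {r} z → Prime r → r ∣ z → (r ≡ 2 → 4 ∣ z) →
    ∃[ u ] geometric (suc z) r ≡ r * u × (∀ s → Prime s → s ∣ z → ¬ (s ∣ u))
  geometric-prime {r} z pr (divides y refl) 4∣z with geometric-expand z r
  ... | w , eq = u , geometric≡r*u , no-common
    where
    instance _ = prime⇒nonZero pr
    x = y * triangular r
    u = 1 + (x + y * (y * r) * w)
    geometric≡r*u : geometric (suc (y * r)) r ≡ r * u
    geometric≡r*u = trans eq (lemma y r (triangular r) w)
      where
      lemma : ∀ y r t w → r + y * r * t + y * r * (y * r) * w ≡ r * (1 + (y * t + y * (y * r) * w))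
      lemma = solve-∀
    r∣x : r ∣ x
    r∣x with r ≟ 2
    ... | no  r≢2 = ∣n⇒∣m*n y (odd-prime∣triangular pr r≢2)
    ... | yes refl = ∣m⇒∣m*n {2} {y} (triangular 2) (*-cancelʳ-∣ {2} {y} 2 (4∣z refl))
    r∤u : ¬ (r ∣ u)
    r∤u r∣u = prime∤1 pr (∣m+n∣m⇒∣n (subst (r ∣_) (+-comm 1 _) r∣u)
      (∣m∣n⇒∣m+n r∣x (∣m⇒∣m*n w (∣n⇒∣m*n y (∣n⇒∣m*n y ∣-refl)))))
    no-common : ∀ s → Prime s → s ∣ y * r → ¬ (s ∣ u)
    no-common s ps s∣z s∣u = r∤u (subst (_∣ u) (prime∣prime⇒≡ ps pr s∣r) s∣u)
      where
      s∣r : s ∣ r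
      s∣r = ∣m+n∣m⇒∣n (subst (s ∣_) (trans geometric≡ (+-comm r _)) (∣n⇒∣m*n r s∣u))
                      (∣m∣n⇒∣m+n (∣m⇒∣m*n (triangular r) s∣z) (∣m⇒∣m*n w (∣m⇒∣m*n z s∣z)))
        where
        geometric≡ : r * u ≡ r + (z * triangular r + z * z * w)
        geometric≡ = trans (sym geometric≡r*u) (trans eq (+-assoc r _ _))

  -- A common prime factor of j and m is removed from both of them; if there is
  -- none, then m is coprime to geometric (suc z) j.
  lifting-the-exponent : ∀ z → 4 ∣ z → ∀ j m → (∀ r → Prime r → r ∣ m → r ∣ z) →
                         m ∣ z * geometric (suc z) j → m ∣ z * j
  lifting-the-exponent z 4∣z = <-rec _ step
    where
    step : ∀ j → (∀ {i} → i < j → ∀ m → (∀ r → Prime r → r ∣ m → r ∣ z) → m ∣ z * geometric (suc z) i → m ∣ z * i) →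
           ∀ m → (∀ r → Prime r → r ∣ m → r ∣ z) → m ∣ z * geometric (suc z) j → m ∣ z * j
    step zero        _   m _    _     = subst (m ∣_) (sym (*-zeroʳ z)) (m ∣0)
    step j@(suc _) rec m m⇒z m∣zS with gcd j m ≟ 1
    ... | yes gcd≡1 = ∣m⇒∣m*n j (coprime-divisor m⊥S (subst (m ∣_) (*-comm z _) m∣zS))
      where
      -- The geometric sum is `j` modulo `z`, so a prime factor of `m`, which divides `z`, would
      -- also divide `j`.
      m⊥S : Coprime m (geometric (suc z) j)
      m⊥S = noCommonPrime⇒coprime λ r pr r∣m r∣S →
        let w , eq = geometric-expand z j
            r∣z = m⇒z r pr r∣m
            r∣j = ∣m+n∣m⇒∣n (subst (r ∣_) (trans eq (trans (+-assoc j _ _) (+-comm j _))) r∣S)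
                    (∣m∣n⇒∣m+n (∣m⇒∣m*n (triangular j) r∣z) (∣m⇒∣m*n w (∣m⇒∣m*n z r∣z)))
        in prime∤1 pr (subst (r ∣_) gcd≡1 (gcd-greatest r∣j r∣m))
    ... | no gcd≢1 with primeDivisor (gcd j m) gcd≢1
    ... | r , pr , r∣gcd with ∣-trans r∣gcd (gcd[m,n]∣m j m) | ∣-trans r∣gcd (gcd[m,n]∣n j m)
    ... | r∣j@(divides j′ j≡) | r∣m@(divides m′ refl) =
      subst (m′ * r ∣_) (trans (*-assoc z j′ r) (cong (z *_) (sym j≡))) (*-monoˡ-∣ r m′∣zj′)
      where
      instance
        _ = prime⇒nonZero pr
        _ = prime⇒nonTrivial pr
      z′ = z * geometric (suc z) j′
      S′ = geometric (suc z) j′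
      -- With Q = 1 + z, the number `z′` is Q ^ j′ - 1. Passing from j′ to j = j′ r multiplies it by
      -- r u with `u` coprime to m′, so `r` can be cancelled on both sides.
      r∣z : r ∣ z
      r∣z = m⇒z r pr r∣m
      split : ∃[ u ] geometric (suc z′) r ≡ r * u × (∀ s → Prime s → s ∣ z′ → ¬ (s ∣ u))
      split = geometric-prime z′ pr (∣m⇒∣m*n _ r∣z) (λ _ → ∣m⇒∣m*n _ 4∣z)
      u = proj₁ split
      m′⊥u : Coprime m′ u
      m′⊥u = noCommonPrime⇒coprime λ s ps s∣m′ →
        proj₂ (proj₂ split) s ps (∣m⇒∣m*n _ (m⇒z s ps (∣m⇒∣m*n r s∣m′)))
      zS≡ : z * geometric (suc z) j ≡ u * (z * S′) * r
      zS≡ = begin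
        z * geometric (suc z) j                   ≡⟨ cong (λ i → z * geometric (suc z) i) (trans j≡ (*-comm j′ r)) ⟩
        z * geometric (suc z) (r * j′)            ≡⟨ cong (z *_) (geometric-* (suc z) j′ r) ⟩
        z * (S′ * geometric (suc z ^ j′) r)       ≡⟨ cong (λ Q → z * (S′ * geometric Q r)) (1+z^n z j′) ⟩
        z * (S′ * geometric (suc z′) r)           ≡⟨ cong (λ x → z * (S′ * x)) (proj₁ (proj₂ split)) ⟩
        z * (S′ * (r * u))                        ≡⟨ lemma z S′ r u ⟩
        u * (z * S′) * r                          ∎
        where
        open ≡-Reasoning
        lemma : ∀ z s r u → z * (s * (r * u)) ≡ u * (z * s) * r
        lemma = solve-∀
      m′∣zS′ : m′ ∣ z * S′
      m′∣zS′ = coprime-divisor m′⊥u (*-cancelʳ-∣ r (subst (m′ * r ∣_) zS≡ m∣zS))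
      m′∣zj′ : m′ ∣ z * j′
      m′∣zj′ = rec (quotient-< r∣j) m′ (λ s ps s∣m′ → m⇒z s ps (∣m⇒∣m*n r s∣m′)) m′∣zS′

-- Serves both for the order of an element and for a divisor of least degree.
least : ∀ {ℓ} {P : ℕ → Set ℓ} → (∀ n → Dec (P n)) → ∀ n → P n →
        ∃[ m ] m ≤ n × P m × (∀ {k} → k < m → ¬ P k)
least {P = P} P? = <-rec _ step
  where
  step : ∀ n → (∀ {i} → i < n → P i → ∃[ m ] m ≤ i × P m × (∀ {k} → k < m → ¬ P k)) →
         P n → ∃[ m ] m ≤ n × P m × (∀ {k} → k < m → ¬ P k)
  step n rec Pn with ℕ.anyUpTo? P? n
  ... | no  none            = n , ℕ.≤-refl , Pn , λ k<n Pk → none (_ , k<n , Pk)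
  ... | yes (i , i<n , Pi) with rec i<n Pi
  ... | m , m≤i , Pm , min = m , ℕ.≤-trans m≤i (ℕ.<⇒≤ i<n) , Pm , min

-- Powers, the Frobenius map and evaluation in commutative rings.

module CommutativeRingProperties {c ℓ} (R : CommutativeRing c ℓ) where
  open CommutativeRing R
  open CommutativeExp commutativeSemiring using (^-distrib-*) public
  open SemiringExp semiring using (_^_; ^-congˡ; ^-homo-*; ^-assocʳ) public
  open SemiringMult semiring using (×-homo-1; ×-congˡ; ×-congʳ; ×-assocˡ; ×-assoc-*; ×-comm-*; ×-homo-+; ×1-homo-*)
    renaming (_×_ to _·_) public
  open GroupProperties +-group using () renaming (x∙y⁻¹≈ε⇒x≈y to x-y≈0⇒x≈y; x≈y⇒x∙y⁻¹≈ε to x≈y⇒x-y≈0) public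
  open IntegerSolver R using (solve; _:=_; _:+_; _:*_; _:-_; :-_; :0; :1)
  open SetoidReasoning setoid

  1^n≈1 : ∀ n → 1# ^ n ≈ 1#
  1^n≈1 zero    = refl
  1^n≈1 (suc n) = trans (*-identityˡ _) (1^n≈1 n)

  x≈0⇒x^n≈0 : ∀ {x} n → .{{NonZero n}} → x ≈ 0# → x ^ n ≈ 0#
  x≈0⇒x^n≈0 (suc n) x≈0 = trans (*-congʳ x≈0) (zeroˡ _)

  ^-comm : ∀ x m n → (x ^ m) ^ n ≈ (x ^ n) ^ m
  ^-comm x m n = begin
    (x ^ m) ^ n      ≈⟨ ^-assocʳ x m n ⟩
    x ^ (m ℕ.* n)    ≡⟨ ≡.cong (x ^_) (ℕ.*-comm m n) ⟩
    x ^ (n ℕ.* m)    ≈⟨ ^-assocʳ x n m ⟨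
    (x ^ n) ^ m      ∎

  fixed⇒fixed-^ : ∀ {x} q n → x ^ q ≈ x → x ^ (q ℕ.^ n) ≈ x
  fixed⇒fixed-^ q zero    x^q≈x = *-identityʳ _
  fixed⇒fixed-^ {x} q (suc n) x^q≈x = begin
    x ^ (q ℕ.* q ℕ.^ n)      ≈⟨ ^-assocʳ x q (q ℕ.^ n) ⟨
    (x ^ q) ^ (q ℕ.^ n)      ≈⟨ ^-congˡ (q ℕ.^ n) x^q≈x ⟩
    x ^ (q ℕ.^ n)            ≈⟨ fixed⇒fixed-^ q n x^q≈x ⟩
    x                        ∎

  p·1≈0⇒p·x≈0 : ∀ {n} p x → p · 1# ≈ 0# → p ∣ n → n · x ≈ 0#
  p·1≈0⇒p·x≈0 p x p·1≈0 (divides k ≡.refl) = begin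
    (k ℕ.* p) · x           ≈⟨ ×-assocˡ x k p ⟨
    k · (p · x)             ≈⟨ ×-congʳ k (×-congʳ p (*-identityˡ x)) ⟨
    k · (p · (1# * x))      ≈⟨ ×-congʳ k (×-assoc-* p 1# x) ⟨
    k · (p · 1# * x)        ≈⟨ ×-congʳ k (trans (*-congʳ p·1≈0) (zeroˡ x)) ⟩
    k · 0#                  ≈⟨ k·0≈0 k ⟩
    0#                      ∎
    where
    k·0≈0 : ∀ k → k · 0# ≈ 0#
    k·0≈0 zero    = refl
    k·0≈0 (suc k) = trans (+-identityˡ _) (k·0≈0 k)

  Annihilates : ℕ → Set ℓ
  Annihilates n = n · 1# ≈ 0#

  -- A property of the exponent, so that it can be iterated and used both for `q` and for its
  -- square.
  Additive : ℕ → Set (c ⊔ ℓ)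
  Additive q = ∀ x y → (x + y) ^ q ≈ x ^ q + y ^ q

  -- In the binomial theorem all coefficients but the two outer ones are multiples of `p`.
  frobenius : ∀ {p} → Prime p → p · 1# ≈ 0# → Additive p
  frobenius {zero}  pp _     _ _ = contradiction pp ¬prime[0]
  frobenius {suc p} pp p·1≈0 x y = begin
    (x + y) ^ suc p                                   ≈⟨ theorem (suc p) x y ⟩
    term Fin.zero + sum (λ i → term (Fin.suc i))      ≈⟨ +-cong first (sum-init-last (λ i → term (Fin.suc i))) ⟩
    y ^ suc p + (sum {p} (λ i → term (Fin.suc (inject₁ i))) + term (Fin.suc (fromℕ p)))
      ≈⟨ +-congˡ (+-cong (trans (sum-cong-≋ middle) (sum-replicate-zero p)) final) ⟩
    y ^ suc p + (0# + x ^ suc p)                      ≈⟨ solve 2 (λ a b → b :+ (:0 :+ a) := a :+ b) refl _ _ ⟩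
    x ^ suc p + y ^ suc p                             ∎
    where
    open Binomial commutativeSemiring
    open SemiringSum semiring using (sum; sum-init-last; sum-cong-≋; sum-replicate-zero)
    term : Fin (suc (suc p)) → Carrier
    term = binomialTerm x y (suc p)
    first : term Fin.zero ≈ y ^ suc p
    first = trans (×-congˡ (Arithmetic.nC0≡1 (suc p))) (trans (×-homo-1 _) (*-identityˡ _))
    middle : ∀ i → term (Fin.suc (inject₁ i)) ≈ 0#
    middle i = p·1≈0⇒p·x≈0 (suc p) _ p·1≈0
      (Arithmetic.prime∣pCk (toℕ (inject₁ i)) pp (s≤s (≡.subst (_< p) (≡.sym (Fin.toℕ-inject₁ i)) (Fin.toℕ<n i))))
    final : term (Fin.suc (fromℕ p)) ≈ x ^ suc p
    final = begin
      (suc p C toℕ (fromℕ (suc p))) · (x ^ toℕ (fromℕ (suc p)) * y ^ (suc p ∸ toℕ (fromℕ (suc p))))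
        ≡⟨ ≡.cong (λ i → (suc p C i) · (x ^ i * y ^ (suc p ∸ i))) (Fin.toℕ-fromℕ (suc p)) ⟩
      (suc p C suc p) · (x ^ suc p * y ^ (p ∸ p))    ≈⟨ ×-congˡ (nCn≡1 (suc p)) ⟩
      1 · (x ^ suc p * y ^ (p ∸ p))                  ≈⟨ ×-homo-1 _ ⟩
      x ^ suc p * y ^ (p ∸ p)                        ≡⟨ ≡.cong (λ i → x ^ suc p * y ^ i) (ℕ.n∸n≡0 p) ⟩
      x ^ suc p * 1#                                 ≈⟨ *-identityʳ _ ⟩
      x ^ suc p                                      ∎

  additive-^ : ∀ {q} n → Additive q → Additive (q ℕ.^ n)
  additive-^ zero    _   x y = trans (*-identityʳ _) (sym (+-cong (*-identityʳ x) (*-identityʳ y)))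
  additive-^ {q} (suc n) add x y = begin
    (x + y) ^ (q ℕ.* q ℕ.^ n)                           ≈⟨ ^-assocʳ (x + y) q (q ℕ.^ n) ⟨
    ((x + y) ^ q) ^ (q ℕ.^ n)                           ≈⟨ ^-congˡ (q ℕ.^ n) (add x y) ⟩
    (x ^ q + y ^ q) ^ (q ℕ.^ n)                         ≈⟨ additive-^ n add _ _ ⟩
    (x ^ q) ^ (q ℕ.^ n) + (y ^ q) ^ (q ℕ.^ n)           ≈⟨ +-cong (^-assocʳ x q (q ℕ.^ n)) (^-assocʳ y q (q ℕ.^ n)) ⟩
    x ^ (q ℕ.* q ℕ.^ n) + y ^ (q ℕ.* q ℕ.^ n)           ∎

  eval : List Carrier → Carrier → Carrier
  eval []      x = 0#
  eval (a ∷ f) x = a + x * eval f x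

  -- The coefficients of the quotient of a ∷ f by X - z, for any a.
  quotientByRoot : Carrier → List Carrier → List Carrier
  quotientByRoot z []      = []
  quotientByRoot z (a ∷ f) = eval (a ∷ f) z ∷ quotientByRoot z f

  length-quotientByRoot : ∀ z f → length (quotientByRoot z f) ≡ length f
  length-quotientByRoot z []      = ≡.refl
  length-quotientByRoot z (a ∷ f) = ≡.cong suc (length-quotientByRoot z f)

  eval-quotientByRoot : ∀ z a f x → eval (a ∷ f) x ≈ eval (a ∷ f) z + (x - z) * eval (quotientByRoot z f) x
  eval-quotientByRoot z a [] x =
    solve 3 (λ a x z → a :+ x :* :0 := a :+ z :* :0 :+ (x :- z) :* :0) refl a x z
  eval-quotientByRoot z a (b ∷ f) x = begin
    a + x * eval (b ∷ f) x                       ≈⟨ +-congˡ (*-congˡ (eval-quotientByRoot z b f x)) ⟩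
    a + x * (v + (x - z) * w)                    ≈⟨ solve 5 (λ a x z v w → a :+ x :* (v :+ (x :- z) :* w) := a :+ z :* v :+ (x :- z) :* (v :+ x :* w)) refl a x z v w ⟩
    a + z * v + (x - z) * (v + x * w)            ∎
    where
    v = eval (b ∷ f) z
    w = eval (quotientByRoot z f) x

  -- The entries are the values at `z` of the nonempty tails of `f`, and a coefficient is the value
  -- of its tail minus `z` times the value of the next one. The second component of the conclusion
  -- carries the latter through the induction.
  quotientByRoot≈0⇒≈0 : ∀ z f → All (_≈ 0#) (quotientByRoot z f) → All (_≈ 0#) f × eval f z ≈ 0#
  quotientByRoot≈0⇒≈0 z []      []           = [] , refl
  quotientByRoot≈0⇒≈0 z (a ∷ f) (fz≈0 ∷ q≈0) with quotientByRoot≈0⇒≈0 z f q≈0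
  ... | f≈0 , tail≈0 = (begin
      a                     ≈⟨ trans (+-congˡ (trans (*-congˡ tail≈0) (zeroʳ z))) (+-identityʳ a) ⟨
      a + z * eval f z      ≈⟨ fz≈0 ⟩
      0#                    ∎) ∷ f≈0 , fz≈0

-- Integral domains: bounds on the number of roots, and orders of elements.

module _ {c ℓ} (R : CommutativeRing c ℓ) where
  open CommutativeRing R

  Nontrivial : Set ℓ
  Nontrivial = ¬ (1# ≈ 0#)

  NoZeroDivisors : Set (c ⊔ ℓ)
  NoZeroDivisors = ∀ x y → x * y ≈ 0# → x ≈ 0# ⊎ y ≈ 0#

  DecidableEquality : Set (c ⊔ ℓ)
  DecidableEquality = ∀ x y → Dec (x ≈ y)

module IntegralDomain {c ℓ} (R : CommutativeRing c ℓ) (1≉0 : Nontrivial R) (integral : NoZeroDivisors R) where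
  open CommutativeRing R
  open CommutativeRingProperties R
  open RingProperties ring using (x[y-z]≈xy-xz)
  open SetoidReasoning setoid

  *-cancelˡ : ∀ {x y z} → ¬ (x ≈ 0#) → x * y ≈ x * z → y ≈ z
  *-cancelˡ {x} {y} {z} x≉0 xy≈xz
    with integral x (y - z) (trans (x[y-z]≈xy-xz x y z) (x≈y⇒x-y≈0 xy≈xz))
  ... | inj₁ x≈0   = contradiction x≈0 x≉0
  ... | inj₂ y-z≈0 = x-y≈0⇒x≈y y z y-z≈0

  x^n≈0⇒x≈0 : ∀ {x} n → x ^ n ≈ 0# → x ≈ 0#
  x^n≈0⇒x≈0 zero    1≈0  = contradiction 1≈0 1≉0
  x^n≈0⇒x≈0 {x} (suc n) x^≈0 with integral x (x ^ n) x^≈0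
  ... | inj₁ x≈0   = x≈0
  ... | inj₂ x^n≈0 = x^n≈0⇒x≈0 n x^n≈0

  -- Replacing x ^ q by y ^ q in the expansion of (x - y) ^ q gives that of (y - y) ^ q = 0, so the
  -- sign of (- y) ^ q never has to be determined.
  additive⇒injective : ∀ q → .{{NonZero q}} → Additive q → ∀ {x y} → x ^ q ≈ y ^ q → x ≈ y
  additive⇒injective q add {x} {y} x^≈y^ = x-y≈0⇒x≈y x y (x^n≈0⇒x≈0 q (begin
    (x - y) ^ q                          ≈⟨ add x (- y) ⟩
    x ^ q + (- y) ^ q                ≈⟨ +-congʳ x^≈y^ ⟩
    y ^ q + (- y) ^ q                ≈⟨ add y (- y) ⟨
    (y - y) ^ q                          ≈⟨ x≈0⇒x^n≈0 q (-‿inverseʳ y) ⟩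
    0#                                       ∎))

  -- Division by X - z for the first root `z` shortens the list by one, and the other roots remain
  -- roots of the quotient because x - z can be cancelled.
  tooManyRoots⇒≈0 : ∀ f xs → length f ≤ length xs → AllPairs (λ x y → ¬ (x ≈ y)) xs →
                    All (λ x → eval f x ≈ 0#) xs → All (_≈ 0#) f
  tooManyRoots⇒≈0 []      _        _         _             _               = []
  tooManyRoots⇒≈0 (a ∷ f) (z ∷ xs) (s≤s f≤xs) (z≉xs ∷ xs≉) (fz≈0 ∷ fxs≈0) with
    quotientByRoot≈0⇒≈0 z f (tooManyRoots⇒≈0 (quotientByRoot z f) xs
      (≡.subst (_≤ length xs) (≡.sym (length-quotientByRoot z f)) f≤xs) xs≉
      (All.zipWith (λ (z≉x , fx≈0) → root z≉x fx≈0) (z≉xs , fxs≈0)))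
    where
    root : ∀ {x} → ¬ (z ≈ x) → eval (a ∷ f) x ≈ 0# → eval (quotientByRoot z f) x ≈ 0#
    root {x} z≉x fx≈0 with integral (x - z) (eval (quotientByRoot z f) x) (begin
        (x - z) * eval (quotientByRoot z f) x                     ≈⟨ +-identityˡ _ ⟨
        0# + (x - z) * eval (quotientByRoot z f) x                ≈⟨ +-congʳ fz≈0 ⟨
        eval (a ∷ f) z + (x - z) * eval (quotientByRoot z f) x    ≈⟨ eval-quotientByRoot z a f x ⟨
        eval (a ∷ f) x                                            ≈⟨ fx≈0 ⟩
        0#                                                        ∎)
    ... | inj₁ x-z≈0 = contradiction (sym (x-y≈0⇒x≈y x z x-z≈0)) z≉x
    ... | inj₂ q≈0   = q≈0
  ... | f≈0 , tail≈0 = (begin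
      a                     ≈⟨ trans (+-congˡ (trans (*-congˡ tail≈0) (zeroʳ z))) (+-identityʳ a) ⟨
      a + z * eval f z      ≈⟨ fz≈0 ⟩
      0#                    ∎) ∷ f≈0

  -- If `x` differed from every `s i`, then X ^ (n + 2) - X would have n + 3 roots, and all its
  -- coefficients would vanish, among them the coefficient -1 of X. From exponent 2 on, this
  -- coefficient is separate from the leading one.
  fixedPoints : ∀ n (s : Fin (suc (suc n)) → Carrier) →
                (∀ {i j} → i ≢ j → ¬ (s i ≈ s j)) → (∀ i → s i ^ suc (suc n) ≈ s i) →
                ∀ {x} → x ^ suc (suc n) ≈ x → ¬ (∀ i → ¬ (s i ≈ x))
  fixedPoints n s s≉ s-fixed {x} x-fixed s≉x = 1≉0 (-1≈0⇒1≈0 (All.head (All.tail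
    (tooManyRoots⇒≈0 X^q-X (x ∷ tabulate s) length≤
      (Allₚ.tabulate⁺ (λ i x≈s → s≉x i (sym x≈s)) ∷ AllPairsₚ.tabulate⁺ s≉)
      (root x-fixed ∷ Allₚ.tabulate⁺ (λ i → root (s-fixed i)))))))
    where
    power : ℕ → List Carrier
    power zero    = 1# ∷ []
    power (suc k) = 0# ∷ power k
    X^q-X = 0# ∷ (- 1#) ∷ power n
    length-power : ∀ k → length (power k) ≡ suc k
    length-power zero    = ≡.refl
    length-power (suc k) = ≡.cong suc (length-power k)
    length≤ : length X^q-X ≤ suc (length (tabulate s))
    length≤ rewrite length-power n | length-tabulate s = ℕ.≤-refl
    open IntegerSolver R using (solve; _:=_; _:+_; _:*_; _:-_; :-_; :0; :1)
    eval-power : ∀ k y → eval (power k) y ≈ y ^ k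
    eval-power zero    y = trans (+-congˡ (zeroʳ y)) (+-identityʳ 1#)
    eval-power (suc k) y = trans (+-identityˡ _) (*-congˡ (eval-power k y))
    root : ∀ {y} → y ^ suc (suc n) ≈ y → eval X^q-X y ≈ 0#
    root {y} y-fixed = begin
      0# + y * (- 1# + y * eval (power n) y)    ≈⟨ +-congˡ (*-congˡ (+-congˡ (*-congˡ (eval-power n y)))) ⟩
      0# + y * (- 1# + y * y ^ n)               ≈⟨ solve 2 (λ y z → :0 :+ y :* (:- :1 :+ y :* z) := y :* (y :* z) :- y) refl y (y ^ n) ⟩
      y ^ suc (suc n) - y                       ≈⟨ x≈y⇒x-y≈0 y-fixed ⟩
      0#                                        ∎
    -1≈0⇒1≈0 : - 1# ≈ 0# → 1# ≈ 0#
    -1≈0⇒1≈0 -1≈0 = begin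
      1#           ≈⟨ +-identityʳ 1# ⟨
      1# + 0#      ≈⟨ +-congˡ -1≈0 ⟨
      1# - 1#      ≈⟨ -‿inverseʳ 1# ⟩
      0#           ∎

  module Order (_≟_ : DecidableEquality R) where

    IsOrder : Carrier → ℕ → Set ℓ
    IsOrder x m = 0 < m × x ^ m ≈ 1# × (∀ k → x ^ k ≈ 1# → m ∣ k)

    -- The least positive exponent divides every other one by division with remainder. The search
    -- runs over exponents shifted by one, so that 0 is excluded.
    order : ∀ x n → 0 < n → x ^ n ≈ 1# → ∃[ m ] IsOrder x m
    order x (suc n) _ x^n≈1 with least {P = λ k → x ^ suc k ≈ 1#} (λ k → (x ^ suc k) ≟ 1#) n x^n≈1
    ... | k , _ , x^m≈1 , minimal = suc k , s≤s z≤n , x^m≈1 , λ j x^j≈1 →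
      m%n≡0⇒n∣m j (suc k) (remainder≡0 j x^j≈1 (j % suc k) ≡.refl)
      where
      m = suc k
      x^%≈1 : ∀ j → x ^ j ≈ 1# → x ^ (j % m) ≈ 1#
      x^%≈1 j x^j≈1 = begin
        x ^ (j % m)                              ≈⟨ *-identityʳ _ ⟨
        x ^ (j % m) * 1#                         ≈⟨ *-congˡ (trans (^-congˡ (j / m) x^m≈1) (1^n≈1 (j / m))) ⟨
        x ^ (j % m) * (x ^ m) ^ (j / m)          ≈⟨ *-congˡ (^-assocʳ x m (j / m)) ⟩
        x ^ (j % m) * x ^ (m ℕ.* (j / m))        ≈⟨ ^-homo-* x (j % m) (m ℕ.* (j / m)) ⟨
        x ^ (j % m ℕ.+ m ℕ.* (j / m))            ≡⟨ ≡.cong (λ i → x ^ (j % m ℕ.+ i)) (ℕ.*-comm m (j / m)) ⟩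
        x ^ (j % m ℕ.+ j / m ℕ.* m)              ≡⟨ ≡.cong (x ^_) (m≡m%n+[m/n]*n j m) ⟨
        x ^ j                                    ≈⟨ x^j≈1 ⟩
        1#                                       ∎
      remainder≡0 : ∀ j → x ^ j ≈ 1# → ∀ r → j % m ≡ r → r ≡ 0
      remainder≡0 j x^j≈1 zero    _  = ≡.refl
      remainder≡0 j x^j≈1 (suc r) eq = contradiction (≡.subst (λ i → x ^ i ≈ 1#) eq (x^%≈1 j x^j≈1))
        (minimal (ℕ.s<s⁻¹ (≡.subst (_< m) eq (m%n<n j m))))

-- Finite fields: decidability, characteristic and x ^ Q = x.

module FieldProperties {c ℓ} (S : Field c ℓ) where
  open Field S hiding (_^_)
  open CommutativeRingProperties commutativeRing
  open IntegerSolver commutativeRing using (solve; _:=_; _:+_; _:*_; _:-_; :-_; :0; :1)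
  open SetoidReasoning setoid

  x≉0∧xy≈0⇒y≈0 : ∀ {x y} → ¬ (x ≈ 0#) → x * y ≈ 0# → y ≈ 0#
  x≉0∧xy≈0⇒y≈0 {x} {y} x≉0 xy≈0 = begin
    y                                ≈⟨ *-identityˡ y ⟨
    1# * y                           ≈⟨ *-congʳ (proj₂ (invertible x x≉0)) ⟨
    x * inv x x≉0 * y                ≈⟨ solve 3 (λ x z y → x :* z :* y := z :* (x :* y)) refl x _ y ⟩
    inv x x≉0 * (x * y)              ≈⟨ trans (*-congˡ xy≈0) (zeroʳ _) ⟩
    0#                               ∎

  module Finite {Q} (card : HasCardinality S Q) where
    open Inverse card using (to; from; to-cong; strictlyInverseˡ; strictlyInverseʳ) public

    _≟_ : ∀ x y → Dec (x ≈ y)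
    x ≟ y = Dec.map′
      (λ e → trans (sym (strictlyInverseʳ x)) (trans (reflexive (≡.cong from e)) (strictlyInverseʳ y)))
      to-cong (to x Fin.≟ to y)

    from-injective : ∀ {i j} → i ≢ j → ¬ (from i ≈ from j)
    from-injective {i} {j} i≢j e =
      i≢j (≡.trans (≡.sym (strictlyInverseˡ i)) (≡.trans (to-cong e) (strictlyInverseˡ j)))

    search : ∀ {p} {P : Carrier → Set p} → (∀ {x y} → x ≈ y → P x → P y) → (∀ x → Dec (P x)) → Dec (∃[ x ] P x)
    search {P = P} resp P? = Dec.map′ (λ (i , Pi) → from i , Pi)
      (λ (x , Px) → to x , resp (sym (strictlyInverseʳ x)) Px) (Fin.any? (P? ∘ from))

    integral : ∀ x y → x * y ≈ 0# → x ≈ 0# ⊎ y ≈ 0#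
    integral x y xy≈0 with x ≟ 0#
    ... | yes x≈0 = inj₁ x≈0
    ... | no  x≉0 = inj₂ (x≉0∧xy≈0⇒y≈0 x≉0 xy≈0)

    permute : (f g : Carrier → Carrier) → (∀ {x y} → x ≈ y → f x ≈ f y) → (∀ {x y} → x ≈ y → g x ≈ g y) →
              (∀ x → f (g x) ≈ x) → (∀ x → g (f x) ≈ x) → Permutation Q Q
    permute f g f-cong g-cong fg gf = permutation (to ∘ f ∘ from) (to ∘ g ∘ from)
      (λ i → ≡.trans (to-cong (trans (f-cong (strictlyInverseʳ _)) (fg (from i)))) (strictlyInverseˡ i))
      (λ i → ≡.trans (to-cong (trans (g-cong (strictlyInverseʳ _)) (gf (from i)))) (strictlyInverseˡ i))

    -- Translation by 1 permutes the field, so the sums of all x and of all x + 1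
    -- agree.
    Q·1≈0 : Q · 1# ≈ 0#
    Q·1≈0 = begin
      Q · 1#                                      ≈⟨ solve 2 (λ s n → n := s :+ n :- s) refl (sum from) (Q · 1#) ⟩
      sum from + Q · 1# - sum from                ≈⟨ +-congʳ (+-congˡ (sum-replicate Q)) ⟨
      sum from + sum {Q} (λ _ → 1#) - sum from    ≈⟨ +-congʳ (∑-distrib-+ from (λ _ → 1#)) ⟨
      sum (λ i → from i + 1#) - sum from          ≈⟨ +-congʳ (sum-cong-≋ (λ i → strictlyInverseʳ (from i + 1#))) ⟨
      sum (λ i → from (π ⟨$⟩ʳ i)) - sum from      ≈⟨ +-congʳ (sum-permute from π) ⟨
      sum from - sum from                         ≈⟨ -‿inverseʳ _ ⟩
      0#                                          ∎
      where
      open CommutativeMonoidSum +-commutativeMonoid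
      π : Permutation Q Q
      π = permute (_+ 1#) (_- 1#) +-congʳ +-congʳ
        (λ x → solve 1 (λ x → x :- :1 :+ :1 := x) refl x) (λ x → solve 1 (λ x → x :+ :1 :- :1 := x) refl x)

  p^k·1≈0⇒p·1≈0 : ∀ {p Q} → HasCardinality S Q → ∀ k → (p ℕ.^ k) · 1# ≈ 0# → p · 1# ≈ 0#
  p^k·1≈0⇒p·1≈0 card zero    1≈0 = contradiction (trans (sym (+-identityʳ 1#)) 1≈0) 1≉0
  p^k·1≈0⇒p·1≈0 {p} card (suc k) e with Finite.integral card (p · 1#) ((p ℕ.^ k) · 1#) (trans (sym (×1-homo-* p (p ℕ.^ k))) e)
  ... | inj₁ p≈0   = p≈0
  ... | inj₂ p^k≈0 = p^k·1≈0⇒p·1≈0 card k p^k≈0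

  -- Multiplication by x ≉ 0 permutes the field.  With 0 replaced by 1, the
  -- product of all elements is nonzero and gets multiplied by x ^ (Q - 1).
  fermat : ∀ {Q} → HasCardinality S Q → ∀ x → x ^ Q ≈ x
  fermat {zero}  card x with () ← Inverse.to card x
  fermat {suc n} card x = helper (x ≟ 0#)
    where
    open Finite card
    open CommutativeMonoidSum *-commutativeMonoid
      using () renaming (sum to ∏; sum-permute to ∏-permute; sum-cong-≋ to ∏-cong; ∑-distrib-+ to ∏-distrib-*;
                         sum-remove to ∏-remove; sum-replicate to ∏-replicate)
    if0 : Carrier → Carrier → ∀ {y} → Dec (y ≈ 0#) → Carrier
    if0 u v (yes _) = u
    if0 u v (no  _) = v
    w : Carrier → Carrier
    w y = if0 1# y (y ≟ 0#)
    w≉0 : ∀ y → ¬ (w y ≈ 0#)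
    w≉0 y with y ≟ 0#
    ... | yes _   = 1≉0
    ... | no  y≉0 = y≉0
    ∏≉0 : ∀ {m} (f : Fin m → Carrier) → (∀ i → ¬ (f i ≈ 0#)) → ¬ (∏ f ≈ 0#)
    ∏≉0 {zero}  f f≉0 = 1≉0
    ∏≉0 {suc m} f f≉0 e = ∏≉0 (f ∘ Fin.suc) (f≉0 ∘ Fin.suc) (x≉0∧xy≈0⇒y≈0 (f≉0 Fin.zero) e)
    -- The factor by which `w` changes when its argument is multiplied by `x`; the argument 0 stays
    -- fixed, so there it is 1.
    s : Carrier → Carrier
    s y = if0 1# x (y ≟ 0#)
    helper : Dec (x ≈ 0#) → x ^ suc n ≈ x
    helper (yes x≈0) = trans (x≈0⇒x^n≈0 (suc n) x≈0) (sym x≈0)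
    helper (no  x≉0) = trans (*-congˡ x^n≈1) (*-identityʳ x)
      where
      x⁻¹ = inv x x≉0
      xx⁻¹≈1 : x * x⁻¹ ≈ 1#
      xx⁻¹≈1 = proj₂ (invertible x x≉0)
      π : Permutation (suc n) (suc n)
      π = permute (x *_) (x⁻¹ *_) *-congˡ *-congˡ
        (λ y → trans (sym (*-assoc x x⁻¹ y)) (trans (*-congʳ xx⁻¹≈1) (*-identityˡ y)))
        (λ y → trans (sym (*-assoc x⁻¹ x y)) (trans (*-congʳ (trans (*-comm x⁻¹ x) xx⁻¹≈1)) (*-identityˡ y)))
      w-scale : ∀ {y z} → z ≈ x * y → w z ≈ s y * w y
      w-scale {y} {z} z≈xy with y ≟ 0# | z ≟ 0#
      ... | yes y≈0 | yes z≈0 = sym (*-identityˡ 1#)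
      ... | yes y≈0 | no  z≉0 = contradiction (trans z≈xy (trans (*-congˡ y≈0) (zeroʳ x))) z≉0
      ... | no  y≉0 | yes z≈0 = contradiction (x≉0∧xy≈0⇒y≈0 x≉0 (trans (sym z≈xy) z≈0)) y≉0
      ... | no  y≉0 | no  z≉0 = z≈xy
      ∏w = ∏ (w ∘ from)
      ∏s≈1 : ∏ (s ∘ from) ≈ 1#
      ∏s≈1 = x-y≈0⇒x≈y _ _ (x≉0∧xy≈0⇒y≈0 (∏≉0 (w ∘ from) (w≉0 ∘ from)) (begin
        ∏w * (∏ (s ∘ from) - 1#)                      ≈⟨ solve 2 (λ w s → w :* (s :- :1) := s :* w :- w) refl ∏w _ ⟩
        ∏ (s ∘ from) * ∏w - ∏w                        ≈⟨ +-congʳ (∏-distrib-* (s ∘ from) (w ∘ from)) ⟨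
        ∏ (λ i → s (from i) * w (from i)) - ∏w        ≈⟨ +-congʳ (∏-cong {suc n} (λ i → w-scale (strictlyInverseʳ (x * from i)))) ⟨
        ∏ (λ i → w (from (π ⟨$⟩ʳ i))) - ∏w            ≈⟨ +-congʳ (∏-permute (w ∘ from) π) ⟨
        ∏w - ∏w                                       ≈⟨ -‿inverseʳ _ ⟩
        0#                                            ∎))
      s≈1 : ∀ {y} → y ≈ 0# → s y ≈ 1#
      s≈1 {y} y≈0 with y ≟ 0#
      ... | yes _   = refl
      ... | no  y≉0 = contradiction y≈0 y≉0
      s≈x : ∀ {y} → ¬ (y ≈ 0#) → s y ≈ x
      s≈x {y} y≉0 with y ≟ 0#
      ... | yes y≈0 = contradiction y≈0 y≉0
      ... | no  _   = refl
      from≉0 : ∀ i → ¬ (from (punchIn (to 0#) i) ≈ 0#)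
      from≉0 i e = Fin.punchInᵢ≢i (to 0#) i (≡.trans (≡.sym (strictlyInverseˡ _)) (to-cong e))
      -- Splitting off the index of 0, which contributes 1, leaves `n` factors equal to `x`.
      x^n≈1 : x ^ n ≈ 1#
      x^n≈1 = begin
        x ^ n                                                       ≈⟨ ∏-replicate n ⟨
        ∏ {n} (λ _ → x)                                             ≈⟨ ∏-cong {n} (λ i → s≈x (from≉0 i)) ⟨
        ∏ (λ i → s (from (punchIn (to 0#) i)))                      ≈⟨ *-identityˡ _ ⟨
        1# * ∏ (λ i → s (from (punchIn (to 0#) i)))                 ≈⟨ *-congʳ (s≈1 (strictlyInverseʳ 0#)) ⟨
        s (from (to 0#)) * ∏ (λ i → s (from (punchIn (to 0#) i)))   ≈⟨ ∏-remove {i = to 0#} (s ∘ from) ⟨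
        ∏ (s ∘ from)                                                ≈⟨ ∏s≈1 ⟩
        1#                                                          ∎

-- The polynomial ring over a field, and division by monic polynomials.

module PolynomialProperties {c ℓ} (S : Field c ℓ) where
  open Field S hiding (_^_; zero)
  open CommutativeRingProperties commutativeRing
  open IntegerSolver commutativeRing using (solve; _:=_; _:+_; _:*_; _:-_; :-_; :0; :1)
  open SetoidReasoning setoid
  open Polynomial S
  open _≈ₚ_ public

  infix 8 -ₚ_
  -ₚ_ : Poly → Poly
  -ₚ f = map -_ f

  coeff-+ : ∀ f g i → coeff (f +ₚ g) i ≈ coeff f i + coeff g i
  coeff-+ []      g       i       = sym (+-identityˡ _)
  coeff-+ (x ∷ f) []      i       = sym (+-identityʳ _)
  coeff-+ (x ∷ f) (y ∷ g) zero    = refl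
  coeff-+ (x ∷ f) (y ∷ g) (suc i) = coeff-+ f g i

  coeff-scale : ∀ x f i → coeff (map (x *_) f) i ≈ x * coeff f i
  coeff-scale x []      i       = sym (zeroʳ x)
  coeff-scale x (y ∷ f) zero    = refl
  coeff-scale x (y ∷ f) (suc i) = coeff-scale x f i

  coeff-neg : ∀ f i → coeff (-ₚ f) i ≈ - coeff f i
  coeff-neg []      i       = solve 0 (:0 := :- :0) refl
  coeff-neg (x ∷ f) zero    = refl
  coeff-neg (x ∷ f) (suc i) = coeff-neg f i

  coeff-- : ∀ f g i → coeff (f -ₚ g) i ≈ coeff f i - coeff g i
  coeff-- f g i = trans (coeff-+ f (-ₚ g) i) (+-congˡ (coeff-neg g i))

  coeff-∷* : ∀ x f g i → coeff ((x ∷ f) *ₚ g) i ≈ x * coeff g i + coeff (0# ∷ (f *ₚ g)) i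
  coeff-∷* x f g i = trans (coeff-+ (map (x *_) g) _ i) (+-congʳ (coeff-scale x g i))

  ∷-cong : ∀ {x y f g} → x ≈ y → f ≈ₚ g → (x ∷ f) ≈ₚ (y ∷ g)
  ∷-cong x≈y f≈g .coeff-≈ zero    = x≈y
  ∷-cong x≈y f≈g .coeff-≈ (suc i) = f≈g .coeff-≈ i

  tail-≈ : ∀ {x y f g} → (x ∷ f) ≈ₚ (y ∷ g) → f ≈ₚ g
  tail-≈ e .coeff-≈ i = e .coeff-≈ (suc i)

  private
    ≈-refl : ∀ {f} → f ≈ₚ f
    ≈-refl .coeff-≈ i = refl

    ≈-sym : ∀ {f g} → f ≈ₚ g → g ≈ₚ f
    ≈-sym e .coeff-≈ i = sym (e .coeff-≈ i)

    ≈-trans : ∀ {f g h} → f ≈ₚ g → g ≈ₚ h → f ≈ₚ h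
    ≈-trans e e′ .coeff-≈ i = trans (e .coeff-≈ i) (e′ .coeff-≈ i)

    +-cong-≈ₚ : ∀ {f g h k} → f ≈ₚ g → h ≈ₚ k → f +ₚ h ≈ₚ g +ₚ k
    +-cong-≈ₚ {f} {g} {h} {k} e e′ .coeff-≈ i =
      trans (coeff-+ f h i) (trans (+-cong (e .coeff-≈ i) (e′ .coeff-≈ i)) (sym (coeff-+ g k i)))

    +-assoc-≈ₚ : ∀ f g h → (f +ₚ g) +ₚ h ≈ₚ f +ₚ (g +ₚ h)
    +-assoc-≈ₚ f g h .coeff-≈ i = begin
      coeff ((f +ₚ g) +ₚ h) i                ≈⟨ trans (coeff-+ (f +ₚ g) h i) (+-congʳ (coeff-+ f g i)) ⟩
      coeff f i + coeff g i + coeff h i      ≈⟨ +-assoc _ _ _ ⟩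
      coeff f i + (coeff g i + coeff h i)    ≈⟨ trans (coeff-+ f (g +ₚ h) i) (+-congˡ (coeff-+ g h i)) ⟨
      coeff (f +ₚ (g +ₚ h)) i                ∎

    +-comm-≈ₚ : ∀ f g → f +ₚ g ≈ₚ g +ₚ f
    +-comm-≈ₚ f g .coeff-≈ i = trans (coeff-+ f g i) (trans (+-comm _ _) (sym (coeff-+ g f i)))

    +-identityʳ-≈ₚ : ∀ f → f +ₚ [] ≈ₚ f
    +-identityʳ-≈ₚ f .coeff-≈ i = trans (coeff-+ f [] i) (+-identityʳ _)

    -‿inverseʳ-≈ₚ : ∀ f → f -ₚ f ≈ₚ []
    -‿inverseʳ-≈ₚ f .coeff-≈ i = trans (coeff-- f f i) (-‿inverseʳ _)

    -‿inverseˡ-≈ₚ : ∀ f → -ₚ f +ₚ f ≈ₚ []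
    -‿inverseˡ-≈ₚ f .coeff-≈ i = trans (coeff-+ (-ₚ f) f i) (trans (+-congʳ (coeff-neg f i)) (-‿inverseˡ _))

    -‿cong-≈ₚ : ∀ {f g} → f ≈ₚ g → -ₚ f ≈ₚ -ₚ g
    -‿cong-≈ₚ {f} {g} e .coeff-≈ i = trans (coeff-neg f i) (trans (-‿cong (e .coeff-≈ i)) (sym (coeff-neg g i)))

    scale-cong : ∀ {x y f g} → x ≈ y → f ≈ₚ g → map (x *_) f ≈ₚ map (y *_) g
    scale-cong {x} {y} {f} {g} x≈y e .coeff-≈ i =
      trans (coeff-scale x f i) (trans (*-cong x≈y (e .coeff-≈ i)) (sym (coeff-scale y g i)))

    0∷[]≈[] : ∀ {f} → f ≈ₚ [] → (0# ∷ f) ≈ₚ []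
    0∷[]≈[] e .coeff-≈ zero    = refl
    0∷[]≈[] e .coeff-≈ (suc i) = e .coeff-≈ i

    *-congˡ-≈ₚ : ∀ f {g h} → g ≈ₚ h → f *ₚ g ≈ₚ f *ₚ h
    *-congˡ-≈ₚ []      e = ≈-refl
    *-congˡ-≈ₚ (x ∷ f) e = +-cong-≈ₚ (scale-cong refl e) (∷-cong refl (*-congˡ-≈ₚ f e))

    *-zeroʳ-≈ₚ : ∀ f → f *ₚ [] ≈ₚ []
    *-zeroʳ-≈ₚ []      = ≈-refl
    *-zeroʳ-≈ₚ (x ∷ f) = 0∷[]≈[] (*-zeroʳ-≈ₚ f)

    -- The mirror image, in the second argument, of the recursion defining the product;
    -- commutativity follows from it.
    *-∷ : ∀ g x f → g *ₚ (x ∷ f) ≈ₚ map (x *_) g +ₚ (0# ∷ (g *ₚ f))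
    *-∷ []      x f .coeff-≈ zero    = refl
    *-∷ []      x f .coeff-≈ (suc i) = refl
    *-∷ (y ∷ g) x f .coeff-≈ zero    = +-congʳ (*-comm y x)
    *-∷ (y ∷ g) x f .coeff-≈ (suc i) = begin
      coeff (map (y *_) f +ₚ (g *ₚ (x ∷ f))) i
        ≈⟨ trans (coeff-+ (map (y *_) f) _ i) (+-congˡ (trans (*-∷ g x f .coeff-≈ i) (coeff-+ (map (x *_) g) _ i))) ⟩
      coeff (map (y *_) f) i + (coeff (map (x *_) g) i + coeff (0# ∷ (g *ₚ f)) i)
        ≈⟨ solve 3 (λ a b c → a :+ (b :+ c) := b :+ (a :+ c)) refl _ _ _ ⟩
      coeff (map (x *_) g) i + (coeff (map (y *_) f) i + coeff (0# ∷ (g *ₚ f)) i)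
        ≈⟨ trans (coeff-+ (map (x *_) g) _ i) (+-congˡ (coeff-+ (map (y *_) f) _ i)) ⟨
      coeff (map (x *_) g +ₚ (map (y *_) f +ₚ (0# ∷ (g *ₚ f)))) i ∎

    *-comm-≈ₚ : ∀ f g → f *ₚ g ≈ₚ g *ₚ f
    *-comm-≈ₚ []      g = ≈-sym (*-zeroʳ-≈ₚ g)
    *-comm-≈ₚ (x ∷ f) g =
      ≈-trans (+-cong-≈ₚ {map (x *_) g} ≈-refl (∷-cong refl (*-comm-≈ₚ f g))) (≈-sym (*-∷ g x f))

    *-cong-≈ₚ : ∀ {f g h k} → f ≈ₚ g → h ≈ₚ k → f *ₚ h ≈ₚ g *ₚ k
    *-cong-≈ₚ {f} {g} {h} {k} e e′ = ≈-trans (*-congˡ-≈ₚ f e′)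
      (≈-trans (*-comm-≈ₚ f k) (≈-trans (*-congˡ-≈ₚ k e) (*-comm-≈ₚ k g)))

    *-distribˡ-≈ₚ : ∀ f g h → f *ₚ (g +ₚ h) ≈ₚ f *ₚ g +ₚ f *ₚ h
    *-distribˡ-≈ₚ []      g h = ≈-refl
    *-distribˡ-≈ₚ (x ∷ f) g h .coeff-≈ i = begin
      coeff ((x ∷ f) *ₚ (g +ₚ h)) i
        ≈⟨ trans (coeff-∷* x f (g +ₚ h) i) (+-cong (*-congˡ (coeff-+ g h i)) (shifted i)) ⟩
      x * (coeff g i + coeff h i) + (coeff (0# ∷ (f *ₚ g)) i + coeff (0# ∷ (f *ₚ h)) i)
        ≈⟨ solve 5 (λ x g h a b → x :* (g :+ h) :+ (a :+ b) := (x :* g :+ a) :+ (x :* h :+ b)) refl x _ _ _ _ ⟩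
      (x * coeff g i + coeff (0# ∷ (f *ₚ g)) i) + (x * coeff h i + coeff (0# ∷ (f *ₚ h)) i)
        ≈⟨ trans (coeff-+ ((x ∷ f) *ₚ g) _ i) (+-cong (coeff-∷* x f g i) (coeff-∷* x f h i)) ⟨
      coeff ((x ∷ f) *ₚ g +ₚ (x ∷ f) *ₚ h) i ∎
      where
      shifted : ∀ i → coeff (0# ∷ (f *ₚ (g +ₚ h))) i ≈ coeff (0# ∷ (f *ₚ g)) i + coeff (0# ∷ (f *ₚ h)) i
      shifted zero    = sym (+-identityˡ 0#)
      shifted (suc i) = trans (*-distribˡ-≈ₚ f g h .coeff-≈ i) (coeff-+ (f *ₚ g) _ i)

    *-distribʳ-≈ₚ : ∀ f g h → (g +ₚ h) *ₚ f ≈ₚ g *ₚ f +ₚ h *ₚ f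
    *-distribʳ-≈ₚ f g h = ≈-trans (*-comm-≈ₚ (g +ₚ h) f)
      (≈-trans (*-distribˡ-≈ₚ f g h) (+-cong-≈ₚ (*-comm-≈ₚ f g) (*-comm-≈ₚ f h)))

    scale-* : ∀ x g h → map (x *_) g *ₚ h ≈ₚ map (x *_) (g *ₚ h)
    scale-* x []      h = ≈-refl
    scale-* x (y ∷ g) h .coeff-≈ i = begin
      coeff ((x * y ∷ map (x *_) g) *ₚ h) i                        ≈⟨ coeff-∷* (x * y) (map (x *_) g) h i ⟩
      x * y * coeff h i + coeff (0# ∷ (map (x *_) g *ₚ h)) i       ≈⟨ +-congˡ (shifted i) ⟩
      x * y * coeff h i + x * coeff (0# ∷ (g *ₚ h)) i              ≈⟨ solve 4 (λ x y a b → x :* y :* a :+ x :* b := x :* (y :* a :+ b)) refl x y _ _ ⟩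
      x * (y * coeff h i + coeff (0# ∷ (g *ₚ h)) i)                ≈⟨ trans (coeff-scale x ((y ∷ g) *ₚ h) i) (*-congˡ (coeff-∷* y g h i)) ⟨
      coeff (map (x *_) ((y ∷ g) *ₚ h)) i                          ∎
      where
      shifted : ∀ i → coeff (0# ∷ (map (x *_) g *ₚ h)) i ≈ x * coeff (0# ∷ (g *ₚ h)) i
      shifted zero    = sym (zeroʳ x)
      shifted (suc i) = trans (scale-* x g h .coeff-≈ i) (coeff-scale x (g *ₚ h) i)

    0∷-* : ∀ f g → (0# ∷ f) *ₚ g ≈ₚ (0# ∷ (f *ₚ g))
    0∷-* f g .coeff-≈ i = trans (coeff-∷* 0# f g i) (trans (+-congʳ (zeroˡ _)) (+-identityˡ _))

    *-assoc-≈ₚ : ∀ f g h → (f *ₚ g) *ₚ h ≈ₚ f *ₚ (g *ₚ h)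
    *-assoc-≈ₚ []      g h = ≈-refl
    *-assoc-≈ₚ (x ∷ f) g h = ≈-trans (*-distribʳ-≈ₚ h (map (x *_) g) (0# ∷ (f *ₚ g)))
      (+-cong-≈ₚ (scale-* x g h) (≈-trans (0∷-* (f *ₚ g) h) (∷-cong refl (*-assoc-≈ₚ f g h))))

    *-identityˡ-≈ₚ : ∀ f → constant 1# *ₚ f ≈ₚ f
    *-identityˡ-≈ₚ f .coeff-≈ i = trans (coeff-∷* 1# [] f i) (trans (+-cong (*-identityˡ _) (zeros i)) (+-identityʳ _))
      where
      zeros : ∀ i → coeff (0# ∷ []) i ≈ 0#
      zeros zero    = refl
      zeros (suc i) = refl

  polynomialRing : CommutativeRing c ℓ
  polynomialRing = record
    { Carrier = Poly
    ; _≈_     = _≈ₚ_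
    ; _+_     = _+ₚ_
    ; _*_     = _*ₚ_
    ; -_      = -ₚ_
    ; 0#      = []
    ; 1#      = constant 1#
    ; isCommutativeRing = record
      { isRing = record
        { +-isAbelianGroup = record
          { isGroup = record
            { isMonoid = record
              { isSemigroup = record
                { isMagma = record
                  { isEquivalence = record { refl = ≈-refl ; sym = ≈-sym ; trans = ≈-trans }
                  ; ∙-cong        = +-cong-≈ₚ
                  }
                ; assoc = +-assoc-≈ₚ
                }
              ; identity = (λ _ → ≈-refl) , +-identityʳ-≈ₚ
              }
            ; inverse = -‿inverseˡ-≈ₚ , -‿inverseʳ-≈ₚ
            ; ⁻¹-cong = -‿cong-≈ₚ
            }
          ; comm = +-comm-≈ₚ
          }
        ; *-cong     = *-cong-≈ₚ
        ; *-assoc    = *-assoc-≈ₚ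
        ; *-identity = *-identityˡ-≈ₚ , λ f → ≈-trans (*-comm-≈ₚ f (constant 1#)) (*-identityˡ-≈ₚ f)
        ; distrib    = *-distribˡ-≈ₚ , *-distribʳ-≈ₚ
        }
      ; *-comm = *-comm-≈ₚ
      }
    }

  module P = CommutativeRing polynomialRing

  -- Degrees are bounded through coefficients because a list may end in zeros. The bound 0 describes
  -- the zero polynomial.
  DegreeBelow : ℕ → Poly → Set ℓ
  DegreeBelow n f = ∀ i → n ≤ i → coeff f i ≈ 0#

  MonicOfDegree : ℕ → Poly → Set ℓ
  MonicOfDegree n f = coeff f n ≈ 1# × DegreeBelow (suc n) f

  below-resp : ∀ {n f g} → f ≈ₚ g → DegreeBelow n f → DegreeBelow n g
  below-resp e below i n≤i = trans (sym (e .coeff-≈ i)) (below i n≤i)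

  below-weaken : ∀ {m n} f → m ≤ n → DegreeBelow m f → DegreeBelow n f
  below-weaken f m≤n below i n≤i = below i (ℕ.≤-trans m≤n n≤i)

  monic-resp : ∀ {n f g} → f ≈ₚ g → MonicOfDegree n f → MonicOfDegree n g
  monic-resp {n} e (lead , below) = trans (sym (e .coeff-≈ n)) lead , below-resp e below

  below0⇒≈0 : ∀ {f} → DegreeBelow 0 f → f ≈ₚ []
  below0⇒≈0 below .coeff-≈ i = below i z≤n

  below-+ : ∀ {n} f g → DegreeBelow n f → DegreeBelow n g → DegreeBelow n (f +ₚ g)
  below-+ f g f< g< i n≤i = trans (coeff-+ f g i) (trans (+-cong (f< i n≤i) (g< i n≤i)) (+-identityˡ 0#))

  below-neg : ∀ {n} f → DegreeBelow n f → DegreeBelow n (-ₚ f)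
  below-neg f f< i n≤i = trans (coeff-neg f i) (trans (-‿cong (f< i n≤i)) (solve 0 (:- :0 := :0) refl))

  below-scale : ∀ {n} x f → DegreeBelow n f → DegreeBelow n (map (x *_) f)
  below-scale x f f< i n≤i = trans (coeff-scale x f i) (trans (*-congˡ (f< i n≤i)) (zeroʳ x))

  monic-+ : ∀ {n} f g → MonicOfDegree n f → DegreeBelow n g → MonicOfDegree n (f +ₚ g)
  monic-+ {n} f g (lead , f<) g< =
    trans (coeff-+ f g n) (trans (+-cong lead (g< n ℕ.≤-refl)) (+-identityʳ 1#)) ,
    below-+ f g f< (below-weaken g (ℕ.n≤1+n n) g<)

  below-∷ : ∀ {n} x f → DegreeBelow n f → DegreeBelow (suc n) (x ∷ f)
  below-∷ x f f< (suc i) (s≤s n≤i) = f< i n≤i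

  leading-* : ∀ m n f g → DegreeBelow (suc m) f → DegreeBelow (suc n) g →
              coeff (f *ₚ g) (m ℕ.+ n) ≈ coeff f m * coeff g n × DegreeBelow (suc (m ℕ.+ n)) (f *ₚ g)
  leading-* m n [] g _ _ = sym (zeroˡ _) , λ _ _ → refl
  leading-* zero n (x ∷ f) g f< g< = xg n , λ i n<i → trans (xg i) (trans (*-congˡ (g< i n<i)) (zeroʳ x))
    where
    f≈0 : f ≈ₚ []
    f≈0 = below0⇒≈0 (λ i _ → f< (suc i) (s≤s z≤n))
    xg : ∀ i → coeff ((x ∷ f) *ₚ g) i ≈ x * coeff g i
    xg i = trans (coeff-∷* x f g i) (trans (+-congˡ (0∷[]≈[] (*-cong-≈ₚ f≈0 (≈-refl {g})) .coeff-≈ i)) (+-identityʳ _))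
  leading-* (suc m) n (x ∷ f) g f< g< =
    trans (shifted (m ℕ.+ n) (s≤s (ℕ.m≤n+m n m))) (proj₁ rec) ,
    λ { (suc i) (s≤s m+n<i) → trans (shifted i (ℕ.≤-trans (s≤s (ℕ.m≤n+m n m)) (ℕ.m≤n⇒m≤1+n m+n<i))) (proj₂ rec i m+n<i) }
    where
    rec : coeff (f *ₚ g) (m ℕ.+ n) ≈ coeff f m * coeff g n × DegreeBelow (suc (m ℕ.+ n)) (f *ₚ g)
    rec = leading-* m n f g (λ i m<i → f< (suc i) (s≤s m<i)) g<
    shifted : ∀ i → n < suc i → coeff ((x ∷ f) *ₚ g) (suc i) ≈ coeff (f *ₚ g) i
    shifted i n<1+i = trans (coeff-∷* x f g (suc i))
      (trans (+-congʳ (trans (*-congˡ (g< (suc i) n<1+i)) (zeroʳ x))) (+-identityˡ _))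

  monic-* : ∀ {m n} f g → MonicOfDegree m f → MonicOfDegree n g → MonicOfDegree (m ℕ.+ n) (f *ₚ g)
  monic-* {m} {n} f g (f≈1 , f<) (g≈1 , g<) =
    trans (proj₁ (leading-* m n f g f< g<)) (trans (*-cong f≈1 g≈1) (*-identityˡ 1#)) ,
    proj₂ (leading-* m n f g f< g<)

  -- A monic factor of degree `n` raises the degree by exactly `n`. The tail of `k` is bounded
  -- first; truncation makes its bound 0 also for j = 0, and once the tail vanishes, `x` is the
  -- coefficient of X ^ n in the product.
  below-cancel : ∀ {n} j k g → MonicOfDegree n g → DegreeBelow (j ℕ.+ n) (k *ₚ g) → DegreeBelow j k
  below-cancel j [] g _ _ = λ _ _ → refl
  below-cancel {n} j (x ∷ k) g (lead , g<) kg< = cases j kg< tail<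
    where
    tail< : DegreeBelow (j ∸ 1) k
    tail< = below-cancel (j ∸ 1) k g (lead , g<) λ i j-1+n≤i → begin
      coeff (k *ₚ g) i                                    ≈⟨ trans (+-congʳ (trans (*-congˡ (g< (suc i) (s≤s (ℕ.≤-trans (ℕ.m≤n+m n (j ∸ 1)) j-1+n≤i)))) (zeroʳ x))) (+-identityˡ _) ⟨
      x * coeff g (suc i) + coeff (k *ₚ g) i              ≈⟨ coeff-∷* x k g (suc i) ⟨
      coeff ((x ∷ k) *ₚ g) (suc i)                        ≈⟨ kg< (suc i) (ℕ.≤-trans (ℕ.+-monoˡ-≤ n (ℕ.m≤n+m∸n j 1)) (s≤s j-1+n≤i)) ⟩
      0#                                                  ∎
    cases : ∀ j → DegreeBelow (j ℕ.+ n) ((x ∷ k) *ₚ g) → DegreeBelow (j ∸ 1) k → DegreeBelow j (x ∷ k)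
    cases (suc j) _   k< (suc i) (s≤s j≤i) = k< i j≤i
    cases zero    _   k< (suc i) _         = k< i z≤n
    cases zero    kg< k< zero    _         = begin
      x                                                   ≈⟨ trans (+-cong (trans (*-congˡ lead) (*-identityʳ x))
                                                               (0∷[]≈[] (*-cong-≈ₚ {k} (below0⇒≈0 k<) (≈-refl {g})) .coeff-≈ n)) (+-identityʳ x) ⟨
      x * coeff g n + coeff (0# ∷ (k *ₚ g)) n             ≈⟨ coeff-∷* x k g n ⟨
      coeff ((x ∷ k) *ₚ g) n                              ≈⟨ kg< n ℕ.≤-refl ⟩
      0#                                                  ∎

  -- From f = k g + r follows x + X f = X k g + u, where u = x + X r has degree at most `n`.
  -- Subtracting `coeff u n` times the monic `g` removes the coefficient of X ^ n.
  divide : ∀ {n} g → MonicOfDegree n g → ∀ f → ∃[ k ] ∃[ r ] f ≈ₚ k *ₚ g +ₚ r × DegreeBelow n r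
  divide g _ [] = [] , [] , ≈-refl , λ _ _ → refl
  divide {n} g monic@(lead , g<) (x ∷ f) with divide g monic f
  ... | k , r , f≈ , r< = c′ ∷ k , u -ₚ map (c′ *_) g , f≈′ , below
    where
    u  = x ∷ r
    c′ = coeff u n
    cg = map (c′ *_) g
    remainder : ∀ i → coeff (u -ₚ cg) i ≈ coeff u i - c′ * coeff g i
    remainder i = trans (coeff-- u cg i) (+-congˡ (-‿cong (coeff-scale c′ g i)))
    below : DegreeBelow n (u -ₚ cg)
    below i n≤i with ℕ.m≤n⇒m<n∨m≡n n≤i
    ... | inj₁ n<i    = begin
      coeff (u -ₚ cg) i              ≈⟨ remainder i ⟩
      coeff u i - c′ * coeff g i     ≈⟨ +-cong (below-∷ x r r< i n<i) (-‿cong (*-congˡ (g< i n<i))) ⟩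
      0# - c′ * 0#                   ≈⟨ solve 1 (λ c → :0 :- c :* :0 := :0) refl c′ ⟩
      0#                             ∎
    ... | inj₂ ≡.refl = begin
      coeff (u -ₚ cg) n              ≈⟨ remainder n ⟩
      c′ - c′ * coeff g n            ≈⟨ +-congˡ (-‿cong (*-congˡ lead)) ⟩
      c′ - c′ * 1#                   ≈⟨ solve 1 (λ c → c :- c :* :1 := :0) refl c′ ⟩
      0#                             ∎
    f≈′ : x ∷ f ≈ₚ (c′ ∷ k) *ₚ g +ₚ (u -ₚ cg)
    f≈′ .coeff-≈ i = begin
      coeff (x ∷ f) i                                                          ≈⟨ split i ⟩
      coeff (0# ∷ (k *ₚ g)) i + coeff u i                                      ≈⟨ solve 3 (λ a b c → a :+ b := c :+ a :+ (b :- c)) refl _ _ _ ⟩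
      c′ * coeff g i + coeff (0# ∷ (k *ₚ g)) i + (coeff u i - c′ * coeff g i)  ≈⟨ trans (coeff-+ ((c′ ∷ k) *ₚ g) _ i) (+-cong (coeff-∷* c′ k g i) (remainder i)) ⟨
      coeff ((c′ ∷ k) *ₚ g +ₚ (u -ₚ cg)) i                                     ∎
      where
      split : ∀ i → coeff (x ∷ f) i ≈ coeff (0# ∷ (k *ₚ g)) i + coeff u i
      split zero    = sym (+-identityˡ x)
      split (suc i) = trans (f≈ .coeff-≈ i) (coeff-+ (k *ₚ g) r i)

  -- Here `r` is the multiple of `g` by k′ - k, and its degree is below that of `g`.
  remainder-of-multiple : ∀ {n} g k r k′ → MonicOfDegree n g → DegreeBelow n r →
                          k′ *ₚ g ≈ₚ k *ₚ g +ₚ r → r ≈ₚ []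
  remainder-of-multiple g k r k′ monic r< e = ≈-trans r≈ (*-cong-≈ₚ k′-k≈0 (≈-refl {g}))
    where
    open IntegerSolver polynomialRing using () renaming (solve to solveₚ; _:=_ to _:=ₚ_; _:+_ to _:+ₚ_; _:*_ to _:*ₚ_; _:-_ to _:-ₚ_)
    r≈ : r ≈ₚ (k′ -ₚ k) *ₚ g
    r≈ = ≈-trans (solveₚ 3 (λ r k g → r :=ₚ k :*ₚ g :+ₚ r :-ₚ k :*ₚ g) ≈-refl r k g)
      (≈-trans (P.+-congʳ { -ₚ (k *ₚ g)} (≈-sym e)) (solveₚ 3 (λ k′ k g → k′ :*ₚ g :-ₚ k :*ₚ g :=ₚ (k′ :-ₚ k) :*ₚ g) ≈-refl k′ k g))
    k′-k≈0 : k′ -ₚ k ≈ₚ []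
    k′-k≈0 = below0⇒≈0 (below-cancel 0 (k′ -ₚ k) g monic (below-resp r≈ r<))

  constant-factor : ∀ {n} k f g → MonicOfDegree n f → MonicOfDegree n g → f ≈ₚ k *ₚ g → f ≈ₚ g
  constant-factor {n} k f g monic-f@(f≈1 , f<) monic-g@(g≈1 , g<) e = ≈-trans e (≈-trans (*-cong-≈ₚ k≈1 (≈-refl {g})) (*-identityˡ-≈ₚ g))
    where
    k< : DegreeBelow 1 k
    k< = below-cancel 1 k g monic-g (below-resp e f<)
    k₀≈1 : coeff k 0 ≈ 1#
    k₀≈1 = begin
      coeff k 0                    ≈⟨ *-identityʳ _ ⟨
      coeff k 0 * 1#               ≈⟨ *-congˡ g≈1 ⟨
      coeff k 0 * coeff g n        ≈⟨ proj₁ (leading-* 0 n k g k< g<) ⟨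
      coeff (k *ₚ g) n             ≈⟨ e .coeff-≈ n ⟨
      coeff f n                    ≈⟨ f≈1 ⟩
      1#                           ∎
    k≈1 : k ≈ₚ constant 1#
    k≈1 .coeff-≈ zero    = k₀≈1
    k≈1 .coeff-≈ (suc i) = k< (suc i) (s≤s z≤n)

  ∣⇒degree≤ : ∀ {m n} f g → MonicOfDegree m f → MonicOfDegree n g → f ∣ₚ g → m ≤ n
  ∣⇒degree≤ {m} {n} f g monic-f (g≈1 , g<) (k , e) with m ℕ.≤? n
  ... | yes m≤n = m≤n
  ... | no  m≰n = contradiction (trans (sym g≈1) (trans (sym (e .coeff-≈ n)) (*-cong-≈ₚ k≈0 (≈-refl {f}) .coeff-≈ n))) 1≉0
    where
    k≈0 : k ≈ₚ []
    k≈0 = below0⇒≈0 (below-cancel 0 k f monic-f (below-weaken (k *ₚ f) (ℕ.≰⇒> m≰n) (below-resp (≈-sym e) g<)))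

  monic-∣-antisym : ∀ {m n} f g → MonicOfDegree m f → MonicOfDegree n g → f ∣ₚ g → g ∣ₚ f → f ≈ₚ g
  monic-∣-antisym f g monic-f monic-g f∣g g∣f@(k , e)
    with ℕ.≤-antisym (∣⇒degree≤ f g monic-f monic-g f∣g) (∣⇒degree≤ g f monic-g monic-f g∣f)
  ... | ≡.refl = constant-factor k f g monic-f monic-g (≈-sym e)

  -- The cofactor `k` is a unit, so `f` divides `g` in turn, and monic associates are equal.
  irreducible-monic-∣ : ∀ {m n} f g → MonicOfDegree m f → MonicOfDegree n g → Irreducible f →
                        ¬ (g ∣ₚ constant 1#) → g ∣ₚ f → f ≈ₚ g
  irreducible-monic-∣ f g monic-f monic-g irr g∤1 g∣f@(k , e) with Irreducible.split-∣1 irr (≈-sym e)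
  ... | inj₂ g∣1       = contradiction g∣1 g∤1
  ... | inj₁ (k″ , e″) = monic-∣-antisym f g monic-f monic-g (k″ , ≈-trans (P.*-congˡ {k″} (≈-sym e))
    (≈-trans (≈-sym (*-assoc-≈ₚ k″ k g)) (≈-trans (*-cong-≈ₚ e″ (≈-refl {g})) (*-identityˡ-≈ₚ g)))) g∣f

-- Quotient rings and the adjunction of a root.

module QuotientRing {c ℓ} (R : CommutativeRing c ℓ) (m : CommutativeRing.Carrier R) where
  open CommutativeRing R
  open IntegerSolver R using (solve; _:=_; _:+_; _:*_; _:-_; :-_; :0; :1)
  open SetoidReasoning setoid

  infix 4 _≈ₘ_
  record _≈ₘ_ (x y : Carrier) : Set (c ⊔ ℓ) where
    constructor multiple
    field
      quotient : Carrier
      equality : x - y ≈ quotient * m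

  ≈⇒≈ₘ : ∀ {x y} → x ≈ y → x ≈ₘ y
  ≈⇒≈ₘ {x} {y} x≈y = multiple 0# (begin
    x - y      ≈⟨ +-congʳ x≈y ⟩
    y - y      ≈⟨ solve 2 (λ y m → y :- y := :0 :* m) refl y m ⟩
    0# * m     ∎)

  quotientRing : CommutativeRing c (c ⊔ ℓ)
  quotientRing = record
    { Carrier = Carrier
    ; _≈_     = _≈ₘ_
    ; _+_     = _+_
    ; _*_     = _*_
    ; -_      = -_
    ; 0#      = 0#
    ; 1#      = 1#
    ; isCommutativeRing = record
      { isRing = record
        { +-isAbelianGroup = record
          { isGroup = record
            { isMonoid = record
              { isSemigroup = record
                { isMagma = record
                  { isEquivalence = record
                    { refl  = ≈⇒≈ₘ refl
                    ; sym   = λ {x} {y} (multiple k e) → multiple (- k) (begin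
                        y - x          ≈⟨ solve 2 (λ x y → y :- x := :- (x :- y)) refl x y ⟩
                        - (x - y)      ≈⟨ -‿cong e ⟩
                        - (k * m)      ≈⟨ solve 2 (λ k m → :- (k :* m) := :- k :* m) refl k m ⟩
                        - k * m        ∎)
                    ; trans = λ {x} {y} {z} (multiple k e) (multiple k′ e′) → multiple (k + k′) (begin
                        x - z                  ≈⟨ solve 3 (λ x y z → x :- z := (x :- y) :+ (y :- z)) refl x y z ⟩
                        (x - y) + (y - z)      ≈⟨ +-cong e e′ ⟩
                        k * m + k′ * m         ≈⟨ distribʳ m k k′ ⟨
                        (k + k′) * m           ∎)
                    }
                  ; ∙-cong = λ {x} {y} {u} {v} (multiple k e) (multiple k′ e′) → multiple (k + k′) (begin
                      (x + u) - (y + v)      ≈⟨ solve 4 (λ x y u v → (x :+ u) :- (y :+ v) := (x :- y) :+ (u :- v)) refl x y u v ⟩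
                      (x - y) + (u - v)      ≈⟨ +-cong e e′ ⟩
                      k * m + k′ * m         ≈⟨ distribʳ m k k′ ⟨
                      (k + k′) * m           ∎)
                  }
                ; assoc = λ x y z → ≈⇒≈ₘ (+-assoc x y z)
                }
              ; identity = (λ x → ≈⇒≈ₘ (+-identityˡ x)) , λ x → ≈⇒≈ₘ (+-identityʳ x)
              }
            ; inverse = (λ x → ≈⇒≈ₘ (-‿inverseˡ x)) , λ x → ≈⇒≈ₘ (-‿inverseʳ x)
            ; ⁻¹-cong = λ {x} {y} (multiple k e) → multiple (- k) (begin
                - x - - y      ≈⟨ solve 2 (λ x y → :- x :- :- y := :- (x :- y)) refl x y ⟩
                - (x - y)      ≈⟨ -‿cong e ⟩
                - (k * m)      ≈⟨ solve 2 (λ k m → :- (k :* m) := :- k :* m) refl k m ⟩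
                - k * m        ∎)
            }
          ; comm = λ x y → ≈⇒≈ₘ (+-comm x y)
          }
        ; *-cong = λ {x} {y} {u} {v} (multiple k e) (multiple k′ e′) → multiple (k * u + y * k′) (begin
            x * u - y * v                  ≈⟨ solve 4 (λ x y u v → x :* u :- y :* v := (x :- y) :* u :+ y :* (u :- v)) refl x y u v ⟩
            (x - y) * u + y * (u - v)      ≈⟨ +-cong (*-congʳ e) (*-congˡ e′) ⟩
            k * m * u + y * (k′ * m)       ≈⟨ solve 5 (λ k m u y k′ → k :* m :* u :+ y :* (k′ :* m) := (k :* u :+ y :* k′) :* m) refl k m u y k′ ⟩
            (k * u + y * k′) * m           ∎)
        ; *-assoc    = λ x y z → ≈⇒≈ₘ (*-assoc x y z)
        ; *-identity = (λ x → ≈⇒≈ₘ (*-identityˡ x)) , λ x → ≈⇒≈ₘ (*-identityʳ x)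
        ; distrib    = (λ x y z → ≈⇒≈ₘ (distribˡ x y z)) , λ x y z → ≈⇒≈ₘ (distribʳ x y z)
        }
      ; *-comm = λ x y → ≈⇒≈ₘ (*-comm x y)
      }
    }

-- Cancellation suffices for counting roots, and decidable equality for finding the order of an
-- element and for locating it in a finite subfield.
record DomainExtension {c ℓ} (S : Field c ℓ) : Set (lsuc (c ⊔ ℓ)) where
  private module S = Field S
  field
    domain         : CommutativeRing c (c ⊔ ℓ)
  open CommutativeRing domain
  field
    _≟_            : DecidableEquality domain
    1≉0            : Nontrivial domain
    integral       : NoZeroDivisors domain
    embed          : S.Carrier → Carrier
    isHomomorphism : RingMorphisms.IsRingHomomorphism S.rawRing rawRing embed

record RootExtension {c ℓ} (S : Field c ℓ) (f : Polynomial.Poly S) : Set (lsuc (c ⊔ ℓ)) where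
  field
    extension : DomainExtension S
  open DomainExtension extension public
  open CommutativeRing domain using (Carrier; _≈_; 0#)
  field
    root   : Carrier
    isRoot : CommutativeRingProperties.eval domain (map embed f) root ≈ 0#

-- The extension is S[X] / (h) for a nonconstant monic divisor h of f of least
-- degree; h is prime since it has no monic divisors except 1 and itself.
module ConstructRoot {c ℓ Q} (S : Field c ℓ) (card : HasCardinality S Q) where
  open Field S hiding (_^_; zero)
  open FieldProperties S
  open Finite card hiding (integral)
  open Polynomial S
  open PolynomialProperties S
  open IntegerSolver polynomialRing using (solve; _:=_; _:+_; _:*_; _:-_)

  ≈0? : ∀ f → Dec (f ≈ₚ [])
  ≈0? []      = yes P.refl
  ≈0? (x ∷ f) with x ≟ 0# | ≈0? f
  ... | no  x≉0 | _       = no λ e → x≉0 (e .coeff-≈ 0)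
  ... | yes _   | no  f≉0 = no λ e → f≉0 (coefficientwise (λ i → e .coeff-≈ (suc i)))
  ... | yes x≈0 | yes f≈0 = yes (coefficientwise λ { zero → x≈0 ; (suc i) → f≈0 .coeff-≈ i })

  ∣? : ∀ {n} g → MonicOfDegree n g → ∀ f → Dec (g ∣ₚ f)
  ∣? g monic f with divide g monic f
  ... | k , r , f≈ , r< = Dec.map′
    (λ r≈0 → k , P.sym (P.trans f≈ (P.trans (P.+-congˡ {k *ₚ g} r≈0) (P.+-identityʳ (k *ₚ g)))))
    (λ (k′ , e) → remainder-of-multiple g k r k′ monic r< (P.trans e f≈))
    (≈0? r)

  leadingCoefficient : ∀ f → ¬ (f ≈ₚ []) → ∃[ n ] ¬ (coeff f n ≈ 0#) × DegreeBelow (suc n) f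
  leadingCoefficient []      f≉0 = contradiction P.refl f≉0
  leadingCoefficient (x ∷ f) xf≉0 with ≈0? f
  ... | yes f≈0 = 0 , (λ x≈0 → xf≉0 (coefficientwise λ { zero → x≈0 ; (suc i) → f≈0 .coeff-≈ i })) ,
                  λ { (suc i) _ → f≈0 .coeff-≈ i }
  ... | no  f≉0 with leadingCoefficient f f≉0
  ... | n , fn≉0 , f< = suc n , fn≉0 , below-∷ x f f<

  normalise : ∀ {e} f → ¬ (f ≈ₚ []) → DegreeBelow e f →
              ∃[ n ] ∃[ u ] n < e × MonicOfDegree n (map (u *_) f)
  normalise {e} f f≉0 f< with leadingCoefficient f f≉0
  ... | n , fn≉0 , f<1+n = n , u , ℕ.≰⇒> (λ e≤n → fn≉0 (f< n e≤n)) ,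
        trans (coeff-scale u f n) (trans (*-comm u _) (proj₂ (invertible (coeff f n) fn≉0))) ,
        below-scale u f f<1+n
    where u = inv (coeff f n) fn≉0

  monic0⇒≈1 : ∀ {f} → MonicOfDegree 0 f → f ≈ₚ constant 1#
  monic0⇒≈1 (lead , below) = coefficientwise λ { zero → lead ; (suc i) → below (suc i) (s≤s z≤n) }

  -- Up to equality there are finitely many monic polynomials of degree `n`: the constant
  -- coefficient runs through the field and the rest through degree n - 1, down to the polynomial 1.
  searchMonic : ∀ {p} n {P : Poly → Set p} → (∀ {f g} → f ≈ₚ g → P f → P g) →
                (∀ f → MonicOfDegree n f → Dec (P f)) → Dec (∃[ f ] MonicOfDegree n f × P f)
  searchMonic zero resp P? = Dec.map′ (λ p → constant 1# , monic-1 , p)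
    (λ (f , monic , p) → resp (monic0⇒≈1 monic) p) (P? (constant 1#) monic-1)
    where
    monic-1 : MonicOfDegree 0 (constant 1#)
    monic-1 = refl , λ { (suc i) _ → refl }
  searchMonic (suc n) {P} resp P? = Dec.map′
    (λ (x , f , (lead , below) , p) → x ∷ f , (lead , below-∷ x f below) , p)
    uncons
    (search (λ x≈y (f , monic , p) → f , monic , resp (∷-cong x≈y P.refl) p)
      (λ x → searchMonic n (λ e → resp (∷-cong refl e))
        (λ f (lead , below) → P? (x ∷ f) (lead , below-∷ x f below))))
    where
    uncons : ∃[ f ] MonicOfDegree (suc n) f × P f → ∃[ x ] ∃[ f ] MonicOfDegree n f × P (x ∷ f)
    uncons ([]    , (0≈1 , _)       , _) = contradiction (sym 0≈1) 1≉0
    uncons (x ∷ f , (lead , below) , p) = x , f , (lead , λ i n<i → below (suc i) (s≤s n<i)) , p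

  HasDivisor : Poly → ℕ → Set _
  HasDivisor f n = ∃[ g ] MonicOfDegree n g × g ∣ₚ f

  ∣ₚ-trans : ∀ {f g h} → f ∣ₚ g → g ∣ₚ h → f ∣ₚ h
  ∣ₚ-trans {f} (k , e) (k′ , e′) =
    k′ *ₚ k , P.trans (P.*-assoc k′ k f) (P.trans (P.*-congˡ {k′} e) e′)

  module _ {n} (f h : Poly) (monic : MonicOfDegree n h) (h∣f : h ∣ₚ f)
    (minimal : ∀ {i} → suc i < n → ¬ HasDivisor f (suc i)) where

    -- Euclidean descent on the degree of `r`. Dividing `h` by the normalised `r̂` leaves `s` such
    -- that `h` divides s v. If `s` vanishes, `r̂` is a monic divisor of `h`, hence of `f`, of
    -- degree below `n`, so minimality leaves only degree 0 and r̂ = 1.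
    ∣-cancel : ∀ e r v → DegreeBelow e r → e ≤ n → ¬ (r ≈ₚ []) → h ∣ₚ r *ₚ v → h ∣ₚ v
    ∣-cancel zero    r v r< _   r≉0 _ = contradiction (below0⇒≈0 r<) r≉0
    ∣-cancel (suc e) r v r< e<n r≉0 (w , wh≈rv) with normalise r r≉0 r<
    ... | i , u , s≤s i≤e , monic′ = helper i i≤e (divide r̂ monic′ h) monic′
      where
      r̂ = map (u *_) r
      r̂≈ : r̂ ≈ₚ constant u *ₚ r
      r̂≈ .coeff-≈ j = sym (trans (coeff-∷* u [] r j) (trans (+-congˡ (0≈ j)) (trans (+-identityʳ _) (sym (coeff-scale u r j)))))
        where
        0≈ : ∀ j → coeff (0# ∷ []) j ≈ 0#
        0≈ zero    = refl
        0≈ (suc j) = refl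
      r̂v≈ : r̂ *ₚ v ≈ₚ constant u *ₚ w *ₚ h
      r̂v≈ = P.trans (P.*-cong {r̂} r̂≈ (P.refl {v})) (P.trans (P.*-assoc (constant u) r v)
        (P.trans (P.*-congˡ {constant u} (P.sym wh≈rv)) (P.sym (P.*-assoc (constant u) w h))))
      helper : ∀ i → i ≤ e → ∃[ k ] ∃[ s ] h ≈ₚ k *ₚ r̂ +ₚ s × DegreeBelow i s → MonicOfDegree i r̂ → h ∣ₚ v
      helper i i≤e (k , s , h≈ , s<) monic′ with ≈0? s
      ... | no s≉0 = ∣-cancel e s v (below-weaken s i≤e s<) (ℕ.≤-trans (ℕ.n≤1+n e) e<n) s≉0
        (v +ₚ (-ₚ (k *ₚ constant u *ₚ w)) , (begin
          (v -ₚ k *ₚ constant u *ₚ w) *ₚ h            ≈⟨ solve 5 (λ v k c w h → (v :- k :* c :* w) :* h := h :* v :- k :* (c :* w :* h)) P.refl v k (constant u) w h ⟩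
          h *ₚ v -ₚ k *ₚ (constant u *ₚ w *ₚ h)       ≈⟨ P.+-congˡ {h *ₚ v} (P.-‿cong (P.*-congˡ {k} r̂v≈)) ⟨
          h *ₚ v -ₚ k *ₚ (r̂ *ₚ v)                     ≈⟨ P.+-congʳ { -ₚ (k *ₚ (r̂ *ₚ v))} (P.*-congʳ {v} h≈) ⟩
          (k *ₚ r̂ +ₚ s) *ₚ v -ₚ k *ₚ (r̂ *ₚ v)         ≈⟨ solve 4 (λ k r s v → (k :* r :+ s) :* v :- k :* (r :* v) := s :* v) P.refl k r̂ s v ⟩
          s *ₚ v                                       ∎))
        where open SetoidReasoning P.setoid
      helper zero _ (k , s , h≈ , s<) monic′ | yes s≈0 = constant u *ₚ w , (begin
          constant u *ₚ w *ₚ h      ≈⟨ r̂v≈ ⟨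
          r̂ *ₚ v                    ≈⟨ P.*-congʳ {v} (monic0⇒≈1 {r̂} monic′) ⟩
          constant 1# *ₚ v          ≈⟨ P.*-identityˡ v ⟩
          v                         ∎)
        where open SetoidReasoning P.setoid
      helper (suc i) i<e (k , s , h≈ , s<) monic′ | yes s≈0 = contradiction
        (r̂ , monic′ , ∣ₚ-trans (k , P.sym (P.trans h≈ (P.trans (P.+-congˡ {k *ₚ r̂} s≈0) (P.+-identityʳ (k *ₚ r̂))))) h∣f)
        (minimal (ℕ.≤-trans (s≤s i<e) e<n))

    -- If `h` does not divide `u`, the nonzero remainder of `u` modulo `h` takes the place of `u`
    -- and can be cancelled.
    h-prime : ∀ u v → h ∣ₚ u *ₚ v → h ∣ₚ u ⊎ h ∣ₚ v
    h-prime u v (w , wh≈uv) with divide h monic u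
    ... | k , r , u≈ , r< with ≈0? r
    ... | yes r≈0 = inj₁ (k , P.sym (P.trans u≈ (P.trans (P.+-congˡ {k *ₚ h} r≈0) (P.+-identityʳ (k *ₚ h)))))
    ... | no  r≉0 = inj₂ (∣-cancel n r v r< ℕ.≤-refl r≉0 (w -ₚ k *ₚ v , (begin
      (w -ₚ k *ₚ v) *ₚ h                      ≈⟨ solve 4 (λ w k v h → (w :- k :* v) :* h := w :* h :- k :* h :* v) P.refl w k v h ⟩
      w *ₚ h -ₚ k *ₚ h *ₚ v                   ≈⟨ P.+-congʳ { -ₚ (k *ₚ h *ₚ v)} wh≈uv ⟩
      u *ₚ v -ₚ k *ₚ h *ₚ v                   ≈⟨ P.+-congʳ { -ₚ (k *ₚ h *ₚ v)} (P.*-congʳ {v} u≈) ⟩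
      (k *ₚ h +ₚ r) *ₚ v -ₚ k *ₚ h *ₚ v       ≈⟨ solve 4 (λ k h r v → (k :* h :+ r) :* v :- k :* h :* v := r :* v) P.refl k h r v ⟩
      r *ₚ v                                  ∎)))
      where open SetoidReasoning P.setoid

  rootExtension : ∀ {n} f → MonicOfDegree (suc n) f → RootExtension S f
  rootExtension {n} f monic-f =
    extend (least {P = λ k → HasDivisor f (suc k)}
      (λ k → searchMonic (suc k) (λ e (w , e′) → w , P.trans (P.*-congˡ {w} (P.sym e)) e′) (λ g monic → ∣? g monic f))
      n (f , monic-f , (constant 1# , P.*-identityˡ f)))
    where
    extend : ∃[ k ] k ≤ n × HasDivisor f (suc k) × (∀ {i} → i < k → ¬ HasDivisor f (suc i)) → RootExtension S f
    extend (k , _ , (h , monic , h∣f@(w , wh≈f)) , minimal) = record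
      { extension = record
        { domain         = quotientRing
        ; _≟_            = λ u v → Dec.map′ (λ (w , e) → multiple w (P.sym e)) (λ (multiple w e) → w , P.sym e) (∣? h monic (u -ₚ v))
        ; 1≉0            = λ (multiple w e) → h∤1 w e
        ; integral       = λ u v (multiple w e) → Sum.map ∣⇒≈ₘ0 ∣⇒≈ₘ0
            (h-prime f h monic h∣f (λ { (s≤s i<k) → minimal i<k }) u v (w , P.trans (P.sym e) (P.+-identityʳ (u *ₚ v))))
        ; embed          = constant
        ; isHomomorphism = record
          { isSemiringHomomorphism = record
            { isNearSemiringHomomorphism = record
              { +-isMonoidHomomorphism = record
                { isMagmaHomomorphism = record
                  { isRelHomomorphism = record { cong = λ x≈y → ≈⇒≈ₘ (∷-cong x≈y P.refl) }
                  ; homo = λ x y → ≈⇒≈ₘ P.refl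
                  }
                ; ε-homo = ≈⇒≈ₘ (coefficientwise λ { zero → refl ; (suc i) → refl })
                }
              ; *-homo = λ x y → ≈⇒≈ₘ (coefficientwise λ { zero → sym (+-identityʳ _) ; (suc i) → refl })
              }
            ; 1#-homo = ≈⇒≈ₘ P.refl
            }
          ; -‿homo = λ x → ≈⇒≈ₘ P.refl
          }
        }
      ; root      = X
      ; isRoot    = ≈ₘ-trans (≈⇒≈ₘ (eval-X f)) (∣⇒≈ₘ0 h∣f)
      }
      where
      open QuotientRing polynomialRing h
      open CommutativeRing quotientRing using () renaming (trans to ≈ₘ-trans)
      open CommutativeRingProperties quotientRing using (eval)
      X = 0# ∷ 1# ∷ []
      ∣⇒≈ₘ0 : ∀ {u} → h ∣ₚ u → u ≈ₘ []
      ∣⇒≈ₘ0 {u} (w , wh≈u) = multiple w (P.trans (P.+-identityʳ u) (P.sym wh≈u))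
      -- Since `h` has positive degree, `w` would have degree below 0 and vanish.
      h∤1 : ∀ w → ¬ (constant 1# ≈ₚ w *ₚ h)
      h∤1 w e = 1≉0 (trans (e .coeff-≈ 0) (P.*-cong {w} {[]} (below0⇒≈0 w<0) (P.refl {h}) .coeff-≈ 0))
        where
        w<0 : DegreeBelow 0 w
        w<0 = below-cancel 0 w h monic λ { (suc i) _ → sym (e .coeff-≈ (suc i)) }
      eval-X : ∀ g → eval (map constant g) X ≈ₚ g
      eval-X []      = P.refl
      eval-X (a ∷ g) .coeff-≈ i = begin
        coeff (constant a +ₚ X *ₚ e) i                                              ≈⟨ coeff-+ (constant a) (X *ₚ e) i ⟩
        coeff (constant a) i + coeff (X *ₚ e) i                                     ≈⟨ +-congˡ (coeff-∷* 0# (constant 1#) e i) ⟩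
        coeff (constant a) i + (0# * coeff e i + coeff (0# ∷ (constant 1# *ₚ e)) i) ≈⟨ +-congˡ (trans (+-congʳ (zeroˡ _)) (+-identityˡ _)) ⟩
        coeff (constant a) i + coeff (0# ∷ (constant 1# *ₚ e)) i                    ≈⟨ shifted i ⟩
        coeff (a ∷ g) i                                                             ∎
        where
        open SetoidReasoning setoid
        e = eval (map constant g) X
        shifted : ∀ i → coeff (constant a) i + coeff (0# ∷ (constant 1# *ₚ e)) i ≈ coeff (a ∷ g) i
        shifted zero    = +-identityʳ a
        shifted (suc i) = trans (+-identityˡ _) (P.trans (P.*-identityˡ e) (eval-X g) .coeff-≈ i)

-- Dickson polynomials as functions: recurrences and the substitution x = u + v, a = u v.

module DicksonIdentities {c ℓ} (R : CommutativeRing c ℓ) where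
  open CommutativeRing R hiding (zero)
  open CommutativeRingProperties R
  open IntegerSolver R using (solve; _:=_; _:+_; _:*_; _:-_; :-_; :0; :1)
  open SetoidReasoning setoid

  Σ : ℕ → (ℕ → Carrier) → Carrier
  Σ zero    f = 0#
  Σ (suc n) f = f 0 + Σ n (f ∘ suc)

  Σ-cong : ∀ n {f g} → (∀ i → f i ≈ g i) → Σ n f ≈ Σ n g
  Σ-cong zero    f≈g = refl
  Σ-cong (suc n) f≈g = +-cong (f≈g 0) (Σ-cong n (f≈g ∘ suc))

  Σ-+ : ∀ n f g → Σ n (λ i → f i + g i) ≈ Σ n f + Σ n g
  Σ-+ zero    f g = sym (+-identityˡ 0#)
  Σ-+ (suc n) f g = trans (+-congˡ (Σ-+ n (f ∘ suc) (g ∘ suc)))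
    (solve 4 (λ a b c d → a :+ b :+ (c :+ d) := a :+ c :+ (b :+ d)) refl _ _ _ _)

  Σ-* : ∀ n x f → Σ n (λ i → x * f i) ≈ x * Σ n f
  Σ-* zero    x f = sym (zeroʳ x)
  Σ-* (suc n) x f = trans (+-congˡ (Σ-* n x (f ∘ suc))) (sym (distribˡ x _ _))

  Σ-snoc : ∀ n f → f n ≈ 0# → Σ (suc n) f ≈ Σ n f
  Σ-snoc zero    f f0≈0 = trans (+-identityʳ _) f0≈0
  Σ-snoc (suc n) f fn≈0 = +-congˡ (Σ-snoc n (f ∘ suc) fn≈0)

  -- Separates the vanishing terms from those with n = k + 2 i, where the truncated differences n ∸
  -- i and n ∸ 2 i become k + i and k.
  data Compare2* (i : ℕ) : ℕ → Set where
    below : ∀ {n} → n < i ℕ.+ i → Compare2* i n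
    above : ∀ k → Compare2* i (k ℕ.+ (i ℕ.+ i))

  compare2* : ∀ n i → Compare2* i n
  compare2* n i with n ℕ.<? i ℕ.+ i
  ... | yes n<2i = below n<2i
  ... | no  n≮2i = ≡.subst (Compare2* i) (ℕ.m∸n+n≡m (ℕ.≮⇒≥ n≮2i)) (above (n ∸ (i ℕ.+ i)))

  coefficient≡0 : ∀ {n} i → n < i ℕ.+ i → (n ∸ i) C i ≡ 0
  coefficient≡0 {n} i n<2i = k>n⇒nCk≡0 (ℕ.m<n+o⇒m∸n<o n i {{ℕ.≢-nonZero (λ { ≡.refl → contradiction n<2i λ () })}} n<2i)

  coefficient-above : ∀ k i → (k ℕ.+ (i ℕ.+ i)) ∸ i ≡ k ℕ.+ i
  coefficient-above k i = ≡.trans (≡.cong (_∸ i) (≡.sym (ℕ.+-assoc k i i))) (ℕ.m+n∸n≡m (k ℕ.+ i) i)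

  exponent-above : ∀ k i → (k ℕ.+ (i ℕ.+ i)) ∸ 2 ℕ.* i ≡ k
  exponent-above k i rewrite ℕ.+-identityʳ i = ℕ.m+n∸n≡m k (i ℕ.+ i)

  module _ (x a : Carrier) where

    eTerm dTerm : ℕ → ℕ → Carrier
    eTerm n i = ((n ∸ i) C i) · (- a) ^ i * x ^ (n ∸ 2 ℕ.* i)
    dTerm n i = ((n ℕ.* ((n ∸ i) C i)) div (n ∸ i)) · (- a) ^ i * x ^ (n ∸ 2 ℕ.* i)

    dicksonE dicksonD : ℕ → Carrier
    dicksonE n = Σ (suc ⌊ n /2⌋) (eTerm n)
    dicksonD n = Σ (suc ⌊ n /2⌋) (dTerm n)

    term≈ : ∀ {m m′ k k′} i → m ≡ m′ → k ≡ k′ → m · (- a) ^ i * x ^ k ≈ m′ · (- a) ^ i * x ^ k′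
    term≈ i ≡.refl ≡.refl = refl

    term≈0 : ∀ {m} y k → m ≡ 0 → m · y * x ^ k ≈ 0#
    term≈0 y k ≡.refl = zeroˡ _

    eTerm≈0 : ∀ {n} i → n < i ℕ.+ i → eTerm n i ≈ 0#
    eTerm≈0 {n} i n<2i = term≈0 ((- a) ^ i) (n ∸ 2 ℕ.* i) (coefficient≡0 i n<2i)

    2+n<2[1+i] : ∀ {n} i → n < i ℕ.+ i → suc (suc n) < suc i ℕ.+ suc i
    2+n<2[1+i] i n<2i rewrite ℕ.+-suc i i = s≤s (s≤s n<2i)

    2+exponent : ∀ n i → suc (suc n) ∸ 2 ℕ.* suc i ≡ n ∸ 2 ℕ.* i
    2+exponent n i = ≡.cong (suc n ∸_) (ℕ.+-suc i (i ℕ.+ 0))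

    -- Pascal's rule for C(n + 1 - i, i + 1): the recurrence of E, term by term. For n < 2 i all
    -- three coefficients vanish.
    eTerm-pascal : ∀ n i → eTerm (suc (suc n)) (suc i) ≈ x * eTerm (suc n) (suc i) + - a * eTerm n i
    eTerm-pascal n i = helper (compare2* n i)
      where
      step : ∀ k c₁ c₂ → c₂ · (- a) ^ suc i * x ^ k ≈ x * (c₂ · (- a) ^ suc i * x ^ (k ∸ 1)) →
             (c₁ ℕ.+ c₂) · (- a) ^ suc i * x ^ k ≈
             x * (c₂ · (- a) ^ suc i * x ^ (k ∸ 1)) + - a * (c₁ · (- a) ^ i * x ^ k)
      step k c₁ c₂ e = begin
        (c₁ ℕ.+ c₂) · (- a) ^ suc i * x ^ k
          ≈⟨ *-congʳ (×-homo-+ _ c₁ c₂) ⟩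
        (c₁ · (- a) ^ suc i + c₂ · (- a) ^ suc i) * x ^ k
          ≈⟨ trans (distribʳ _ _ _) (+-comm _ _) ⟩
        c₂ · (- a) ^ suc i * x ^ k + c₁ · (- a) ^ suc i * x ^ k
          ≈⟨ +-cong e (trans (*-congʳ (sym (×-comm-* c₁ (- a) _))) (*-assoc _ _ _)) ⟩
        x * (c₂ · (- a) ^ suc i * x ^ (k ∸ 1)) + - a * (c₁ · (- a) ^ i * x ^ k) ∎
      helper : ∀ {n} → Compare2* i n → eTerm (suc (suc n)) (suc i) ≈ x * eTerm (suc n) (suc i) + - a * eTerm n i
      helper {n} (below n<2i) = begin
        eTerm (suc (suc n)) (suc i)                      ≈⟨ eTerm≈0 (suc i) (2+n<2[1+i] i n<2i) ⟩
        0#                                               ≈⟨ solve 2 (λ x a → x :* :0 :+ a :* :0 := :0) refl x (- a) ⟨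
        x * 0# + - a * 0#                                ≈⟨ +-cong (*-congˡ (eTerm≈0 (suc i) (ℕ.<-trans (ℕ.n<1+n (suc n)) (2+n<2[1+i] i n<2i))))
                                                                   (*-congˡ (eTerm≈0 i n<2i)) ⟨
        x * eTerm (suc n) (suc i) + - a * eTerm n i      ∎
      helper (above k) = begin
        eTerm (suc (suc n′)) (suc i)
          ≈⟨ term≈ (suc i) (≡.trans (≡.cong (_C suc i) (≡.trans (ℕ.+-∸-assoc 1 i≤n′) (≡.cong suc (coefficient-above k i)))) (≡.sym (nCk+nC[k+1]≡[n+1]C[k+1] (k ℕ.+ i) i)))
               (≡.trans (2+exponent n′ i) (exponent-above k i)) ⟩
        ((k ℕ.+ i) C i ℕ.+ (k ℕ.+ i) C suc i) · (- a) ^ suc i * x ^ k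
          ≈⟨ step k ((k ℕ.+ i) C i) ((k ℕ.+ i) C suc i) (shift k) ⟩
        x * (((k ℕ.+ i) C suc i) · (- a) ^ suc i * x ^ (k ∸ 1)) + - a * (((k ℕ.+ i) C i) · (- a) ^ i * x ^ k)
          ≈⟨ +-cong (*-congˡ (term≈ (suc i) (≡.cong (_C suc i) (coefficient-above k i)) exponent′))
                    (*-congˡ (term≈ i (≡.cong (_C i) (coefficient-above k i)) (exponent-above k i))) ⟨
        x * eTerm (suc n′) (suc i) + - a * eTerm n′ i ∎
        where
        n′ = k ℕ.+ (i ℕ.+ i)
        i≤n′ : i ≤ n′
        i≤n′ = ℕ.≤-trans (ℕ.m≤m+n i i) (ℕ.m≤n+m (i ℕ.+ i) k)
        exponent′ : suc n′ ∸ 2 ℕ.* suc i ≡ k ∸ 1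
        exponent′ = ≡.trans (≡.cong (n′ ∸_) (≡.trans (ℕ.+-suc i (i ℕ.+ 0)) (ℕ.+-comm 1 (2 ℕ.* i))))
          (≡.trans (≡.sym (ℕ.∸-+-assoc n′ (2 ℕ.* i) 1)) (≡.cong (_∸ 1) (exponent-above k i)))
        -- For k = 0 the exponent k ∸ 1 is truncated, but then the coefficient C(i, i + 1) is zero.
        shift : ∀ k → ((k ℕ.+ i) C suc i) · (- a) ^ suc i * x ^ k ≈
                      x * (((k ℕ.+ i) C suc i) · (- a) ^ suc i * x ^ (k ∸ 1))
        shift zero    = trans (term≈0 _ 0 i<1+i) (sym (trans (*-congˡ (term≈0 _ 0 i<1+i)) (zeroʳ x)))
          where
          i<1+i : i C suc i ≡ 0
          i<1+i = k>n⇒nCk≡0 (ℕ.n<1+n i)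
        shift (suc k) = solve 3 (λ y x z → y :* (x :* z) := x :* (y :* z)) refl _ x (x ^ k)

    -- The coefficient of D is a sum of two binomial coefficients, one belonging to index n + 2 and
    -- one to index n of E.
    dTerm≈eTerm+eTerm : ∀ n i → dTerm (suc (suc n)) (suc i) ≈ eTerm (suc (suc n)) (suc i) + - a * eTerm n i
    dTerm≈eTerm+eTerm n i = helper (compare2* n i)
      where
      -- The divisor can be 0 for large `i`; the default value of `div` is then the right one.
      n*0/m≡0 : ∀ n m → (n ℕ.* 0) div m ≡ 0
      n*0/m≡0 n zero    = ≡.refl
      n*0/m≡0 n (suc m) = ≡.trans (≡.cong (_div suc m) (ℕ.*-zeroʳ n)) (0/n≡0 (suc m))
      helper : ∀ {n} → Compare2* i n → dTerm (suc (suc n)) (suc i) ≈ eTerm (suc (suc n)) (suc i) + - a * eTerm n i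
      helper {n} (below n<2i) = begin
        dTerm (suc (suc n)) (suc i)                            ≈⟨ term≈0 ((- a) ^ suc i) (suc (suc n) ∸ 2 ℕ.* suc i)
            (≡.trans (≡.cong (λ z → (suc (suc n) ℕ.* z) div (suc n ∸ i)) (coefficient≡0 (suc i) (2+n<2[1+i] i n<2i))) (n*0/m≡0 (suc (suc n)) (suc n ∸ i))) ⟩
        0#                                                     ≈⟨ solve 1 (λ a → :0 :+ a :* :0 := :0) refl (- a) ⟨
        0# + - a * 0#                                          ≈⟨ +-cong (eTerm≈0 (suc i) (2+n<2[1+i] i n<2i)) (*-congˡ (eTerm≈0 i n<2i)) ⟨
        eTerm (suc (suc n)) (suc i) + - a * eTerm n i          ∎
      helper (above k) = begin
        dTerm (suc (suc n′)) (suc i)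
          ≈⟨ term≈ (suc i) (≡.trans (≡.cong₂ (λ y z → (y ℕ.* (z C suc i)) div z) (regroup k i) m≡) (Arithmetic.dicksonCoefficient (k ℕ.+ i) i)) exponent′ ⟩
        (c₂ ℕ.+ c₁) · (- a) ^ suc i * x ^ k
          ≈⟨ trans (*-congʳ (×-homo-+ _ c₂ c₁)) (distribʳ _ _ _) ⟩
        c₂ · (- a) ^ suc i * x ^ k + c₁ · (- a) ^ suc i * x ^ k
          ≈⟨ +-cong (sym (term≈ (suc i) (≡.cong (_C suc i) m≡) exponent′))
                    (trans (trans (*-congʳ (sym (×-comm-* c₁ (- a) _))) (*-assoc _ _ _))
                           (*-congˡ (sym (term≈ i (≡.cong (_C i) (coefficient-above k i)) (exponent-above k i))))) ⟩
        eTerm (suc (suc n′)) (suc i) + - a * eTerm n′ i ∎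
        where
        n′ = k ℕ.+ (i ℕ.+ i)
        c₁ = (k ℕ.+ i) C i
        c₂ = suc (k ℕ.+ i) C suc i
        m≡ : suc n′ ∸ i ≡ suc (k ℕ.+ i)
        m≡ = ≡.trans (ℕ.+-∸-assoc 1 (ℕ.≤-trans (ℕ.m≤m+n i i) (ℕ.m≤n+m (i ℕ.+ i) k))) (≡.cong suc (coefficient-above k i))
        exponent′ : suc (suc n′) ∸ 2 ℕ.* suc i ≡ k
        exponent′ = ≡.trans (2+exponent n′ i) (exponent-above k i)
        regroup : ∀ k i → suc (suc (k ℕ.+ (i ℕ.+ i))) ≡ suc (k ℕ.+ i) ℕ.+ suc i
        regroup = ℕ-Solver.solve-∀

    firstTerm : ∀ n → eTerm n 0 ≈ x ^ n
    firstTerm n = trans (*-congʳ (trans (×-congˡ (Arithmetic.nC0≡1 n)) (+-identityʳ 1#))) (*-identityˡ _)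

    dicksonE-recurrence : ∀ n → dicksonE (suc (suc n)) ≈ x * dicksonE (suc n) + - a * dicksonE n
    dicksonE-recurrence n = begin
      eTerm (suc (suc n)) 0 + Σ m (eTerm (suc (suc n)) ∘ suc)
        ≈⟨ +-cong (trans {j = x ^ suc (suc n)} (firstTerm (suc (suc n))) (*-congˡ {x} (sym (firstTerm (suc n))))) (trans (Σ-cong m (eTerm-pascal n)) (trans (Σ-+ m (λ i → x * eTerm (suc n) (suc i)) (λ i → - a * eTerm n i))
             (+-cong (Σ-* m x (eTerm (suc n) ∘ suc)) (Σ-* m (- a) (eTerm n))))) ⟩
      x * eTerm (suc n) 0 + (x * Σ m (eTerm (suc n) ∘ suc) + - a * dicksonE n)
        ≈⟨ solve 4 (λ x t s u → x :* t :+ (x :* s :+ u) := x :* (t :+ s) :+ u) refl x _ _ _ ⟩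
      x * Σ (suc m) (eTerm (suc n)) + - a * dicksonE n
        ≈⟨ +-congʳ (*-congˡ (range n (eTerm≈0 {suc n}))) ⟩
      x * dicksonE (suc n) + - a * dicksonE n ∎
      where
      m = suc ⌊ n /2⌋
      -- The ranges differ only for even `n`, and then by one vanishing term.
      range : ∀ n {f} → (∀ i → suc n < i ℕ.+ i → f i ≈ 0#) → Σ (suc (suc ⌊ n /2⌋)) f ≈ Σ (suc ⌊ suc n /2⌋) f
      range zero          {f} f≈0 = Σ-snoc 1 f (f≈0 1 (s≤s (s≤s z≤n)))
      range (suc zero)    {f} f≈0 = refl
      range (suc (suc n)) {f} f≈0 = +-congˡ (range n λ i n<2i → f≈0 (suc i) (2+n<2[1+i] i n<2i))

    dicksonD≈dicksonE+dicksonE : ∀ n → dicksonD (suc (suc n)) ≈ dicksonE (suc (suc n)) + - a * dicksonE n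
    dicksonD≈dicksonE+dicksonE n = begin
      dTerm (suc (suc n)) 0 + Σ m (dTerm (suc (suc n)) ∘ suc)
        ≈⟨ +-cong (term≈ {k = suc (suc n)} 0 (cancel (suc n) (suc (suc n) C 0)) ≡.refl)
             (trans (Σ-cong m (dTerm≈eTerm+eTerm n)) (trans (Σ-+ m (eTerm (suc (suc n)) ∘ suc) (λ i → - a * eTerm n i)) (+-congˡ (Σ-* m (- a) (eTerm n))))) ⟩
      eTerm (suc (suc n)) 0 + (Σ m (eTerm (suc (suc n)) ∘ suc) + - a * dicksonE n)
        ≈⟨ +-assoc _ _ _ ⟨
      dicksonE (suc (suc n)) + - a * dicksonE n ∎
      where
      m = suc ⌊ n /2⌋
      cancel : ∀ m k → (suc m ℕ.* k) div suc m ≡ k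
      cancel m k = ≡.trans (≡.cong (_div suc m) (ℕ.*-comm (suc m) k)) (m*n/n≡m k (suc m))

    module _ (u v : Carrier) (x≈u+v : x ≈ u + v) (a≈u*v : a ≈ u * v) where

      -- The complete homogeneous sum of the u ^ i v ^ (n - i). It stands for the quotient of u ^ (n
      -- + 1) - v ^ (n + 1) by u - v and keeps its meaning for u = v.
      powerSum : ℕ → Carrier
      powerSum zero    = 1#
      powerSum (suc n) = u * powerSum n + v ^ suc n

      powerSum-sym : ∀ n → powerSum (suc n) ≈ v * powerSum n + u ^ suc n
      powerSum-sym zero    = +-comm _ _
      powerSum-sym (suc n) = begin
        u * powerSum (suc n) + v ^ suc (suc n)                       ≈⟨ +-congʳ (*-congˡ (powerSum-sym n)) ⟩
        u * (v * powerSum n + u ^ suc n) + v * v ^ suc n             ≈⟨ solve 5 (λ u v s y z → u :* (v :* s :+ y) :+ v :* z := v :* (u :* s :+ z) :+ u :* y) refl u v (powerSum n) (u ^ suc n) (v ^ suc n) ⟩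
        v * (u * powerSum n + v ^ suc n) + u * u ^ suc n             ∎

      dicksonE≈powerSum : ∀ n → dicksonE n ≈ powerSum n
      dicksonE≈powerSum zero       = trans (+-identityʳ _) (firstTerm 0)
      dicksonE≈powerSum (suc zero) = begin
        eTerm 1 0 + 0#         ≈⟨ trans (+-identityʳ _) (firstTerm 1) ⟩
        x * 1#                 ≈⟨ trans (*-identityʳ x) x≈u+v ⟩
        u + v                  ≈⟨ solve 2 (λ u v → u :* :1 :+ v :* :1 := u :+ v) refl u v ⟨
        u * 1# + v * 1#        ∎
      dicksonE≈powerSum (suc (suc n)) = begin
        dicksonE (suc (suc n))                                                 ≈⟨ dicksonE-recurrence n ⟩
        x * dicksonE (suc n) + - a * dicksonE n                                ≈⟨ +-cong (*-cong x≈u+v (dicksonE≈powerSum (suc n))) (*-cong (-‿cong a≈u*v) (dicksonE≈powerSum n)) ⟩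
        (u + v) * (u * s + v ^ suc n) + - (u * v) * s                          ≈⟨ solve 4 (λ u v s z → (u :+ v) :* (u :* s :+ z) :+ :- (u :* v) :* s := u :* (u :* s :+ z) :+ v :* z) refl u v s (v ^ suc n) ⟩
        u * (u * s + v ^ suc n) + v * v ^ suc n                                ∎
        where s = powerSum n

      powerSum-difference : ∀ n → (u - v) * powerSum n ≈ u ^ suc n - v ^ suc n
      powerSum-difference n = begin
        (u - v) * s                                              ≈⟨ solve 3 (λ u v s → (u :- v) :* s := u :* s :- v :* s) refl u v s ⟩
        u * s - v * s                                            ≈⟨ solve 4 (λ us vs y z → us :- vs := y :- z :+ ((us :+ z) :- (vs :+ y))) refl (u * s) (v * s) (u ^ suc n) (v ^ suc n) ⟩
        u ^ suc n - v ^ suc n + (powerSum (suc n) - (v * s + u ^ suc n))  ≈⟨ +-congˡ (x≈y⇒x-y≈0 (powerSum-sym n)) ⟩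
        u ^ suc n - v ^ suc n + 0#                               ≈⟨ +-identityʳ _ ⟩
        u ^ suc n - v ^ suc n                                    ∎
        where s = powerSum n

      powerSum-diagonal : u ≈ v → ∀ n → powerSum n ≈ suc n · 1# * u ^ n
      powerSum-diagonal u≈v zero    = solve 0 (:1 := (:1 :+ :0) :* :1) refl
      powerSum-diagonal u≈v (suc n) = begin
        u * powerSum n + v ^ suc n                        ≈⟨ +-cong (*-congˡ (powerSum-diagonal u≈v n)) (^-congˡ (suc n) (sym u≈v)) ⟩
        u * (suc n · 1# * u ^ n) + u * u ^ n              ≈⟨ solve 3 (λ u m y → u :* (m :* y) :+ u :* y := (:1 :+ m) :* (u :* y)) refl u (suc n · 1#) (u ^ n) ⟩
        (1# + suc n · 1#) * (u * u ^ n)                   ∎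

      -- In E (n + 2) - a E n the symmetric form of the sum exhibits a term u v s, which cancels
      -- against a E n.
      dicksonD≈power+power : ∀ n → dicksonD (suc n) ≈ u ^ suc n + v ^ suc n
      dicksonD≈power+power zero = begin
        (1# + 0#) * (x * 1#) + 0#      ≈⟨ solve 1 (λ x → (:1 :+ :0) :* (x :* :1) :+ :0 := x) refl x ⟩
        x                              ≈⟨ x≈u+v ⟩
        u + v                          ≈⟨ solve 2 (λ u v → u :* :1 :+ v :* :1 := u :+ v) refl u v ⟨
        u * 1# + v * 1#                ∎
      dicksonD≈power+power (suc n) = begin
        dicksonD (suc (suc n))                                       ≈⟨ dicksonD≈dicksonE+dicksonE n ⟩
        dicksonE (suc (suc n)) + - a * dicksonE n                    ≈⟨ +-cong (trans (dicksonE≈powerSum (suc (suc n))) (+-congʳ (*-congˡ (powerSum-sym n))))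
                                                                               (*-cong (-‿cong a≈u*v) (dicksonE≈powerSum n)) ⟩
        u * (v * s + u ^ suc n) + v ^ suc (suc n) + - (u * v) * s    ≈⟨ solve 5 (λ u v s y z → u :* (v :* s :+ y) :+ z :+ :- (u :* v) :* s := u :* y :+ z) refl u v s (u ^ suc n) (v ^ suc (suc n)) ⟩
        u ^ suc (suc n) + v ^ suc (suc n)                            ∎
        where s = powerSum n

-- Homomorphisms from a field, evaluation of polynomials and conjugate roots.

module HomomorphismProperties {c₁ ℓ₁ c₂ ℓ₂} (S : Field c₁ ℓ₁) (R : CommutativeRing c₂ ℓ₂)
  {φ : Field.Carrier S → CommutativeRing.Carrier R}
  (φ-hom : RingMorphisms.IsRingHomomorphism (Field.rawRing S) (CommutativeRing.rawRing R) φ) where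
  private module S where
    open Field S public
    open SemiringMult semiring using () renaming (_×_ to _·_) public
  open CommutativeRing R hiding (zero)
  open CommutativeRingProperties R
  open RingMorphisms.IsRingHomomorphism φ-hom public
    renaming (⟦⟧-cong to φ-cong; +-homo to φ-+; *-homo to φ-*; -‿homo to φ-neg; 0#-homo to φ-0; 1#-homo to φ-1)

  φ-^ : ∀ x n → φ (x S.^ n) ≈ φ x ^ n
  φ-^ x zero    = φ-1
  φ-^ x (suc n) = trans (φ-* x _) (*-congˡ (φ-^ x n))

  φ-· : ∀ n x → φ (n S.· x) ≈ n · φ x
  φ-· zero    x = φ-0
  φ-· (suc n) x = trans (φ-+ x _) (+-congˡ (φ-· n x))

  φ-≉0 : ¬ (1# ≈ 0#) → ∀ {x} → ¬ (x S.≈ S.0#) → ¬ (φ x ≈ 0#)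
  φ-≉0 1≉0 {x} x≉0 φx≈0 = 1≉0 (begin
    1#                          ≈⟨ φ-1 ⟨
    φ S.1#                      ≈⟨ φ-cong (proj₂ (S.invertible x x≉0)) ⟨
    φ (x S.* S.inv x x≉0)       ≈⟨ φ-* x _ ⟩
    φ x * φ (S.inv x x≉0)       ≈⟨ trans (*-congʳ φx≈0) (zeroˡ _) ⟩
    0#                          ∎)
    where open SetoidReasoning setoid

  φ-fixed : ∀ {q} → (∀ x → x S.^ q S.≈ x) → ∀ x → φ x ^ q ≈ φ x
  φ-fixed {q} fixed x = trans (sym (φ-^ x q)) (φ-cong (fixed x))

  module Injective (1≉0 : Nontrivial R) (_≟_ : DecidableEquality S.commutativeRing) where
    φ≈0⇒≈0 : ∀ {x} → φ x ≈ 0# → x S.≈ S.0#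
    φ≈0⇒≈0 {x} φx≈0 with x ≟ S.0#
    ... | yes x≈0 = x≈0
    ... | no  x≉0 = contradiction φx≈0 (φ-≉0 1≉0 x≉0)

    φ-injective : ∀ {x y} → φ x ≈ φ y → x S.≈ y
    φ-injective {x} {y} φx≈φy = S-x-y≈0⇒x≈y x y (φ≈0⇒≈0 (trans (φ-+ x _) (trans (+-congˡ (φ-neg y)) (x≈y⇒x-y≈0 φx≈φy))))
      where open CommutativeRingProperties S.commutativeRing using () renaming (x-y≈0⇒x≈y to S-x-y≈0⇒x≈y)

module Evaluation {c₁ ℓ₁ c₂ ℓ₂} (S : Field c₁ ℓ₁) (R : CommutativeRing c₂ ℓ₂)
  {φ : Field.Carrier S → CommutativeRing.Carrier R}
  (φ-hom : RingMorphisms.IsRingHomomorphism (Field.rawRing S) (CommutativeRing.rawRing R) φ) where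
  private module S where
    open Field S public
    open SemiringMult semiring using () renaming (_×_ to _·_) public
  open CommutativeRing R hiding (zero)
  open CommutativeRingProperties R
  open HomomorphismProperties S R φ-hom
  open Polynomial S
  open PolynomialProperties S using (module P; coeff-≈; tail-≈; -ₚ_; MonicOfDegree; divide)
  open IntegerSolver R using (solve; _:=_; _:+_; _:*_; _:-_; :-_; :0; :1)
  open SetoidReasoning setoid

  evaluate : Poly → Carrier → Carrier
  evaluate f = eval (map φ f)

  evaluate-≈0 : ∀ {f} x → f ≈ₚ [] → evaluate f x ≈ 0#
  evaluate-≈0 {[]}    x f≈0 = refl
  evaluate-≈0 {a ∷ f} x f≈0 = begin
    φ a + x * evaluate f x      ≈⟨ +-cong (trans (φ-cong (f≈0 .coeff-≈ 0)) φ-0) (*-congˡ (evaluate-≈0 {f} x (coefficientwise (λ i → f≈0 .coeff-≈ (suc i))))) ⟩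
    0# + x * 0#                 ≈⟨ trans (+-identityˡ _) (zeroʳ x) ⟩
    0#                          ∎

  evaluate-cong : ∀ {f g} x → f ≈ₚ g → evaluate f x ≈ evaluate g x
  evaluate-cong {[]}    {g}     x f≈g = sym (evaluate-≈0 {g} x (P.sym f≈g))
  evaluate-cong {a ∷ f} {[]}    x f≈g = evaluate-≈0 {a ∷ f} x f≈g
  evaluate-cong {a ∷ f} {b ∷ g} x f≈g = +-cong (φ-cong (f≈g .coeff-≈ 0)) (*-congˡ (evaluate-cong {f} {g} x (tail-≈ f≈g)))

  eval-cong : ∀ f {x y} → x ≈ y → eval f x ≈ eval f y
  eval-cong []      x≈y = refl
  eval-cong (a ∷ f) x≈y = +-congˡ (*-cong x≈y (eval-cong f x≈y))

  evaluate-+ : ∀ f g x → evaluate (f +ₚ g) x ≈ evaluate f x + evaluate g x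
  evaluate-+ []      g       x = sym (+-identityˡ _)
  evaluate-+ (a ∷ f) []      x = sym (+-identityʳ _)
  evaluate-+ (a ∷ f) (b ∷ g) x = begin
    φ (a S.+ b) + x * evaluate (f +ₚ g) x                          ≈⟨ +-cong (φ-+ a b) (*-congˡ (evaluate-+ f g x)) ⟩
    φ a + φ b + x * (evaluate f x + evaluate g x)                  ≈⟨ solve 5 (λ a b x f g → a :+ b :+ x :* (f :+ g) := (a :+ x :* f) :+ (b :+ x :* g)) refl _ _ x _ _ ⟩
    (φ a + x * evaluate f x) + (φ b + x * evaluate g x)            ∎

  evaluate-neg : ∀ f x → evaluate (-ₚ f) x ≈ - evaluate f x
  evaluate-neg []      x = solve 0 (:0 := :- :0) refl
  evaluate-neg (a ∷ f) x = trans (+-cong (φ-neg a) (*-congˡ (evaluate-neg f x)))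
    (solve 3 (λ a x f → :- a :+ x :* :- f := :- (a :+ x :* f)) refl _ x _)

  evaluate-- : ∀ f g x → evaluate (f -ₚ g) x ≈ evaluate f x - evaluate g x
  evaluate-- f g x = trans (evaluate-+ f (-ₚ g) x) (+-congˡ (evaluate-neg g x))

  evaluate-scale : ∀ a f x → evaluate (map (a S.*_) f) x ≈ φ a * evaluate f x
  evaluate-scale a []      x = sym (zeroʳ _)
  evaluate-scale a (b ∷ f) x = trans (+-cong (φ-* a b) (*-congˡ (evaluate-scale a f x)))
    (solve 4 (λ a b x f → a :* b :+ x :* (a :* f) := a :* (b :+ x :* f)) refl _ _ x _)

  evaluate-0∷ : ∀ f x → evaluate (S.0# ∷ f) x ≈ x * evaluate f x
  evaluate-0∷ f x = trans (+-congʳ φ-0) (+-identityˡ _)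

  evaluate-* : ∀ f g x → evaluate (f *ₚ g) x ≈ evaluate f x * evaluate g x
  evaluate-* []      g x = sym (zeroˡ _)
  evaluate-* (a ∷ f) g x = begin
    evaluate (map (a S.*_) g +ₚ (S.0# ∷ (f *ₚ g))) x            ≈⟨ evaluate-+ (map (a S.*_) g) _ x ⟩
    evaluate (map (a S.*_) g) x + evaluate (S.0# ∷ (f *ₚ g)) x  ≈⟨ +-cong (evaluate-scale a g x) (trans (evaluate-0∷ (f *ₚ g) x) (*-congˡ (evaluate-* f g x))) ⟩
    φ a * evaluate g x + x * (evaluate f x * evaluate g x)      ≈⟨ solve 4 (λ a x f g → a :* g :+ x :* (f :* g) := (a :+ x :* f) :* g) refl _ x _ _ ⟩
    (φ a + x * evaluate f x) * evaluate g x                     ∎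

  evaluate-constant : ∀ a x → evaluate (constant a) x ≈ φ a
  evaluate-constant a x = trans (+-congˡ (zeroʳ x)) (+-identityʳ _)

  evaluate-monomial : ∀ a k x → evaluate (monomial a k) x ≈ φ a * x ^ k
  evaluate-monomial a zero    x = trans (evaluate-constant a x) (sym (*-identityʳ _))
  evaluate-monomial a (suc k) x = trans (evaluate-0∷ (monomial a k) x)
    (trans (*-congˡ (evaluate-monomial a k x)) (solve 3 (λ x a y → x :* (a :* y) := a :* (x :* y)) refl x _ _))

  evaluate-∣ : ∀ {f g x} → f ∣ₚ g → evaluate f x ≈ 0# → evaluate g x ≈ 0#
  evaluate-∣ {f} {g} {x} (k , e) fx≈0 = begin
    evaluate g x                    ≈⟨ evaluate-cong x e ⟨
    evaluate (k *ₚ f) x             ≈⟨ evaluate-* k f x ⟩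
    evaluate k x * evaluate f x     ≈⟨ trans (*-congˡ fx≈0) (zeroʳ _) ⟩
    0#                              ∎

  module _ (a : S.Carrier) (x : Carrier) where
    private module Dickson = DicksonIdentities R

    evaluate-term : ∀ m i k → evaluate (monomial (m S.· ((S.- a) S.^ i)) k) x ≈ m · (- φ a) ^ i * x ^ k
    evaluate-term m i k = trans (evaluate-monomial _ k x) (*-congʳ (trans (φ-· m _)
      (×-congʳ m (trans (φ-^ (S.- a) i) (^-congˡ i (φ-neg a))))))

    evaluate-sumUpTo : ∀ m f g → (∀ i → evaluate (f i) x ≈ g i) → evaluate (sumUpTo m f) x ≈ Dickson.Σ (suc m) g
    evaluate-sumUpTo zero    f g e = trans (evaluate-+ (f 0) [] x) (+-congʳ (e 0))
    evaluate-sumUpTo (suc m) f g e = trans (evaluate-+ (f 0) _ x) (+-cong (e 0) (evaluate-sumUpTo m (f ∘ suc) (g ∘ suc) (e ∘ suc)))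

    evaluate-dickson : ∀ n (coefficient exponent : ℕ → ℕ) →
      evaluate (sumUpTo ⌊ n /2⌋ λ i → monomial (coefficient i S.· ((S.- a) S.^ i)) (exponent i)) x ≈
      Dickson.Σ (suc ⌊ n /2⌋) (λ i → coefficient i · (- φ a) ^ i * x ^ exponent i)
    evaluate-dickson n coefficient exponent =
      evaluate-sumUpTo ⌊ n /2⌋ (λ i → monomial (coefficient i S.· ((S.- a) S.^ i)) (exponent i)) _
        (λ i → evaluate-term (coefficient i) i (exponent i))

    evaluate-dicksonD : ∀ n → evaluate (dicksonD n a) x ≈ Dickson.dicksonD x (φ a) n
    evaluate-dicksonD n = evaluate-dickson n (λ i → (n ℕ.* ((n ∸ i) C i)) div (n ∸ i)) (λ i → n ∸ 2 ℕ.* i)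

    evaluate-dicksonE : ∀ n → evaluate (dicksonE n a) x ≈ Dickson.dicksonE x (φ a) n
    evaluate-dicksonE n = evaluate-dickson n (λ i → (n ∸ i) C i) (λ i → n ∸ 2 ℕ.* i)

  -- The q-th power is additive and multiplicative and fixes the coefficients.
  evaluate-frobenius : ∀ q → .{{NonZero q}} → Additive q → (∀ a → φ a ^ q ≈ φ a) →
                       ∀ f x → evaluate f (x ^ q) ≈ evaluate f x ^ q
  evaluate-frobenius q add fixed []      x = sym (x≈0⇒x^n≈0 q refl)
  evaluate-frobenius q add fixed (a ∷ f) x = begin
    φ a + x ^ q * evaluate f (x ^ q)                 ≈⟨ +-cong (sym (fixed a)) (trans (*-congˡ (evaluate-frobenius q add fixed f x)) (sym (^-distrib-* x _ q))) ⟩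
    φ a ^ q + (x * evaluate f x) ^ q                 ≈⟨ add _ _ ⟨
    (φ a + x * evaluate f x) ^ q                         ∎

  module ConjugateRoots (_≟_ : DecidableEquality S.commutativeRing) (1≉0 : Nontrivial R) (integral : NoZeroDivisors R)
    (q : ℕ) .{{_ : NonZero q}} (add : Additive q) (fixed : ∀ a → φ a ^ q ≈ φ a) where
    open IntegralDomain R 1≉0 integral
    open Injective 1≉0 _≟_

    conjugate : Carrier → ℕ → Carrier
    conjugate x i = x ^ (q ℕ.^ i)

    conjugate-suc : ∀ x i → conjugate x (suc i) ≈ conjugate x i ^ q
    conjugate-suc x i = trans (sym (^-assocʳ x q (q ℕ.^ i))) (^-comm x q (q ℕ.^ i))

    conjugate-root : ∀ f {x} → evaluate f x ≈ 0# → ∀ i → evaluate f (conjugate x i) ≈ 0#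
    conjugate-root f {x} fx≈0 zero    = trans (eval-cong (map φ f) (*-identityʳ x)) fx≈0
    conjugate-root f {x} fx≈0 (suc i) = begin
      evaluate f (conjugate x (suc i))         ≈⟨ eval-cong (map φ f) (conjugate-suc x i) ⟩
      evaluate f (conjugate x i ^ q)       ≈⟨ evaluate-frobenius q add fixed f (conjugate x i) ⟩
      evaluate f (conjugate x i) ^ q       ≈⟨ x≈0⇒x^n≈0 q (conjugate-root f fx≈0 i) ⟩
      0#                                       ∎

    conjugate-injective : ∀ i {x y} → conjugate x i ≈ conjugate y i → x ≈ y
    conjugate-injective zero    e = trans (sym (*-identityʳ _)) (trans e (*-identityʳ _))
    conjugate-injective (suc i) {x} {y} e = conjugate-injective i
      (additive⇒injective q add (trans (sym (conjugate-suc x i)) (trans e (conjugate-suc y i))))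

    -- Injectivity of the q ^ i-th power turns a coincidence of the conjugates `i` and `j` into the
    -- period j - i, which is less than `n`.
    conjugates-distinct : ∀ {n x} → (∀ k → 0 < k → conjugate x k ≈ x → n ≤ k) →
                          ∀ {i j} → i < j → j < n → ¬ (conjugate x i ≈ conjugate x j)
    conjugates-distinct {n} {x} period {i} {j} i<j j<n e = ℕ.<⇒≱ j<n
      (ℕ.≤-trans (period (j ∸ i) (ℕ.m<n⇒0<n∸m i<j) (sym (conjugate-injective i (begin
        conjugate x i                                ≈⟨ e ⟩
        x ^ (q ℕ.^ j)                            ≡⟨ ≡.cong (λ k → x ^ (q ℕ.^ k)) (ℕ.m∸n+n≡m (ℕ.<⇒≤ i<j)) ⟨
        x ^ (q ℕ.^ (j ∸ i ℕ.+ i))                ≡⟨ ≡.cong (x ^_) (ℕ.^-distribˡ-+-* q (j ∸ i) i) ⟩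
        x ^ (q ℕ.^ (j ∸ i) ℕ.* q ℕ.^ i)      ≈⟨ ^-assocʳ x (q ℕ.^ (j ∸ i)) (q ℕ.^ i) ⟨
        conjugate (conjugate x (j ∸ i)) i            ∎)))) (ℕ.m∸n≤m j i))

    -- The remainder of f modulo g vanishes at the n distinct conjugates of x.
    commonRoot⇒∣ : ∀ {n} f g x → MonicOfDegree n g → evaluate f x ≈ 0# → evaluate g x ≈ 0# →
                   (∀ k → 0 < k → conjugate x k ≈ x → n ≤ k) → g ∣ₚ f
    commonRoot⇒∣ {n} f g x monic fx≈0 gx≈0 period with divide g monic f
    ... | k , r , f≈ , r< = k , P.trans (P.sym (P.+-identityʳ (k *ₚ g))) (P.trans (P.+-congˡ {k *ₚ g} (P.sym r≈0)) (P.sym f≈))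
      where
      r-root : ∀ i → evaluate r (conjugate x i) ≈ 0#
      r-root i = begin
        evaluate r y                                 ≈⟨ +-identityˡ _ ⟨
        0# + evaluate r y                            ≈⟨ +-congʳ (trans (evaluate-* k g y) (trans (*-congˡ (conjugate-root g gx≈0 i)) (zeroʳ _))) ⟨
        evaluate (k *ₚ g) y + evaluate r y           ≈⟨ trans (evaluate-cong y f≈) (evaluate-+ (k *ₚ g) r y) ⟨
        evaluate f y                                 ≈⟨ conjugate-root f fx≈0 i ⟩
        0#                                           ∎
        where y = conjugate x i
      coeff-take : ∀ m f i → i < m → coeff (take m f) i S.≈ coeff f i
      coeff-take (suc m) []      i       _         = S.refl
      coeff-take (suc m) (a ∷ f) zero    _         = S.refl
      coeff-take (suc m) (a ∷ f) (suc i) (s≤s i<m) = coeff-take m f i i<m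
      coeff-take-≥ : ∀ m f i → m ≤ i → coeff (take m f) i S.≈ S.0#
      coeff-take-≥ zero    f       i       _         = S.refl
      coeff-take-≥ (suc m) []      i       _         = S.refl
      coeff-take-≥ (suc m) (a ∷ f) (suc i) (s≤s m≤i) = coeff-take-≥ m f i m≤i
      -- The list `r` may be longer than `n` because of trailing zeros, whereas the root count
      -- depends on the length of the list.
      r≈take : r ≈ₚ take n r
      r≈take .coeff-≈ i with i ℕ.<? n
      ... | yes i<n = S.sym (coeff-take n r i i<n)
      ... | no  i≮n = S.trans (r< i (ℕ.≮⇒≥ i≮n)) (S.sym (coeff-take-≥ n r i (ℕ.≮⇒≥ i≮n)))
      all≈0 : All (λ y → y ≈ 0#) (map φ (take n r))
      all≈0 = tooManyRoots⇒≈0 (map φ (take n r)) (applyUpTo (conjugate x) n)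
        (≡.subst₂ _≤_ (≡.sym (≡.trans (length-map φ (take n r)) (length-take n r))) (≡.sym (length-applyUpTo (conjugate x) n)) (ℕ.m⊓n≤m n (length r)))
        (AllPairsₚ.applyUpTo⁺₁ (conjugate x) n (conjugates-distinct period))
        (Allₚ.applyUpTo⁺₂ (conjugate x) n (λ i → trans (evaluate-cong (conjugate x i) (P.sym r≈take)) (r-root i)))
      zeros : ∀ f → All (λ y → y ≈ 0#) (map φ f) → f ≈ₚ []
      zeros []      []          = P.refl
      zeros (a ∷ f) (a≈0 ∷ f≈0) = coefficientwise λ { zero → φ≈0⇒≈0 a≈0 ; (suc i) → zeros f f≈0 .coeff-≈ i }
      r≈0 : r ≈ₚ []
      r≈0 = P.trans r≈take (zeros (take n r) all≈0)

-- Degree of the Dickson polynomials, and extension of the base field.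

module DicksonDegree {c ℓ} (S : Field c ℓ) where
  open Field S hiding (_^_; zero)
  open Polynomial S
  open PolynomialProperties S

  coeff-monomial : ∀ a k → coeff (monomial a k) k ≈ a
  coeff-monomial a zero    = refl
  coeff-monomial a (suc k) = coeff-monomial a k

  below-monomial : ∀ a k → DegreeBelow (suc k) (monomial a k)
  below-monomial a zero    = λ { (suc i) _ → refl }
  below-monomial a (suc k) = below-∷ 0# (monomial a k) (below-monomial a k)

  -- Only the term with i = 0 reaches X ^ n, and its coefficient is n C(n, 0) / n = 1.
  dicksonD-monic : ∀ n a → 0 < n → MonicOfDegree n (dicksonD n a)
  dicksonD-monic n@(suc n-1) a _ = monic-+ (term 0) (foldr _+ₚ_ [] (applyUpTo (term ∘ suc) ⌊ n /2⌋))
    (lead , below-monomial _ n) (below-sum ⌊ n /2⌋ (term ∘ suc) (λ i → below-term (suc i) (s≤s z≤n)))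
    where
    open SemiringMult semiring using (×-congˡ; ×-homo-1) renaming (_×_ to _·_)
    open Field S using (_^_)
    term : ℕ → Poly
    term i = monomial (((n ℕ.* ((n ∸ i) C i)) div (n ∸ i)) · ((- a) ^ i)) (n ∸ 2 ℕ.* i)
    lead : coeff (term 0) n ≈ 1#
    lead = trans (coeff-monomial _ n) (trans (×-congˡ coefficient≡1) (×-homo-1 1#))
      where
      coefficient≡1 : (n ℕ.* (n C 0)) div n ≡ 1
      coefficient≡1 = ≡.trans (≡.cong (_div n) (≡.trans (≡.cong (n ℕ.*_) (Arithmetic.nC0≡1 n)) (ℕ.*-comm n 1))) (m*n/n≡m 1 n)
    below-term : ∀ i → 0 < i → DegreeBelow n (term i)
    below-term (suc i) _ = below-weaken (term (suc i)) (s≤s (ℕ.m∸n≤m n-1 (i ℕ.+ 1 ℕ.* suc i))) (below-monomial _ (n ∸ 2 ℕ.* suc i))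
    below-sum : ∀ m f → (∀ i → DegreeBelow n (f i)) → DegreeBelow n (foldr _+ₚ_ [] (applyUpTo f m))
    below-sum zero    f f< = λ _ _ → refl
    below-sum (suc m) f f< = below-+ (f 0) _ (f< 0) (below-sum m (f ∘ suc) (f< ∘ suc))

module MapPolynomial {c₁ ℓ₁ c₂ ℓ₂} (S : Field c₁ ℓ₁) (S′ : Field c₂ ℓ₂)
  {φ : Field.Carrier S → Field.Carrier S′} (φ-hom : IsFieldEmbedding S S′ φ) where
  private
    module S  = Field S
    module S′ where
      open Field S′ public
      open CommutativeRingProperties commutativeRing using (_·_; ×-congʳ; ^-congˡ) public
    module S[x]  where
      open Polynomial S public
      open PolynomialProperties S public
    module S′[x] where
      open Polynomial S′ public
      open PolynomialProperties S′ public
  open HomomorphismProperties S S′.commutativeRing φ-hom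
  open S′[x] using (_≈ₚ_; coeff-≈; module P; ∷-cong)

  coeff-map : ∀ f i → S′[x].coeff (map φ f) i S′.≈ φ (S[x].coeff f i)
  coeff-map []      i       = S′.sym φ-0
  coeff-map (a ∷ f) zero    = S′.refl
  coeff-map (a ∷ f) (suc i) = coeff-map f i

  map-cong : ∀ {f g} → f S[x].≈ₚ g → map φ f ≈ₚ map φ g
  map-cong {f} {g} e .coeff-≈ i = S′.trans (coeff-map f i) (S′.trans (φ-cong (S[x].coeff-≈ e i)) (S′.sym (coeff-map g i)))

  map-+ : ∀ f g → map φ (f S[x].+ₚ g) ≈ₚ map φ f S′[x].+ₚ map φ g
  map-+ []      g       = P.refl
  map-+ (a ∷ f) []      = P.refl
  map-+ (a ∷ f) (b ∷ g) = ∷-cong (φ-+ a b) (map-+ f g)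

  map-neg : ∀ f → map φ (S[x].-ₚ f) ≈ₚ S′[x].-ₚ map φ f
  map-neg []      = P.refl
  map-neg (a ∷ f) = ∷-cong (φ-neg a) (map-neg f)

  map-- : ∀ f g → map φ (f S[x].-ₚ g) ≈ₚ map φ f S′[x].-ₚ map φ g
  map-- f g = P.trans (map-+ f (S[x].-ₚ g)) (P.+-congˡ {map φ f} (map-neg g))

  map-scale : ∀ a f → map φ (map (a S.*_) f) ≈ₚ map (φ a S′.*_) (map φ f)
  map-scale a []      = P.refl
  map-scale a (b ∷ f) = ∷-cong (φ-* a b) (map-scale a f)

  map-* : ∀ f g → map φ (f S[x].*ₚ g) ≈ₚ map φ f S′[x].*ₚ map φ g
  map-* []      g = P.refl
  map-* (a ∷ f) g = P.trans (map-+ (map (a S.*_) g) _)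
    (P.+-cong (map-scale a g) (∷-cong φ-0 (map-* f g)))

  map-monomial : ∀ a k → map φ (S[x].monomial a k) ≈ₚ S′[x].monomial (φ a) k
  map-monomial a zero    = P.refl
  map-monomial a (suc k) = ∷-cong φ-0 (map-monomial a k)

  monomial-cong : ∀ {a b} k → a S′.≈ b → S′[x].monomial a k ≈ₚ S′[x].monomial b k
  monomial-cong zero    a≈b = ∷-cong a≈b P.refl
  monomial-cong (suc k) a≈b = ∷-cong S′.refl (monomial-cong k a≈b)

  map-sumUpTo : ∀ m f {g} → (∀ i → map φ (f i) ≈ₚ g i) → map φ (S[x].sumUpTo m f) ≈ₚ S′[x].sumUpTo m g
  map-sumUpTo zero    f e = P.trans (map-+ (f 0) []) (P.+-cong (e 0) (P.refl {[]}))
  map-sumUpTo (suc m) f e = P.trans (map-+ (f 0) _) (P.+-cong (e 0) (map-sumUpTo m (f ∘ suc) (e ∘ suc)))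

  map-dicksonD : ∀ n a → map φ (S[x].dicksonD n a) ≈ₚ S′[x].dicksonD n (φ a)
  map-dicksonD n a = map-sumUpTo ⌊ n /2⌋ _ λ i → P.trans (map-monomial _ (n ∸ 2 ℕ.* i))
    (monomial-cong (n ∸ 2 ℕ.* i) (S′.trans (φ-· ((n ℕ.* ((n ∸ i) C i)) div (n ∸ i)) _)
      (S′.×-congʳ ((n ℕ.* ((n ∸ i) C i)) div (n ∸ i)) (S′.trans (φ-^ (S.- a) i) (S′.^-congˡ i (φ-neg a))))))

  module Reflect (_≟_ : DecidableEquality S.commutativeRing) where
    open Injective S′.1≉0 _≟_

    monic-reflect : ∀ {n} f → S′[x].MonicOfDegree n (map φ f) → S[x].MonicOfDegree n f
    monic-reflect {n} f (lead , below) =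
      φ-injective (S′.trans (S′.sym (coeff-map f n)) (S′.trans lead (S′.sym φ-1))) ,
      λ i n<i → φ≈0⇒≈0 (S′.trans (S′.sym (coeff-map f i)) (below i n<i))

-- Arithmetic of the order m and of its factors d and t.

module ExponentArithmetic (q n m : ℕ) (q%4≡3 : q % 4 ≡ 3) (n%2≡1 : n % 2 ≡ 1)
  (rad∣q-1 : rad (n ℕ.+ 1) ∣ q ∸ 1) (m∣2[n+1] : m ∣ 2 ℕ.* (n ℕ.+ 1)) where
  open import Data.Nat.Base using (_+_; _*_; _^_; ≢-nonZero; ≢-nonZero⁻¹)
  open import Data.Nat.Properties
  open import Data.Nat.Divisibility
  open import Data.Nat.Primality using (euclidsLemma)
  open import Data.Nat.Coprimality using (coprime-divisor; gcd≡1⇒coprime)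
  open import Data.Nat.GCD using (gcd[m,n]∣m; gcd[m,n]∣n; gcd-greatest; gcd[m,n]≢0)
  open import Data.Nat.Tactic.RingSolver using (solve-∀)
  open import Relation.Binary.PropositionalEquality
  open Arithmetic

  z : ℕ
  z = q ^ 2 ∸ 1

  q≡3+4w : q ≡ 3 + q / 4 * 4
  q≡3+4w = trans (m≡m%n+[m/n]*n q 4) (cong (_+ q / 4 * 4) q%4≡3)

  z≡[q-1][q+1] : z ≡ (q ∸ 1) * (q + 1)
  z≡[q-1][q+1] = subst (λ q → q ^ 2 ∸ 1 ≡ (q ∸ 1) * (q + 1)) (sym q≡3+4w) (lemma (2 + q / 4 * 4))
    where
    expand : ∀ r → suc r * (suc r * 1) ≡ suc (r * (suc r + 1))
    expand = solve-∀
    lemma : ∀ r → suc r ^ 2 ∸ 1 ≡ r * (suc r + 1)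
    lemma r = cong (_∸ 1) (expand r)

  q^2≡1+z : q ^ 2 ≡ suc z
  q^2≡1+z = subst (λ q → q ^ 2 ≡ suc (q ^ 2 ∸ 1)) (sym q≡3+4w) refl

  q-1∣z : q ∸ 1 ∣ z
  q-1∣z = subst (q ∸ 1 ∣_) (sym z≡[q-1][q+1]) (m∣m*n (q + 1))

  -- Already q + 1 is a multiple of 4, because q is 3 modulo 4.
  4∣z : 4 ∣ z
  4∣z = subst (4 ∣_) (sym z≡[q-1][q+1]) (subst (λ q → 4 ∣ (q ∸ 1) * (q + 1)) (sym q≡3+4w)
    (∣n⇒∣m*n (2 + q / 4 * 4) (divides (1 + q / 4) (lemma (q / 4)))))
    where
    lemma : ∀ w → 3 + w * 4 + 1 ≡ (1 + w) * 4
    lemma = solve-∀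

  instance
    z≢0 : NonZero z
    z≢0 = ≢-nonZero λ z≡0 → contradiction (trans (sym z≡[q-1][q+1]) z≡0)
      (subst (λ q → (q ∸ 1) * (q + 1) ≢ 0) (sym q≡3+4w) λ ())

    n+1≢0 : NonZero (n + 1)
    n+1≢0 = ≢-nonZero λ e → contradiction (m+n≡0⇒n≡0 n e) λ ()

    m≢0 : NonZero m
    m≢0 = ≢-nonZero λ { refl → contradiction (m*n≡0⇒m≡0 2 (n + 1) (0∣⇒≡0 m∣2[n+1])) λ () }

  2∣n+1 : 2 ∣ n + 1
  2∣n+1 = divides (1 + n / 2) (trans (cong (_+ 1) (trans (m≡m%n+[m/n]*n n 2) (cong (_+ n / 2 * 2) n%2≡1))) (lemma (n / 2)))
    where
    lemma : ∀ w → 1 + w * 2 + 1 ≡ (1 + w) * 2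
    lemma = solve-∀

  prime∣n+1⇒∣q-1 : ∀ r → Prime r → r ∣ n + 1 → r ∣ q ∸ 1
  prime∣n+1⇒∣q-1 r pr r∣n+1 = ∣-trans (primeDivisor∣rad (n + 1) pr r∣n+1) rad∣q-1

  -- Since n + 1 is even, a prime factor of 2 (n + 1) divides n + 1, hence q - 1 by the condition on
  -- the radical.
  prime∣m⇒∣z : ∀ r → Prime r → r ∣ m → r ∣ z
  prime∣m⇒∣z r pr r∣m = ∣-trans (prime∣n+1⇒∣q-1 r pr (helper (euclidsLemma 2 (n + 1) pr (∣-trans r∣m m∣2[n+1])))) q-1∣z
    where
    helper : r ∣ 2 ⊎ r ∣ n + 1 → r ∣ n + 1
    helper (inj₁ r∣2)   = ∣-trans r∣2 2∣n+1
    helper (inj₂ r∣n+1) = r∣n+1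

  -- For ζ of order m, the order of Q = q ^ 2 modulo m is t, and ζ ^ t has
  -- order d.
  abstract
    d t z/d : ℕ
    d   = gcd m z
    t   = quotient (gcd[m,n]∣m m z)
    z/d = quotient (gcd[m,n]∣n m z)

    m≡t*d : m ≡ t * d
    m≡t*d = _∣_.equality (gcd[m,n]∣m m z)

    z≡z/d*d : z ≡ z/d * d
    z≡z/d*d = _∣_.equality (gcd[m,n]∣n m z)

    d-greatest : ∀ {x} → x ∣ m → x ∣ z → x ∣ d
    d-greatest = gcd-greatest

  d∣m : d ∣ m
  d∣m = divides t m≡t*d

  d∣z : d ∣ z
  d∣z = divides z/d z≡z/d*d

  instance
    d≢0 : NonZero d
    d≢0 = ≢-nonZero λ d≡0 → contradiction (trans m≡t*d (trans (cong (t *_) d≡0) (*-zeroʳ t))) (≢-nonZero⁻¹ m)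

    t≢0 : NonZero t
    t≢0 = ≢-nonZero λ t≡0 → contradiction (trans m≡t*d (cong (_* d) t≡0)) (≢-nonZero⁻¹ m)

  div-exact : ∀ k l → .{{NonZero l}} → (k * l) div l ≡ k
  div-exact k l@(suc _) = m*n/n≡m k l

  t∣m : t ∣ m
  t∣m = divides d (trans m≡t*d (*-comm t d))

  -- A prime factor of `t` divides `m`, hence also `z`, and so their greatest common divisor.
  rad∣d : rad t ∣ d
  rad∣d = rad∣ t λ r pr r∣t → d-greatest (∣-trans r∣t t∣m) (prime∣m⇒∣z r pr (∣-trans r∣t t∣m))

  -- The product of this gcd with `d` divides both m = t d and z, hence `d` itself.
  gcd[t,z/d]≡1 : gcd t z/d ≡ 1
  gcd[t,z/d]≡1 = ∣1⇒≡1 (*-cancelʳ-∣ d (subst (gcd t z/d * d ∣_) (sym (*-identityˡ d)) (d-greatest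
    (subst (gcd t z/d * d ∣_) (sym m≡t*d) (*-monoˡ-∣ d (gcd[m,n]∣m t z/d)))
    (subst (gcd t z/d * d ∣_) (sym z≡z/d*d) (*-monoˡ-∣ d (gcd[m,n]∣n t z/d))))))

  gcd≡1 : gcd t (z div d) ≡ 1
  gcd≡1 = trans (cong (gcd t) (trans (cong (_div d) z≡z/d*d) (div-exact z/d d))) gcd[t,z/d]≡1

  -- Cancelling `d` leaves that `t` divides `z/d` times `k`, and `t` is coprime to `z/d`.
  m∣z*k⇒t∣k : ∀ k → m ∣ z * k → t ∣ k
  m∣z*k⇒t∣k k m∣zk = coprime-divisor (gcd≡1⇒coprime gcd[t,z/d]≡1)
    (*-cancelʳ-∣ d (subst₂ _∣_ m≡t*d (trans (cong (_* k) z≡z/d*d) (lemma z/d d k)) m∣zk))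
    where
    lemma : ∀ x y k → x * y * k ≡ x * k * y
    lemma = solve-∀

  -- Writing N = k g with g ∣ q - 1 ∣ z, one has m ∣ N ∣ k z, and therefore t ∣ k.
  t∣ : t ∣ (2 * (n + 1)) div gcd (2 * (n + 1)) (q ∸ 1)
  t∣ = subst (t ∣_) (sym (trans (cong (_div g) (_∣_.equality g∣N)) (div-exact k g)))
    (m∣z*k⇒t∣k k (∣-trans m∣2[n+1] (subst (N ∣_) (*-comm k z) N∣kz)))
    where
    N = 2 * (n + 1)
    g = gcd N (q ∸ 1)
    g∣N : g ∣ N
    g∣N = gcd[m,n]∣m N (q ∸ 1)
    k = quotient g∣N
    instance
      g≢0 : NonZero g
      g≢0 = ≢-nonZero (gcd[m,n]≢0 N (q ∸ 1) (inj₁ λ N≡0 → contradiction (m+n≡0⇒n≡0 n (m+n≡0⇒m≡0 (n + 1) N≡0)) λ ()))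
    N∣kz : N ∣ k * z
    N∣kz = subst (_∣ k * z) (sym (_∣_.equality g∣N)) (*-monoʳ-∣ k (∣-trans (gcd[m,n]∣n N (q ∸ 1)) q-1∣z))

  N/t : ℕ
  N/t = quotient m∣2[n+1] * d

  N≡t*N/t : 2 * (n + 1) ≡ t * N/t
  N≡t*N/t = trans (_∣_.equality m∣2[n+1]) (trans (cong (quotient m∣2[n+1] *_) m≡t*d) (lemma (quotient m∣2[n+1]) t d))
    where
    lemma : ∀ k t d → k * (t * d) ≡ t * (k * d)
    lemma = solve-∀

  2[n+1]div-t : (2 * (n + 1)) div t ≡ N/t
  2[n+1]div-t = trans (cong (_div t) (trans N≡t*N/t (*-comm t N/t))) (div-exact N/t t)

  -- A prime factor of `t` divides `d`, hence 2. As 4 ∣ z and d ∣ 2, the number `z/d` is even, so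
  -- this prime would divide both `t` and `z/d`.
  d∣2⇒t≡1 : d ∣ 2 → t ≡ 1
  d∣2⇒t≡1 d∣2 with t ≟ 1
  ... | yes t≡1 = t≡1
  ... | no  t≢1 with primeDivisor t t≢1
  ... | r , pr , r∣t = contradiction (subst (r ∣_) gcd[t,z/d]≡1 (gcd-greatest r∣t r∣z/d)) (prime∤1 pr)
    where
    r∣2 : r ∣ 2
    r∣2 = ∣-trans (d-greatest (∣-trans r∣t t∣m) (prime∣m⇒∣z r pr (∣-trans r∣t t∣m))) d∣2
    2∣z/d : 2 ∣ z/d
    2∣z/d = *-cancelʳ-∣ {2} {z/d} 2 (∣-trans 4∣z (subst (_∣ z/d * 2) (sym z≡z/d*d) (*-monoʳ-∣ z/d d∣2)))
    r∣z/d : r ∣ z/d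
    r∣z/d = ∣-trans r∣2 2∣z/d

  [q^2]^k : ∀ k → (q ^ 2) ^ k ≡ 1 + z * geometric (suc z) k
  [q^2]^k k = trans (cong (_^ k) q^2≡1+z) (1+z^n z k)

  m∣[q^2]^k-1⇒t∣k : ∀ k → m ∣ z * geometric (suc z) k → t ∣ k
  m∣[q^2]^k-1⇒t∣k k m∣ = m∣z*k⇒t∣k k (lifting-the-exponent z 4∣z k m prime∣m⇒∣z m∣)

  -- Since `d` divides `z`, it divides Q ^ k - 1 as well as Q ^ k + 1, hence 2.
  m∣[q^2]^k+1⇒t≡1 : ∀ k → m ∣ (q ^ 2) ^ k + 1 → t ≡ 1
  m∣[q^2]^k+1⇒t≡1 k m∣ = d∣2⇒t≡1 (∣m+n∣m⇒∣n (subst (d ∣_) (trans (cong (_+ 1) ([q^2]^k k)) (lemma (z * geometric (suc z) k)))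
      (∣-trans d∣m m∣)) (∣m⇒∣m*n (geometric (suc z) k) d∣z))
    where
    lemma : ∀ x → 1 + x + 1 ≡ x + 2
    lemma = solve-∀

-- Fixed points of a Frobenius power, and elements given with an inverse.

module FixedField {c₁ ℓ₁ c₂ ℓ₂ Q} (S : Field c₁ ℓ₁) (card : HasCardinality S Q) (1<Q : 1 < Q)
  (R : CommutativeRing c₂ ℓ₂) (_≟_ : DecidableEquality R) (1≉0 : Nontrivial R) (integral : NoZeroDivisors R)
  {φ : Field.Carrier S → CommutativeRing.Carrier R}
  (φ-hom : RingMorphisms.IsRingHomomorphism (Field.rawRing S) (CommutativeRing.rawRing R) φ) where
  open CommutativeRing R
  private module S where
    open Field S public
    open FieldProperties S public
    open FieldProperties.Finite S card public
  open CommutativeRingProperties R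
  open IntegralDomain R 1≉0 integral
  open HomomorphismProperties S R φ-hom
  open Injective 1≉0 S._≟_

  -- The `Q` images of elements of `S` are distinct solutions of x ^ Q = x, and a domain has no
  -- more. As equality is decidable, running through them produces the preimage.
  fixed⇒∈image : ∀ {x} → x ^ Q ≈ x → ∃[ s ] φ s ≈ x
  fixed⇒∈image {x} x^Q≈x with Fin.any? (λ i → φ (S.from i) ≟ x)
  ... | yes (i , e) = S.from i , e
  ... | no  none    = contradiction (λ i e → none (i , e)) (helper Q 1<Q S.from S.from-injective (S.fermat card) x^Q≈x)
    where
    helper : ∀ Q → 1 < Q → (s : Fin Q → S.Carrier) → (∀ {i j} → i ≢ j → ¬ (s i S.≈ s j)) →
             (∀ y → y S.^ Q S.≈ y) → x ^ Q ≈ x → ¬ (∀ i → ¬ (φ (s i) ≈ x))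
    helper (suc (suc Q)) (s≤s (s≤s _)) s s≉ fixed =
      fixedPoints Q (φ ∘ s) (λ i≢j e → s≉ i≢j (φ-injective e)) (λ i → φ-fixed {suc (suc Q)} fixed (s i))

module Inverses {c ℓ} (R : CommutativeRing c ℓ) where
  open CommutativeRing R
  open CommutativeRingProperties R
  open IntegerSolver R using (solve; _:=_; _:+_; _:*_; _:-_; :-_; :0; :1)
  open SetoidReasoning setoid

  inverse-^ : ∀ {x x′} n → x * x′ ≈ 1# → x ^ n * x′ ^ n ≈ 1#
  inverse-^ {x} {x′} n xx′≈1 = trans (sym (^-distrib-* x x′ n)) (trans (^-congˡ n xx′≈1) (1^n≈1 n))

  inverse-unique : ∀ {x y z} → x * y ≈ 1# → x * z ≈ 1# → y ≈ z
  inverse-unique {x} {y} {z} xy≈1 xz≈1 = begin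
    y              ≈⟨ *-identityʳ y ⟨
    y * 1#         ≈⟨ *-congˡ xz≈1 ⟨
    y * (x * z)    ≈⟨ solve 3 (λ x y z → y :* (x :* z) := (x :* y) :* z) refl x y z ⟩
    x * y * z      ≈⟨ trans (*-congʳ xy≈1) (*-identityˡ z) ⟩
    z              ∎

  inverse-^≈1 : ∀ {x x′} n → x * x′ ≈ 1# → x′ ^ n * x′ ≈ 1# → x ^ (n ℕ.+ 1) ≈ 1#
  inverse-^≈1 {x} {x′} n xx′≈1 e = begin
    x ^ (n ℕ.+ 1)                ≡⟨ ≡.cong (x ^_) (ℕ.+-comm n 1) ⟩
    x ^ suc n                    ≈⟨ *-identityʳ _ ⟨
    x ^ suc n * 1#               ≈⟨ *-congˡ (trans (*-comm x′ (x′ ^ n)) e) ⟨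
    x ^ suc n * x′ ^ suc n       ≈⟨ inverse-^ (suc n) xx′≈1 ⟩
    1#                           ∎

  unit≉0 : ¬ (1# ≈ 0#) → ∀ {x x′} → x * x′ ≈ 1# → ¬ (x ≈ 0#)
  unit≉0 1≉0 {x′ = x′} xx′≈1 x≈0 = 1≉0 (trans (sym xx′≈1) (trans (*-congʳ x≈0) (zeroˡ x′)))

  module _ (1≉0 : Nontrivial R) (integral : NoZeroDivisors R) where
    -- y + y⁻¹ = x + x⁻¹ means (y - x) (1 - y⁻¹ x⁻¹) = 0.
    sum-with-inverse : ∀ {x x′ y y′} → x * x′ ≈ 1# → y * y′ ≈ 1# → y + y′ ≈ x + x′ → y ≈ x ⊎ y′ * x′ ≈ 1#
    sum-with-inverse {x} {x′} {y} {y′} xx′≈1 yy′≈1 e =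
      Sum.map (x-y≈0⇒x≈y y x) (λ e′ → sym (x-y≈0⇒x≈y 1# (y′ * x′) e′)) (integral (y - x) (1# - y′ * x′) (begin
        (y - x) * (1# - y′ * x′)                         ≈⟨ solve 4 (λ x x′ y y′ → (y :- x) :* (:1 :- y′ :* x′) := y :- x :- (y :* y′) :* x′ :+ (x :* x′) :* y′) refl x x′ y y′ ⟩
        y - x - y * y′ * x′ + x * x′ * y′                ≈⟨ +-cong (+-congˡ (-‿cong (*-congʳ yy′≈1))) (*-congʳ xx′≈1) ⟩
        y - x - 1# * x′ + 1# * y′                        ≈⟨ solve 4 (λ x x′ y y′ → y :- x :- :1 :* x′ :+ :1 :* y′ := (y :+ y′) :- (x :+ x′)) refl x x′ y y′ ⟩
        (y + y′) - (x + x′)                              ≈⟨ x≈y⇒x-y≈0 e ⟩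
        0#                                               ∎))

  -- A Bézout identity for `m` and `n` would yield 1 = 0.
  coprime⇒·1≉0 : ¬ (1# ≈ 0#) → ∀ {m n} → Coprime m n → m · 1# ≈ 0# → ¬ (n · 1# ≈ 0#)
  coprime⇒·1≉0 1≉0 {m} {n} m⊥n m≈0 n≈0 = helper (coprime-Bézout m⊥n)
    where
    multiple≈0 : ∀ x {m} → m · 1# ≈ 0# → (x ℕ.* m) · 1# ≈ 0#
    multiple≈0 x {m} m≈0 = p·1≈0⇒p·x≈0 m 1# m≈0 (n∣m*n x)
    unit : ∀ x {m} → m · 1# ≈ 0# → ∀ y {n} → n · 1# ≈ 0# → ¬ (1 ℕ.+ y ℕ.* n ≡ x ℕ.* m)
    unit x {m} m≈0 y {n} n≈0 e = 1≉0 (begin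
      1#                               ≈⟨ +-identityʳ 1# ⟨
      1# + 0#                          ≈⟨ +-congˡ (multiple≈0 y n≈0) ⟨
      (1 ℕ.+ y ℕ.* n) · 1#             ≡⟨ ≡.cong (_· 1#) e ⟩
      (x ℕ.* m) · 1#                   ≈⟨ multiple≈0 x m≈0 ⟩
      0#                               ∎)
    helper : ¬ Bézout.Identity 1 m n
    helper (Bézout.+- x y e) = unit x m≈0 y n≈0 e
    helper (Bézout.-+ x y e) = unit y n≈0 x m≈0 e

-- The self-reciprocal polynomial whose roots are the possible ζ.

-- transform e f = β ^ e X ^ e f (β⁻¹ (X + X⁻¹)) for f of degree e.
module Transform {c ℓ} (S : Field c ℓ) (β : Field.Carrier S) where
  open Field S hiding (zero)
  open Polynomial S
  open PolynomialProperties S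
  open SetoidReasoning setoid

  X²+1 : Poly
  X²+1 = 1# ∷ 0# ∷ 1# ∷ []

  transform : ℕ → Poly → Poly
  transform zero    f = constant (coeff f 0)
  transform (suc e) f = monomial (β ^ suc e * coeff f 0) (suc e) +ₚ X²+1 *ₚ transform e (drop 1 f)

  coeff-drop : ∀ f i → coeff (drop 1 f) i ≈ coeff f (suc i)
  coeff-drop []      i = refl
  coeff-drop (x ∷ f) i = refl

  monic-X²+1 : MonicOfDegree 2 X²+1
  monic-X²+1 = refl , λ { (suc (suc (suc i))) _ → refl ; (suc zero) (s≤s ()) ; (suc (suc zero)) (s≤s (s≤s ())) }

  -- Each step multiplies by the monic X² + 1, and the added monomial, of degree e + 1, stays below
  -- the new degree 2 e + 2.
  transform-monic : ∀ e f → coeff f e ≈ 1# → MonicOfDegree (e ℕ.+ e) (transform e f)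
  transform-monic zero    f f₀≈1 = f₀≈1 , λ { (suc i) _ → refl }
  transform-monic (suc e) f lead = ≡.subst (λ n → MonicOfDegree n (transform (suc e) f)) (≡.cong suc (≡.sym (ℕ.+-suc e e)))
    (monic-resp {suc (suc (e ℕ.+ e))} (P.+-comm (X²+1 *ₚ T) lower)
      (monic-+ (X²+1 *ₚ T) lower
        (monic-* X²+1 T monic-X²+1 (transform-monic e (drop 1 f) (trans (coeff-drop f e) lead)))
        (below-weaken lower (s≤s (s≤s (ℕ.m≤m+n e e))) (DicksonDegree.below-monomial S _ (suc e)))))
    where
    T = transform e (drop 1 f)
    lower = monomial (β ^ suc e * coeff f 0) (suc e)

  -- X² + 1 has constant term 1 and the added monomials have positive degree. A constant coefficient
  -- 1 makes every root invertible.
  transform-coeff₀ : ∀ e f → coeff f e ≈ 1# → coeff (transform e f) 0 ≈ 1#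
  transform-coeff₀ zero    f f₀≈1 = f₀≈1
  transform-coeff₀ (suc e) f lead = begin
    coeff (transform (suc e) f) 0      ≈⟨ coeff-+ (monomial (β ^ suc e * coeff f 0) (suc e)) (X²+1 *ₚ T) 0 ⟩
    0# + coeff (X²+1 *ₚ T) 0           ≈⟨ trans (+-identityˡ _) (coeff-∷* 1# (0# ∷ 1# ∷ []) T 0) ⟩
    1# * coeff T 0 + 0#                ≈⟨ trans (+-identityʳ _) (*-identityˡ _) ⟩
    coeff T 0                          ≈⟨ transform-coeff₀ e (drop 1 f) (trans (coeff-drop f e) lead) ⟩
    1#                                 ∎
    where T = transform e (drop 1 f)

  module _ {c₂ ℓ₂} (R : CommutativeRing c₂ ℓ₂) {φ : Carrier → CommutativeRing.Carrier R}
    (φ-hom : RingMorphisms.IsRingHomomorphism rawRing (CommutativeRing.rawRing R) φ) where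
    private module R where
      open CommutativeRing R public
      open CommutativeRingProperties R public
    open HomomorphismProperties S R φ-hom
    open Evaluation S R φ-hom
    open IntegerSolver R using (solve; _:=_; _:+_; _:*_; _:-_; :-_; :0; :1)

    evaluate-head : ∀ f x → evaluate f x R.≈ φ (coeff f 0) R.+ x R.* evaluate (drop 1 f) x
    evaluate-head []      x = R.sym (R.trans (R.+-cong φ-0 (R.zeroʳ x)) (R.+-identityˡ R.0#))
    evaluate-head (a ∷ f) x = R.refl

    -- Horner's scheme: X² + 1 takes at `y` the value β y x. The hypothesis is x = β⁻¹ (y + y⁻¹)
    -- with denominators cleared.
    evaluate-transform : ∀ {x y} → φ β R.* y R.* x R.≈ R.1# R.+ y R.* y → ∀ e f → DegreeBelow (suc e) f →
                         evaluate (transform e f) y R.≈ (φ β R.* y) R.^ e R.* evaluate f x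
    evaluate-transform {x} {y} βyx zero f f< = Rs.begin
      φ (coeff f 0) R.+ y R.* R.0#                         Rs.≈⟨ solve 3 (λ c x y → c :+ y :* :0 := :1 :* (c :+ x :* :0)) R.refl _ x y ⟩
      R.1# R.* (φ (coeff f 0) R.+ x R.* R.0#)              Rs.≈⟨ R.*-congˡ (R.+-congˡ (R.*-congˡ (evaluate-≈0 {drop 1 f} x rest≈0))) ⟨
      R.1# R.* (φ (coeff f 0) R.+ x R.* evaluate (drop 1 f) x)  Rs.≈⟨ R.*-congˡ (evaluate-head f x) ⟨
      R.1# R.* evaluate f x                                Rs.∎
      where
      module Rs = SetoidReasoning R.setoid
      rest≈0 : drop 1 f ≈ₚ []
      rest≈0 .coeff-≈ i = trans (coeff-drop f i) (f< (suc i) (s≤s z≤n))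
    evaluate-transform {x} {y} βyx (suc e) f f< = Rs.begin
      evaluate (transform (suc e) f) y
        Rs.≈⟨ R.trans (evaluate-+ (monomial (β ^ suc e * coeff f 0) (suc e)) (X²+1 *ₚ T) y) (R.+-cong (evaluate-monomial (β ^ suc e * coeff f 0) (suc e) y) (evaluate-* X²+1 T y)) ⟩
      φ (β ^ suc e * coeff f 0) R.* y R.^ suc e R.+ evaluate X²+1 y R.* evaluate T y
        Rs.≈⟨ R.+-cong (R.*-congʳ (R.trans (φ-* _ _) (R.*-congʳ (φ-^ β (suc e)))))
             (R.*-cong (R.+-cong φ-1 (R.*-congˡ (R.+-cong φ-0 (R.*-congˡ (R.+-congʳ φ-1))))) (evaluate-transform βyx e (drop 1 f) tail<)) ⟩
      φ β R.^ suc e R.* f₀ R.* y R.^ suc e R.+ (R.1# R.+ y R.* (R.0# R.+ y R.* (R.1# R.+ y R.* R.0#))) R.* ((φ β R.* y) R.^ e R.* E)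
        Rs.≈⟨ R.+-cong (R.trans (solve 3 (λ b c y → b :* c :* y := b :* y :* c) R.refl _ f₀ _) (R.*-congʳ (R.sym (R.^-distrib-* (φ β) y (suc e)))))
             (solve 3 (λ y p E → (:1 :+ y :* (:0 :+ y :* (:1 :+ y :* :0))) :* (p :* E) := (:1 :+ y :* y) :* (p :* E)) R.refl y _ E) ⟩
      (φ β R.* y) R.^ suc e R.* f₀ R.+ (R.1# R.+ y R.* y) R.* ((φ β R.* y) R.^ e R.* E)
        Rs.≈⟨ R.+-congˡ (R.*-congʳ βyx) ⟨
      (φ β R.* y) R.^ suc e R.* f₀ R.+ φ β R.* y R.* x R.* ((φ β R.* y) R.^ e R.* E)
        Rs.≈⟨ solve 5 (λ w p c x E → w :* p :* c :+ w :* x :* (p :* E) := w :* p :* (c :+ x :* E)) R.refl (φ β R.* y) ((φ β R.* y) R.^ e) f₀ x E ⟩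
      (φ β R.* y) R.^ suc e R.* (f₀ R.+ x R.* E)
        Rs.≈⟨ R.*-congˡ (evaluate-head f x) ⟨
      (φ β R.* y) R.^ suc e R.* evaluate f x Rs.∎
      where
      module Rs = SetoidReasoning R.setoid
      T = transform e (drop 1 f)
      f₀ = φ (coeff f 0)
      E = evaluate (drop 1 f) x
      tail< : DegreeBelow (suc e) (drop 1 f)
      tail< i e<i = trans (coeff-drop f i) (f< (suc i) (s≤s e<i))

-- From an irreducible factor of E_n to α and t.

record Hypotheses {c₁ ℓ₁ c₂ ℓ₂} (F : Field c₁ ℓ₁) (K : Field c₂ ℓ₂) (ι : Field.Carrier F → Field.Carrier K) :
                  Set (c₁ ⊔ ℓ₁ ⊔ c₂ ⊔ ℓ₂) where
  private module F = Field F
  field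
    q          : ℕ
    cardF      : HasCardinality F q
    cardK      : HasCardinality K (q ℕ.^ 2)
    ι-hom      : IsFieldEmbedding F K ι
    primePower : IsPrimePower q
    q%4≡3      : q % 4 ≡ 3
    a b        : F.Carrier
    b≉0        : ¬ (b F.≈ F.0#)
    b²≈a       : b F.^ 2 F.≈ a
    n          : ℕ
    n%2≡1      : n % 2 ≡ 1
    rad∣q-1    : rad (n ℕ.+ 1) ∣ q ∸ 1

module Setting {c₁ ℓ₁ c₂ ℓ₂} {F : Field c₁ ℓ₁} {K : Field c₂ ℓ₂} {ι : Field.Carrier F → Field.Carrier K}
  (hypotheses : Hypotheses F K ι) where
  open Hypotheses hypotheses

  private
    module F where
      open Field F hiding (_^_) public
      open CommutativeRingProperties commutativeRing public
      open FieldProperties F public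
      open FieldProperties.Finite F cardF public
    module K where
      open Field K hiding (_^_) public
      open CommutativeRingProperties commutativeRing public
      open FieldProperties K public
      open FieldProperties.Finite K cardK public
      open Inverses commutativeRing public
    module F[x] where
      open Polynomial F public
      open PolynomialProperties F public
    module K[x] where
      open Polynomial K public
      open PolynomialProperties K public

  p k : ℕ
  p = proj₁ primePower
  k = proj₁ (proj₂ primePower)

  p-prime : Prime p
  p-prime = proj₁ (proj₂ (proj₂ primePower))

  q≡p^k : q ≡ p ℕ.^ k
  q≡p^k = proj₂ (proj₂ (proj₂ (proj₂ primePower)))

  p∣q : p ∣ q
  p∣q = ≡.subst (p ∣_) (≡.sym q≡p^k) (p∣p^k k (proj₁ (proj₂ (proj₂ (proj₂ primePower)))))
    where
    p∣p^k : ∀ k → 0 < k → p ∣ p ℕ.^ k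
    p∣p^k (suc k) _ = m∣m*n (p ℕ.^ k)

  1<q : 1 < q
  -- The divisor `m` is set to 1, as only q = 3 + 4 w is read off.
  1<q = ≡.subst (1 <_) (≡.sym (ExponentArithmetic.q≡3+4w q n 1 q%4≡3 n%2≡1 rad∣q-1 (1∣ _))) (s≤s (s≤s z≤n))

  instance
    q≢0 : NonZero q
    q≢0 = >-nonZero (ℕ.<-trans (s≤s z≤n) 1<q)

    q^2≢0 : NonZero (q ℕ.^ 2)
    q^2≢0 = ℕ.m^n≢0 q 2

  1<q^2 : 1 < q ℕ.^ 2
  1<q^2 = ℕ.<-≤-trans 1<q (≡.subst (_≤ q ℕ.^ 2) (ℕ.^-identityʳ q) (ℕ.^-monoʳ-≤ q (s≤s {0} {1} z≤n)))

  p·1≈0 : p F.· F.1# F.≈ F.0#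
  p·1≈0 = F.p^k·1≈0⇒p·1≈0 cardF k (F.trans (F.×-congˡ (≡.sym q≡p^k)) F.Q·1≈0)

  -- A common prime factor would divide `q` and, by the condition on the radical, also q - 1.
  p-coprime-n+1 : Coprime p (n ℕ.+ 1)
  p-coprime-n+1 = Arithmetic.noCommonPrime⇒coprime λ r pr r∣p r∣n+1 →
    Arithmetic.prime∤1 pr (∣m+n∣m⇒∣n
      (≡.subst (r ∣_) (≡.sym (ℕ.m∸n+n≡m (ℕ.<⇒≤ 1<q))) (∣-trans r∣p p∣q))
      (ExponentArithmetic.prime∣n+1⇒∣q-1 q n 1 q%4≡3 n%2≡1 rad∣q-1 (1∣ _) r pr r∣n+1))

  additive : ∀ {c ℓ} (R : CommutativeRing c ℓ) → CommutativeRingProperties.Annihilates R p →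
             CommutativeRingProperties.Additive R q
  additive R p·1≈0 = ≡.subst Additive (≡.sym q≡p^k) (additive-^ k (frobenius p-prime p·1≈0))
    where open CommutativeRingProperties R

  module ι = HomomorphismProperties F K.commutativeRing ι-hom
  module Map = MapPolynomial F K ι-hom

  Conclusion : F[x].Poly → Set (c₂ ⊔ ℓ₂ ⊔ c₁)
  Conclusion f = Σ[ α ∈ K.Carrier ] Σ[ α≉0 ∈ ¬ (α K.≈ K.0#) ] ∃[ t ] ∃[ d ]
    let α⁻¹ = K.inv α α≉0
        g   = K[x].dicksonD t (ι a) K[x].-ₚ K[x].constant (ι b K.^ t K.* (α K.+ α⁻¹))
        g′  = K[x].dicksonD t (ι a) K[x].-ₚ K[x].constant (ι b K.^ t K.* (α K.^ q K.+ α⁻¹ K.^ q))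
        caseA = (∃[ x ] ι x K.≈ α) ⊎ (α K.^ (q ℕ.+ 1) K.≈ K.1#)
    in
    0 < t ×
    t ∣ (2 ℕ.* (n ℕ.+ 1)) div gcd (2 ℕ.* (n ℕ.+ 1)) (q ∸ 1) ×
    Field.IsMultiplicativeOrder K α d ×
    α K.^ ((2 ℕ.* (n ℕ.+ 1)) div t) K.≈ K.1# ×
    rad t ∣ d ×
    gcd t ((q ℕ.^ 2 ∸ 1) div d) ≡ 1 ×
    ¬ (α K.≈ K.1# × t ≡ 1) ×
    ¬ (α K.≈ K.- K.1# × t ≡ 1) ×
    (caseA → map ι f K[x].≈ₚ g) ×
    (¬ caseA → map ι f K[x].≈ₚ g K[x].*ₚ g′)

  record InvertibleElement : Set (lsuc (c₂ ⊔ ℓ₂)) where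
    field
      extension : DomainExtension K
    open DomainExtension extension public renaming (domain to L; embed to j; isHomomorphism to j-hom)
    open CommutativeRing L using (Carrier; _≈_; _*_; 1#)
    field
      ζ ζ′  : Carrier
      ζζ′≈1 : ζ * ζ′ ≈ 1#

  module WithElement (element : InvertibleElement) where
    open InvertibleElement element
    open CommutativeRing L
    open CommutativeRingProperties L
    open IntegralDomain L 1≉0 integral
    open Inverses L
    open IntegerSolver L using (solve; _:=_; _:+_; _:*_; _:-_; :-_; :0; :1)
    open SetoidReasoning setoid

    φ : F.Carrier → Carrier
    φ = j ∘ ι

    φ-hom : RingMorphisms.IsRingHomomorphism F.rawRing rawRing φ
    φ-hom = Composition.isRingHomomorphism trans ι-hom j-hom

    module j = HomomorphismProperties K L j-hom
    module jInjective = j.Injective 1≉0 K._≟_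
    module φ = HomomorphismProperties F L φ-hom
    module Eval = Evaluation F L φ-hom
    module Evalⱼ = Evaluation K L j-hom

    Q : ℕ
    Q = q ℕ.^ 2

    B : Carrier
    B = φ b

    B≉0 : ¬ (B ≈ 0#)
    B≉0 = φ.φ-≉0 1≉0 b≉0

    u v x₀ : Carrier
    u  = B * ζ
    v  = B * ζ′
    x₀ = u + v

    a≈uv : φ a ≈ u * v
    a≈uv = begin
      φ a                      ≈⟨ φ.φ-cong b²≈a ⟨
      φ (b F.^ 2)              ≈⟨ φ.φ-^ b 2 ⟩
      B * (B * 1#)             ≈⟨ solve 1 (λ b → b :* (b :* :1) := (b :* b) :* :1) refl B ⟩
      B * B * 1#               ≈⟨ *-congˡ ζζ′≈1 ⟨
      B * B * (ζ * ζ′)         ≈⟨ solve 3 (λ b z z′ → b :* b :* (z :* z′) := (b :* z) :* (b :* z′)) refl B ζ ζ′ ⟩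
      u * v                    ∎

    module Dickson = DicksonIdentities L

    p·1≈0ₗ : p · 1# ≈ 0#
    p·1≈0ₗ = trans (×-congʳ p (sym φ.φ-1)) (trans (sym (φ.φ-· p F.1#)) (trans (φ.φ-cong p·1≈0) φ.φ-0))

    p·1≈0ₖ : p K.· K.1# K.≈ K.0#
    p·1≈0ₖ = K.trans (K.×-congʳ p (K.sym ι.φ-1)) (K.trans (K.sym (ι.φ-· p F.1#)) (K.trans (ι.φ-cong p·1≈0) ι.φ-0))

    additive-q : Additive q
    additive-q = additive L p·1≈0ₗ

    additive-Q : Additive Q
    additive-Q = additive-^ {q} 2 additive-q

    φ-fixed-q : ∀ x → φ x ^ q ≈ φ x
    φ-fixed-q = φ.φ-fixed {q} (F.fermat cardF)

    φ-fixed-Q : ∀ x → φ x ^ Q ≈ φ x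
    φ-fixed-Q x = fixed⇒fixed-^ q 2 (φ-fixed-q x)

    ζ≉0 : ¬ (ζ ≈ 0#)
    ζ≉0 = unit≉0 1≉0 ζζ′≈1

    module _ (f : F[x].Poly) (f∣E : f F[x].∣ₚ F[x].dicksonE n a) (fx₀≈0 : Eval.evaluate f x₀ ≈ 0#) where

      powerSum≈0 : Dickson.powerSum x₀ (φ a) u v refl a≈uv n ≈ 0#
      powerSum≈0 = begin
        Dickson.powerSum x₀ (φ a) u v refl a≈uv n    ≈⟨ Dickson.dicksonE≈powerSum x₀ (φ a) u v refl a≈uv n ⟨
        Dickson.dicksonE x₀ (φ a) n                  ≈⟨ Eval.evaluate-dicksonE a x₀ n ⟨
        Eval.evaluate (F[x].dicksonE n a) x₀         ≈⟨ Eval.evaluate-∣ f∣E fx₀≈0 ⟩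
        0#                                           ∎

      -- At a zero of E_n one has u ^ (n + 1) = v ^ (n + 1); cancelling B ^ (n + 1) shows that ζ ^
      -- (n + 1) is its own inverse.
      ζ^2[n+1]≈1 : ζ ^ (2 ℕ.* (n ℕ.+ 1)) ≈ 1#
      ζ^2[n+1]≈1 = begin
        ζ ^ (2 ℕ.* (n ℕ.+ 1))            ≡⟨ ≡.cong (ζ ^_) (≡.trans (≡.cong (2 ℕ.*_) (ℕ.+-comm n 1)) (≡.cong (suc n ℕ.+_) (ℕ.+-identityʳ (suc n)))) ⟩
        ζ ^ (suc n ℕ.+ suc n)            ≈⟨ ^-homo-* ζ (suc n) (suc n) ⟩
        ζ ^ suc n * ζ ^ suc n            ≈⟨ *-congˡ ζ^≈ζ′^ ⟩
        ζ ^ suc n * ζ′ ^ suc n           ≈⟨ inverse-^ (suc n) ζζ′≈1 ⟩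
        1#                               ∎
        where
        u^≈v^ : u ^ suc n ≈ v ^ suc n
        u^≈v^ = x-y≈0⇒x≈y _ _ (trans (sym (Dickson.powerSum-difference x₀ (φ a) u v refl a≈uv n))
          (trans (*-congˡ powerSum≈0) (zeroʳ _)))
        ζ^≈ζ′^ : ζ ^ suc n ≈ ζ′ ^ suc n
        ζ^≈ζ′^ = *-cancelˡ {B ^ suc n} (λ e → B≉0 (x^n≈0⇒x≈0 (suc n) e))
          (trans (sym (^-distrib-* B ζ (suc n))) (trans u^≈v^ (^-distrib-* B ζ′ (suc n))))

      -- At ζ = ±1 the value of E_n is ±(n + 1) b ^ n, which is nonzero since p ∤ n + 1.
      ζζ≉1 : ¬ (ζ * ζ ≈ 1#)
      ζζ≉1 ζζ≈1 = coprime⇒·1≉0 1≉0 p-coprime-n+1 p·1≈0ₗ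
        (trans (×-congˡ (ℕ.+-comm n 1)) (Sum.[ (λ e → e) , (λ e → contradiction (x^n≈0⇒x≈0 n e) u≉0) ]′
          (integral (suc n · 1#) (u ^ n) (trans (sym (Dickson.powerSum-diagonal x₀ (φ a) u v refl a≈uv u≈v n)) powerSum≈0))))
        where
        u≈v : u ≈ v
        u≈v = *-congˡ (inverse-unique ζζ≈1 ζζ′≈1)
        u≉0 : ¬ (u ≈ 0#)
        u≉0 e = Sum.[ B≉0 , ζ≉0 ]′ (integral B ζ e)

      module WithOrder (m : ℕ) (m∣2[n+1] : m ∣ 2 ℕ.* (n ℕ.+ 1)) (ζ^m≈1 : ζ ^ m ≈ 1#)
        (ζ^i≈1⇒m∣i : ∀ i → ζ ^ i ≈ 1# → m ∣ i) where

        open ExponentArithmetic q n m q%4≡3 n%2≡1 rad∣q-1 m∣2[n+1]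

        -- The `M`-th power is additive and fixes `B`, so ζ ^ M + ζ ^ -M = ζ + ζ⁻¹ and ζ ^ M is ζ or
        -- ζ⁻¹. The first alternative means m ∣ Q ^ i - 1, the second m ∣ Q ^ i + 1 and thus t = 1.
        x₀-fixed⇒t∣i : ∀ i → x₀ ^ (Q ℕ.^ i) ≈ x₀ → t ∣ i
        x₀-fixed⇒t∣i i e = Sum.[ case₁ , case₂ ]′ (sum-with-inverse 1≉0 integral ζζ′≈1 (inverse-^ M ζζ′≈1) sum≈)
          where
          M = Q ℕ.^ i
          B-fixed : B ^ M ≈ B
          B-fixed = fixed⇒fixed-^ Q i (φ-fixed-Q b)
          sum≈ : ζ ^ M + ζ′ ^ M ≈ ζ + ζ′
          sum≈ = *-cancelˡ B≉0 (begin
            B * (ζ ^ M + ζ′ ^ M)               ≈⟨ distribˡ B _ _ ⟩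
            B * ζ ^ M + B * ζ′ ^ M             ≈⟨ +-cong (*-congʳ B-fixed) (*-congʳ B-fixed) ⟨
            B ^ M * ζ ^ M + B ^ M * ζ′ ^ M     ≈⟨ +-cong (^-distrib-* B ζ M) (^-distrib-* B ζ′ M) ⟨
            u ^ M + v ^ M                      ≈⟨ additive-^ i additive-Q u v ⟨
            x₀ ^ M                             ≈⟨ e ⟩
            u + v                              ≈⟨ distribˡ B ζ ζ′ ⟨
            B * (ζ + ζ′)                       ∎)
          case₁ : ζ ^ M ≈ ζ → t ∣ i
          case₁ e = m∣[q^2]^k-1⇒t∣k i (ζ^i≈1⇒m∣i _ (*-cancelˡ ζ≉0 (begin
            ζ ^ suc (z ℕ.* Arithmetic.geometric (suc z) i)    ≡⟨ ≡.cong (ζ ^_) ([q^2]^k i) ⟨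
            ζ ^ M                                             ≈⟨ e ⟩
            ζ                                                 ≈⟨ *-identityʳ ζ ⟨
            ζ * 1#                                            ∎)))
          case₂ : ζ′ ^ M * ζ′ ≈ 1# → t ∣ i
          case₂ e = ≡.subst (_∣ i) (≡.sym (m∣[q^2]^k+1⇒t≡1 i (ζ^i≈1⇒m∣i (M ℕ.+ 1) (inverse-^≈1 M ζζ′≈1 e)))) (1∣ i)

        module Image = FixedField K cardK 1<q^2 L _≟_ 1≉0 integral j-hom

        -- The exponent t z = m (z / d) is a multiple of `m`, so ζ ^ t solves x ^ Q = x.
        ζ^t∈K : ∃[ α ] j α ≈ ζ ^ t
        ζ^t∈K = Image.fixed⇒∈image (begin
          (ζ ^ t) ^ Q                        ≡⟨ ≡.cong ((ζ ^ t) ^_) q^2≡1+z ⟩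
          ζ ^ t * (ζ ^ t) ^ z                ≈⟨ *-congˡ (^-assocʳ ζ t z) ⟩
          ζ ^ t * ζ ^ (t ℕ.* z)              ≈⟨ *-congˡ (trans (reflexive (≡.cong (ζ ^_) tz≡)) (trans (sym (^-assocʳ ζ m z/d)) (trans (^-congˡ z/d ζ^m≈1) (1^n≈1 z/d)))) ⟩
          ζ ^ t * 1#                         ≈⟨ *-identityʳ _ ⟩
          ζ ^ t                              ∎)
          where
          tz≡ : t ℕ.* z ≡ m ℕ.* z/d
          tz≡ = ≡.trans (≡.cong (t ℕ.*_) (≡.trans z≡z/d*d (ℕ.*-comm z/d d)))
            (≡.trans (≡.sym (ℕ.*-assoc t d z/d)) (≡.cong (ℕ._* z/d) (≡.sym m≡t*d)))

        α : K.Carrier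
        α = proj₁ ζ^t∈K

        jα≈ζ^t : j α ≈ ζ ^ t
        jα≈ζ^t = proj₂ ζ^t∈K

        α≉0 : ¬ (α K.≈ K.0#)
        α≉0 α≈0 = unit≉0 1≉0 (inverse-^ t ζζ′≈1) (trans (sym jα≈ζ^t) (trans (j.φ-cong α≈0) j.φ-0))

        α⁻¹ : K.Carrier
        α⁻¹ = K.inv α α≉0

        αα⁻¹≈1 : α K.* α⁻¹ K.≈ K.1#
        αα⁻¹≈1 = proj₂ (K.invertible α α≉0)

        jα⁻¹≈ζ′^t : j α⁻¹ ≈ ζ′ ^ t
        jα⁻¹≈ζ′^t = inverse-unique {ζ ^ t} (trans (*-congʳ (sym jα≈ζ^t)) (trans (sym (j.φ-* α α⁻¹)) (trans (j.φ-cong αα⁻¹≈1) j.φ-1)))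
          (inverse-^ t ζζ′≈1)

        jα^i≈ζ^[t*i] : ∀ i → j (α K.^ i) ≈ ζ ^ (t ℕ.* i)
        jα^i≈ζ^[t*i] i = trans (j.φ-^ α i) (trans (^-congˡ i jα≈ζ^t) (^-assocʳ ζ t i))

        -- α ^ i is ζ ^ (t i), which is 1 only if m = t d divides t i.
        α-order : Field.IsMultiplicativeOrder K α d
        α-order = record
          { positive = ℕ.>-nonZero⁻¹ d
          ; power≈1  = jInjective.φ-injective (trans (jα^i≈ζ^[t*i] d) (trans (reflexive (≡.cong (ζ ^_) (≡.sym m≡t*d))) (trans ζ^m≈1 (sym j.φ-1))))
          ; minimal  = λ i 0<i α^i≈1 → ∣⇒≤ {{>-nonZero 0<i}} (*-cancelˡ-∣ t (≡.subst (_∣ t ℕ.* i) m≡t*d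
              (ζ^i≈1⇒m∣i (t ℕ.* i) (trans (sym (jα^i≈ζ^[t*i] i)) (trans (j.φ-cong α^i≈1) j.φ-1)))))
          }

        α^[N/t]≈1 : α K.^ ((2 ℕ.* (n ℕ.+ 1)) div t) K.≈ K.1#
        α^[N/t]≈1 = jInjective.φ-injective (begin
          j (α K.^ ((2 ℕ.* (n ℕ.+ 1)) div t))      ≡⟨ ≡.cong (λ i → j (α K.^ i)) 2[n+1]div-t ⟩
          j (α K.^ N/t)                            ≈⟨ jα^i≈ζ^[t*i] N/t ⟩
          ζ ^ (t ℕ.* N/t)                          ≡⟨ ≡.cong (ζ ^_) (≡.sym N≡t*N/t) ⟩
          ζ ^ (2 ℕ.* (n ℕ.+ 1))                    ≈⟨ ζ^2[n+1]≈1 ⟩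
          1#                                       ≈⟨ j.φ-1 ⟨
          j K.1#                                   ∎)

        -- For t = 1 the element α is ζ itself, whose square is not 1.
        ¬[α≈1×t≡1] : ¬ (α K.≈ K.1# × t ≡ 1)
        ¬[α≈1×t≡1] (α≈1 , t≡1) = ζζ≉1 (trans (*-cong ζ≈1 ζ≈1) (*-identityˡ 1#))
          where
          ζ≈1 : ζ ≈ 1#
          ζ≈1 = begin
            ζ        ≈⟨ *-identityʳ ζ ⟨
            ζ ^ 1    ≡⟨ ≡.cong (ζ ^_) t≡1 ⟨
            ζ ^ t    ≈⟨ jα≈ζ^t ⟨
            j α      ≈⟨ trans (j.φ-cong α≈1) j.φ-1 ⟩
            1#       ∎

        ¬[α≈-1×t≡1] : ¬ (α K.≈ K.- K.1# × t ≡ 1)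
        ¬[α≈-1×t≡1] (α≈-1 , t≡1) = ζζ≉1 (trans (*-cong ζ≈-1 ζ≈-1) (solve 0 (:- :1 :* :- :1 := :1) refl))
          where
          ζ≈-1 : ζ ≈ - 1#
          ζ≈-1 = begin
            ζ        ≈⟨ *-identityʳ ζ ⟨
            ζ ^ 1    ≡⟨ ≡.cong (ζ ^_) t≡1 ⟨
            ζ ^ t    ≈⟨ jα≈ζ^t ⟨
            j α      ≈⟨ trans (j.φ-cong α≈-1) (trans (j.φ-neg K.1#) (-‿cong j.φ-1)) ⟩
            - 1#     ∎

        c c′ : K.Carrier
        c  = ι b K.^ t K.* (α K.+ α⁻¹)
        c′ = ι b K.^ t K.* (α K.^ q K.+ α⁻¹ K.^ q)

        D g g′ : K[x].Poly
        D  = K[x].dicksonD t (ι a)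
        g  = D K[x].-ₚ K[x].constant c
        g′ = D K[x].-ₚ K[x].constant c′

        dicksonD≈ : ∀ t .{{_ : NonZero t}} → Dickson.dicksonD x₀ (φ a) t ≈ u ^ t + v ^ t
        dicksonD≈ (suc t) = Dickson.dicksonD≈power+power x₀ (φ a) u v refl a≈uv t

        D[x₀]≈jc : Evalⱼ.evaluate D x₀ ≈ j c
        D[x₀]≈jc = begin
          Evalⱼ.evaluate D x₀                    ≈⟨ Evalⱼ.evaluate-dicksonD (ι a) x₀ t ⟩
          Dickson.dicksonD x₀ (φ a) t            ≈⟨ dicksonD≈ t ⟩
          u ^ t + v ^ t                          ≈⟨ +-cong (^-distrib-* B ζ t) (^-distrib-* B ζ′ t) ⟩
          B ^ t * ζ ^ t + B ^ t * ζ′ ^ t         ≈⟨ distribˡ _ _ _ ⟨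
          B ^ t * (ζ ^ t + ζ′ ^ t)               ≈⟨ *-cong (j.φ-^ (ι b) t) (trans (j.φ-+ α α⁻¹) (+-cong jα≈ζ^t jα⁻¹≈ζ′^t)) ⟨
          j (ι b K.^ t) * j (α K.+ α⁻¹)          ≈⟨ j.φ-* _ _ ⟨
          j c                                    ∎

        g-root : Evalⱼ.evaluate g x₀ ≈ 0#
        g-root = trans (Evalⱼ.evaluate-- D (K[x].constant c) x₀)
          (x≈y⇒x-y≈0 (trans D[x₀]≈jc (sym (Evalⱼ.evaluate-constant c x₀))))

        D-monic : K[x].MonicOfDegree t D
        D-monic = DicksonDegree.dicksonD-monic K t (ι a) (ℕ.>-nonZero⁻¹ t)

        D-constant-monic : ∀ x → K[x].MonicOfDegree t (D K[x].-ₚ K[x].constant x)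
        D-constant-monic x = K[x].monic-+ D (K[x].-ₚ K[x].constant x) D-monic
          (K[x].below-neg (K[x].constant x) λ { zero t≤0 → contradiction (ℕ.>-nonZero⁻¹ t) (ℕ.≤⇒≯ t≤0) ; (suc i) _ → K.refl })

        ιb-fixed : (ι b K.^ t) K.^ q K.≈ ι b K.^ t
        ιb-fixed = K.trans (K.^-comm (ι b) t q) (K.^-congˡ t (ι.φ-fixed {q} (F.fermat cardF) b))

        additiveₖ : K.Additive q
        additiveₖ = additive K.commutativeRing p·1≈0ₖ

        c^q≈c′ : c K.^ q K.≈ c′
        c^q≈c′ = K.trans (K.^-distrib-* (ι b K.^ t) _ q) (K.*-cong ιb-fixed (additiveₖ α α⁻¹))

        c′^q≈c : c′ K.^ q K.≈ c
        c′^q≈c = K.trans (K.^-congˡ q (K.sym c^q≈c′)) (K.trans (K.^-assocʳ c q q)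
          (K.trans (K.reflexive (≡.cong (c K.^_) (≡.cong (q ℕ.*_) (≡.sym (ℕ.*-identityʳ q))))) (K.fermat cardK c)))

        module ιImage = FixedField F cardF 1<q K.commutativeRing K._≟_ K.1≉0 K.integral ι-hom

        CaseA : Set _
        CaseA = (∃[ x ] ι x K.≈ α) ⊎ (α K.^ (q ℕ.+ 1) K.≈ K.1#)

        -- The q-th power fixes α and α⁻¹ if α comes from `F`, and exchanges them if α ^ (q + 1) =
        -- 1; their sum is fixed in both cases.
        caseA⇒c^q≈c : CaseA → c K.^ q K.≈ c
        caseA⇒c^q≈c case = K.trans c^q≈c′ (K.*-congˡ (sum≈ case))
          where
          αα⁻¹^q≈1 : α K.^ q K.* α⁻¹ K.^ q K.≈ K.1#
          αα⁻¹^q≈1 = K.inverse-^ q αα⁻¹≈1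
          sum≈ : CaseA → α K.^ q K.+ α⁻¹ K.^ q K.≈ α K.+ α⁻¹
          sum≈ (inj₁ (x , ιx≈α)) = K.+-cong α^q≈α (K.inverse-unique (K.trans (K.*-congʳ (K.sym α^q≈α)) αα⁻¹^q≈1) αα⁻¹≈1)
            where
            α^q≈α : α K.^ q K.≈ α
            α^q≈α = K.trans (K.^-congˡ q (K.sym ιx≈α)) (K.trans (ι.φ-fixed {q} (F.fermat cardF) x) ιx≈α)
          sum≈ (inj₂ α^[q+1]≈1) = K.trans (K.+-cong α^q≈α⁻¹ α⁻¹^q≈α) (K.+-comm α⁻¹ α)
            where
            α^q≈α⁻¹ : α K.^ q K.≈ α⁻¹
            α^q≈α⁻¹ = K.inverse-unique (K.trans (K.reflexive (≡.cong (α K.^_) (ℕ.+-comm 1 q))) α^[q+1]≈1) αα⁻¹≈1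
            α⁻¹^q≈α : α⁻¹ K.^ q K.≈ α
            α⁻¹^q≈α = K.inverse-unique (K.trans (K.*-congʳ (K.sym α^q≈α⁻¹)) αα⁻¹^q≈1) (K.trans (K.*-comm α⁻¹ α) αα⁻¹≈1)

        -- Cancelling b ^ t leaves α ^ q + α ^ -q = α + α⁻¹, so α ^ q is α or α⁻¹. Outside case (a)
        -- this shows that `c` does not lie in 𝔽_q.
        c^q≈c⇒caseA : c K.^ q K.≈ c → CaseA
        c^q≈c⇒caseA c^q≈c = Sum.map ιImage.fixed⇒∈image (K.inverse-^≈1 q αα⁻¹≈1) cases
          where
          module Kᵢ = IntegralDomain K.commutativeRing K.1≉0 K.integral
          ιb^t≉0 : ¬ (ι b K.^ t K.≈ K.0#)
          ιb^t≉0 e = ι.φ-≉0 K.1≉0 b≉0 (Kᵢ.x^n≈0⇒x≈0 t e)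
          sum≈ : α K.^ q K.+ α⁻¹ K.^ q K.≈ α K.+ α⁻¹
          sum≈ = Kᵢ.*-cancelˡ ιb^t≉0 (K.trans (K.sym c^q≈c′) c^q≈c)
          cases : α K.^ q K.≈ α ⊎ α⁻¹ K.^ q K.* α⁻¹ K.≈ K.1#
          cases = K.sum-with-inverse K.1≉0 K.integral αα⁻¹≈1 (K.inverse-^ q αα⁻¹≈1) sum≈

        evaluate-map : ∀ h x → Eval.evaluate h x ≈ Evalⱼ.evaluate (map ι h) x
        evaluate-map h x = reflexive (≡.cong (λ l → eval l x) (map-∘ h))

        module WithIrreducible {e} (f-monic : F[x].MonicOfDegree e f) (f-irreducible : F[x].Irreducible f) where

          -- Turns a period into an equality: `h` has the root x₀ and a degree not exceeding the
          -- period of x₀, so it divides `f`; having a root, it is no unit. `P` is `Q` in case (a)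
          -- and `q` in case (b).
          identify : ∀ {N} P .{{_ : NonZero P}} → Additive P → (∀ x → φ x ^ P ≈ φ x) →
                     (∀ i → 0 < i → x₀ ^ (P ℕ.^ i) ≈ x₀ → N ≤ i) →
                     ∀ h h′ → map ι h K[x].≈ₚ h′ → K[x].MonicOfDegree N h′ → Evalⱼ.evaluate h′ x₀ ≈ 0# →
                     map ι f K[x].≈ₚ h′
          identify P add fixed period h h′ h≈h′ h′-monic h′-root =
            K[x].P.trans (Map.map-cong (F[x].irreducible-monic-∣ f h f-monic h-monic f-irreducible h∤1
              (Eval.ConjugateRoots.commonRoot⇒∣ F._≟_ 1≉0 integral P add fixed f h x₀ h-monic fx₀≈0 h-root period))) h≈h′
            where
            h-monic : F[x].MonicOfDegree _ h
            h-monic = Map.Reflect.monic-reflect F._≟_ h (K[x].monic-resp (K[x].P.sym h≈h′) h′-monic)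
            h-root : Eval.evaluate h x₀ ≈ 0#
            h-root = trans (evaluate-map h x₀) (trans (Evalⱼ.evaluate-cong x₀ h≈h′) h′-root)
            h∤1 : ¬ (h F[x].∣ₚ F[x].constant F.1#)
            h∤1 h∣1 = 1≉0 (trans (sym φ.φ-1) (trans (sym (Eval.evaluate-constant F.1# x₀)) (Eval.evaluate-∣ h∣1 h-root)))

          caseA : CaseA → map ι f K[x].≈ₚ g
          caseA case = identify Q additive-Q φ-fixed-Q (λ i 0<i e → ∣⇒≤ {{>-nonZero 0<i}} (x₀-fixed⇒t∣i i e))
            h g h≈g (D-constant-monic c) g-root
            where
            s∈F : ∃[ s ] ι s K.≈ c
            s∈F = ιImage.fixed⇒∈image (caseA⇒c^q≈c case)
            h : F[x].Poly
            h = F[x].dicksonD t a F[x].-ₚ F[x].constant (proj₁ s∈F)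
            h≈g : map ι h K[x].≈ₚ g
            h≈g = K[x].P.trans (Map.map-- (F[x].dicksonD t a) (F[x].constant (proj₁ s∈F)))
              (K[x].P.+-cong (Map.map-dicksonD t a) (K[x].P.-‿cong (K[x].∷-cong (proj₂ s∈F) K[x].P.refl)))

          caseB : ¬ CaseA → map ι f K[x].≈ₚ g K[x].*ₚ g′
          caseB ¬case = identify q additive-q φ-fixed-q period h (g K[x].*ₚ g′) h≈gg′
            (K[x].monic-* g g′ (D-constant-monic c) (D-constant-monic c′))
            (trans (Evalⱼ.evaluate-* g g′ x₀) (trans (*-congʳ g-root) (zeroˡ _)))
            where
            s∈F : ∃[ s ] ι s K.≈ c K.+ c′
            s∈F = ιImage.fixed⇒∈image (K.trans (additiveₖ c c′) (K.trans (K.+-cong c^q≈c′ c′^q≈c) (K.+-comm c′ c)))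
            w∈F : ∃[ w ] ι w K.≈ c K.* c′
            w∈F = ιImage.fixed⇒∈image (K.trans (K.^-distrib-* c c′ q) (K.trans (K.*-cong c^q≈c′ c′^q≈c) (K.*-comm c′ c)))
            s w : F[x].Poly
            s = F[x].constant (proj₁ s∈F)
            w = F[x].constant (proj₁ w∈F)
            D₀ h : F[x].Poly
            D₀ = F[x].dicksonD t a
            -- The product g g′ as a quadratic polynomial in D; c + c′ and c c′ are fixed by the
            -- q-th power, which exchanges `c` and `c′`.
            h  = D₀ F[x].*ₚ D₀ F[x].-ₚ s F[x].*ₚ D₀ F[x].+ₚ w
            κ κ′ : K[x].Poly
            κ  = K[x].constant c
            κ′ = K[x].constant c′
            h≈gg′ : map ι h K[x].≈ₚ g K[x].*ₚ g′
            h≈gg′ = K[x].P.trans (Map.map-+ (D₀ F[x].*ₚ D₀ F[x].-ₚ s F[x].*ₚ D₀) w) (K[x].P.trans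
              (K[x].P.+-cong
                (K[x].P.trans (Map.map-- (D₀ F[x].*ₚ D₀) (s F[x].*ₚ D₀)) (K[x].P.+-cong
                  (K[x].P.trans (Map.map-* D₀ D₀) (K[x].P.*-cong D₀≈D D₀≈D))
                  (K[x].P.-‿cong (K[x].P.trans (Map.map-* s D₀) (K[x].P.*-cong s≈ D₀≈D)))))
                w≈)
              (quadratic D κ κ′))
              where
              D₀≈D : map ι D₀ K[x].≈ₚ D
              D₀≈D = Map.map-dicksonD t a
              s≈ : map ι s K[x].≈ₚ κ K[x].+ₚ κ′
              s≈ = K[x].∷-cong (proj₂ s∈F) K[x].P.refl
              w≈ : map ι w K[x].≈ₚ κ K[x].*ₚ κ′
              w≈ = K[x].∷-cong (K.trans (proj₂ w∈F) (K.sym (K.+-identityʳ _))) K[x].P.refl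
              quadratic : ∀ D κ κ′ → D K[x].*ₚ D K[x].-ₚ (κ K[x].+ₚ κ′) K[x].*ₚ D K[x].+ₚ κ K[x].*ₚ κ′ K[x].≈ₚ
                                     (D K[x].-ₚ κ) K[x].*ₚ (D K[x].-ₚ κ′)
              quadratic = P.solve 3 (λ D κ κ′ → D P.:* D P.:- (κ P.:+ κ′) P.:* D P.:+ κ P.:* κ′ P.:= (D P.:- κ) P.:* (D P.:- κ′)) K[x].P.refl
                where module P = IntegerSolver K[x].polynomialRing

            -- The q²-th power fixes `c`, so for odd `i` the hypothesis becomes c ^ q = c, which
            -- holds only in case (a).
            c-fixed⇒2∣i : ∀ i → c K.^ (q ℕ.^ i) K.≈ c → ∃[ l ] i ≡ 2 ℕ.* l
            c-fixed⇒2∣i i e = helper (parity i)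
              where
              parity : ∀ i → (∃[ l ] i ≡ 2 ℕ.* l) ⊎ (∃[ l ] i ≡ suc (2 ℕ.* l))
              parity zero    = inj₁ (0 , ≡.refl)
              parity (suc i) = Sum.[ (λ (l , e) → inj₂ (l , ≡.cong suc e)) ,
                                     (λ (l , e) → inj₁ (suc l , ≡.trans (≡.cong suc e) (≡.sym (≡.cong suc (ℕ.+-suc l (l ℕ.+ 0)))))) ]′ (parity i)
              helper : (∃[ l ] i ≡ 2 ℕ.* l) ⊎ (∃[ l ] i ≡ suc (2 ℕ.* l)) → ∃[ l ] i ≡ 2 ℕ.* l
              helper (inj₁ even)    = even
              helper (inj₂ (l , o)) = contradiction (c^q≈c⇒caseA c^q≈c) ¬case
                where
                c^q≈c : c K.^ q K.≈ c
                c^q≈c = K.trans (K.sym (K.fixed⇒fixed-^ Q l (K.trans (K.^-comm c q Q) (K.^-congˡ q (K.fermat cardK c)))))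
                  (K.trans (K.^-assocʳ c q (Q ℕ.^ l)) (K.trans
                    (K.reflexive (≡.cong (c K.^_) (≡.sym (≡.trans (≡.cong (q ℕ.^_) o) (≡.cong (q ℕ.*_) (≡.sym (ℕ.^-*-assoc q 2 l))))))) e))

            -- Being D_t(x₀, a), the element `c` is fixed along with x₀. Hence i = 2 l, and then x₀
            -- ^ (Q ^ l) = x₀ gives t ∣ l.
            period : ∀ i → 0 < i → x₀ ^ (q ℕ.^ i) ≈ x₀ → t ℕ.+ t ≤ i
            period i 0<i e = helper (c-fixed⇒2∣i i (jInjective.φ-injective (begin
              j (c K.^ (q ℕ.^ i))                    ≈⟨ j.φ-^ c (q ℕ.^ i) ⟩
              j c ^ (q ℕ.^ i)                        ≈⟨ ^-congˡ (q ℕ.^ i) D₀[x₀]≈jc ⟨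
              Eval.evaluate D₀ x₀ ^ (q ℕ.^ i)        ≈⟨ Eval.evaluate-frobenius (q ℕ.^ i) {{ℕ.m^n≢0 q i}} (additive-^ {q} i additive-q) (λ x → fixed⇒fixed-^ q i (φ-fixed-q x)) D₀ x₀ ⟨
              Eval.evaluate D₀ (x₀ ^ (q ℕ.^ i))      ≈⟨ Eval.eval-cong (map φ D₀) e ⟩
              Eval.evaluate D₀ x₀                    ≈⟨ D₀[x₀]≈jc ⟩
              j c                                    ∎)))
              where
              D₀[x₀]≈jc : Eval.evaluate D₀ x₀ ≈ j c
              D₀[x₀]≈jc = trans (evaluate-map D₀ x₀) (trans (Evalⱼ.evaluate-cong x₀ (Map.map-dicksonD t a)) D[x₀]≈jc)
              helper : ∃[ l ] i ≡ 2 ℕ.* l → t ℕ.+ t ≤ i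
              helper (l , i≡2l) = ≡.subst (t ℕ.+ t ≤_) (≡.trans (≡.cong (l ℕ.+_) (≡.sym (ℕ.+-identityʳ l))) (≡.sym i≡2l)) (ℕ.+-mono-≤ t≤l t≤l)
                where
                instance
                  l≢0 : NonZero l
                  l≢0 = ℕ.≢-nonZero λ l≡0 → contradiction (≡.trans i≡2l (≡.cong (2 ℕ.*_) l≡0)) λ i≡0 → ℕ.<⇒≢ 0<i (≡.sym i≡0)
                t≤l : t ≤ l
                t≤l = ∣⇒≤ (x₀-fixed⇒t∣i l (trans (reflexive (≡.cong (x₀ ^_) (≡.trans (ℕ.^-*-assoc q 2 l) (≡.cong (q ℕ.^_) (≡.sym i≡2l))))) e))

          conclusion : Conclusion f
          conclusion = α , α≉0 , t , d , ℕ.>-nonZero⁻¹ t , t∣ , α-order , α^[N/t]≈1 , rad∣d , gcd≡1 ,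
                       ¬[α≈1×t≡1] , ¬[α≈-1×t≡1] , caseA , caseB

      conclusion : ∀ {e} → F[x].MonicOfDegree e f → F[x].Irreducible f → Conclusion f
      conclusion f-monic f-irreducible = conclude (Order.order _≟_ ζ (2 ℕ.* (n ℕ.+ 1)) 0<2[n+1] ζ^2[n+1]≈1)
        where
        0<2[n+1] : 0 < 2 ℕ.* (n ℕ.+ 1)
        0<2[n+1] = ℕ.≤-trans (ℕ.m≤n+m 1 n) (ℕ.m≤n*m (n ℕ.+ 1) 2)
        conclude : ∃[ m ] Order.IsOrder _≟_ ζ m → Conclusion f
        conclude (m , _ , ζ^m≈1 , ζ^i≈1⇒m∣i) =
          WithOrder.WithIrreducible.conclusion m (ζ^i≈1⇒m∣i _ ζ^2[n+1]≈1) ζ^m≈1 ζ^i≈1⇒m∣i f-monic f-irreducible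

  module FromExtension {e} (f : F[x].Poly) (f-monic : F[x].MonicOfDegree e f)
    (f-irreducible : F[x].Irreducible f) (f∣E : f F[x].∣ₚ F[x].dicksonE n a) where

    β : K.Carrier
    β = ι (F.inv b b≉0)

    β*ιb≈1 : β K.* ι b K.≈ K.1#
    β*ιb≈1 = K.trans (K.sym (ι.φ-* _ b)) (K.trans (ι.φ-cong (F.trans (F.*-comm _ b) (proj₂ (F.invertible b b≉0)))) ι.φ-1)

    module Tr = Transform K β

    lead : K[x].coeff (map ι f) e K.≈ K.1#
    lead = K.trans (Map.coeff-map f e) (K.trans (ι.φ-cong (proj₁ f-monic)) ι.φ-1)

    T : K[x].Poly
    T = Tr.transform e (map ι f)

    T-monic : K[x].MonicOfDegree (e ℕ.+ e) T
    T-monic = Tr.transform-monic e (map ι f) lead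

    conclusion : RootExtension K T → Conclusion f
    conclusion rootExtension = WithElement.conclusion (record { extension = extension ; ζ = ζ ; ζ′ = ζ′ ; ζζ′≈1 = ζζ′≈1 })
      f f∣E f[x₀]≈0 f-monic f-irreducible
      where
      open RootExtension rootExtension
      open CommutativeRing domain
      open CommutativeRingProperties domain using (eval)
      open IntegerSolver domain using (solve; _:=_; _:+_; _:*_; _:-_; :-_; :0; :1)
      open SetoidReasoning setoid
      module j = HomomorphismProperties K domain isHomomorphism

      ζ E ζ′ B x₀ : Carrier
      ζ  = root
      E  = eval (map embed (drop 1 T)) ζ
      -- The constant coefficient of `T` is 1, so T(ζ) = 1 + ζ E, and this is 0.
      ζ′ = - E
      B  = embed (ι b)
      x₀ = B * ζ + B * ζ′

      ζζ′≈1 : ζ * ζ′ ≈ 1#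
      ζζ′≈1 = begin
        ζ * - E                                       ≈⟨ solve 2 (λ z E → z :* :- E := :1 :- (:1 :+ z :* E)) refl ζ E ⟩
        1# - (1# + ζ * E)                             ≈⟨ +-congˡ (-‿cong (+-congʳ (trans (j.φ-cong (Tr.transform-coeff₀ e (map ι f) lead)) j.φ-1))) ⟨
        1# - (embed (K[x].coeff T 0) + ζ * E)         ≈⟨ +-congˡ (-‿cong (Tr.evaluate-head domain isHomomorphism T ζ)) ⟨
        1# - eval (map embed T) ζ                     ≈⟨ +-congˡ (-‿cong isRoot) ⟩
        1# - 0#                                       ≈⟨ solve 0 (:1 :- :0 := :1) refl ⟩
        1#                                            ∎

      βB≈1 : embed β * B ≈ 1#
      βB≈1 = trans (sym (j.φ-* β (ι b))) (trans (j.φ-cong β*ιb≈1) j.φ-1)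

      βζ≉0 : ¬ (embed β * ζ ≈ 0#)
      βζ≉0 = Inverses.unit≉0 domain 1≉0 {x′ = B * ζ′} (begin
        embed β * ζ * (B * ζ′)      ≈⟨ solve 4 (λ β z b z′ → β :* z :* (b :* z′) := (β :* b) :* (z :* z′)) refl (embed β) ζ B ζ′ ⟩
        embed β * B * (ζ * ζ′)      ≈⟨ trans (*-cong βB≈1 ζζ′≈1) (*-identityˡ 1#) ⟩
        1#                          ∎)

      βζx₀≈1+ζζ : embed β * ζ * x₀ ≈ 1# + ζ * ζ
      βζx₀≈1+ζζ = begin
        embed β * ζ * (B * ζ + B * ζ′)      ≈⟨ solve 4 (λ β z b z′ → β :* z :* (b :* z :+ b :* z′) := (β :* b) :* (z :* z′ :+ z :* z)) refl (embed β) ζ B ζ′ ⟩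
        embed β * B * (ζ * ζ′ + ζ * ζ)      ≈⟨ *-cong βB≈1 (+-congʳ ζζ′≈1) ⟩
        1# * (1# + ζ * ζ)                   ≈⟨ *-identityˡ _ ⟩
        1# + ζ * ζ                          ∎

      f< : K[x].DegreeBelow (suc e) (map ι f)
      f< i e<i = K.trans (Map.coeff-map f i) (K.trans (ι.φ-cong (proj₂ f-monic i e<i)) ι.φ-0)

      -- T(ζ) is the product of (β ζ) ^ e and f(x₀), and β ζ is not zero.
      f[x₀]≈0 : eval (map (embed ∘ ι) f) x₀ ≈ 0#
      f[x₀]≈0 = trans (reflexive (≡.cong (λ l → eval l x₀) (map-∘ f)))
        ([ (λ [βζ]^e≈0 → contradiction (IntegralDomain.x^n≈0⇒x≈0 domain 1≉0 integral e [βζ]^e≈0) βζ≉0) , id ]′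
          (integral _ _ (trans (sym (Tr.evaluate-transform domain isHomomorphism βζx₀≈1+ζζ e (map ι f) f<)) isRoot)))

  irreducibleFactor : ∀ f → F[x].Monic f → F[x].Irreducible f → f F[x].∣ₚ F[x].dicksonE n a → Conclusion f
  -- A monic polynomial of degree 0 is the unit 1. In positive degree the transform has positive
  -- degree too, so a root can be adjoined.
  irreducibleFactor f (zero , f-monic) f-irreducible f∣E = contradiction
    (F[x].constant F.1# , F[x].P.trans (F[x].P.*-identityˡ f) (ConstructRoot.monic0⇒≈1 F cardF f-monic))
    (F[x].Irreducible.p∤1 f-irreducible)
  irreducibleFactor f (suc e , f-monic) f-irreducible f∣E = FromExtension.conclusion f f-monic f-irreducible f∣E
    (ConstructRoot.rootExtension K cardK _ (FromExtension.T-monic f f-monic f-irreducible f∣E))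

open import Data.Nat.Base using (_+_; _*_; _^_)

theorem4p3 :
  ∀ {c₁ ℓ₁ c₂ ℓ₂} (F : Field c₁ ℓ₁) (K : Field c₂ ℓ₂)
    (ι : Field.Carrier F → Field.Carrier K) (q : ℕ) →
  let module F = Field F
      module K = Field K
      module F[x] = Polynomial F
      module K[x] = Polynomial K
  in
  HasCardinality F q →
  HasCardinality K (q ^ 2) →
  IsFieldEmbedding F K ι →
  IsPrimePower q →
  q % 4 ≡ 3 →
  (a : F.Carrier) → ¬ (a F.≈ F.0#) →
  (b : F.Carrier) → b F.^ 2 F.≈ a →
  (n : ℕ) → n % 2 ≡ 1 →
  rad (n + 1) ∣ q ∸ 1 →
  (f : F[x].Poly) →
  F[x].Monic f →
  F[x].Irreducible f →
  f F[x].∣ₚ F[x].dicksonE n a →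
  Σ[ α ∈ K.Carrier ] Σ[ α≉0 ∈ ¬ (α K.≈ K.0#) ] ∃[ t ] ∃[ d ]
    let α⁻¹ = K.inv α α≉0
        g   = K[x].dicksonD t (ι a) K[x].-ₚ
                K[x].constant (ι b K.^ t K.* (α K.+ α⁻¹))
        g′  = K[x].dicksonD t (ι a) K[x].-ₚ
                K[x].constant (ι b K.^ t K.* (α K.^ q K.+ α⁻¹ K.^ q))
        caseA = (∃[ x ] ι x K.≈ α) ⊎ (α K.^ (q + 1) K.≈ K.1#)
    in
    0 < t ×
    t ∣ (2 * (n + 1)) div gcd (2 * (n + 1)) (q ∸ 1) ×
    K.IsMultiplicativeOrder α d ×
    α K.^ ((2 * (n + 1)) div t) K.≈ K.1# ×
    rad t ∣ d ×
    gcd t ((q ^ 2 ∸ 1) div d) ≡ 1 ×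
    ¬ (α K.≈ K.1# × t ≡ 1) ×
    ¬ (α K.≈ K.- K.1# × t ≡ 1) ×
    (caseA → map ι f K[x].≈ₚ g) ×
    (¬ caseA → map ι f K[x].≈ₚ g K[x].*ₚ g′)
theorem4p3 F K ι q cardF cardK ι-hom primePower q%4≡3 a a≉0 b b²≈a n n%2≡1 rad∣q-1 =
  Setting.irreducibleFactor (record
    { q = q ; cardF = cardF ; cardK = cardK ; ι-hom = ι-hom ; primePower = primePower ; q%4≡3 = q%4≡3
    ; a = a ; b = b ; b≉0 = b≉0 ; b²≈a = b²≈a ; n = n ; n%2≡1 = n%2≡1 ; rad∣q-1 = rad∣q-1 })
  where
  module F = Field F
  b≉0 : ¬ (b F.≈ F.0#)
  b≉0 b≈0 = a≉0 (F.trans (F.sym b²≈a) (CommutativeRingProperties.x≈0⇒x^n≈0 F.commutativeRing 2 b≈0))
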